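{- $\mathrm{MC}^*(\cap,\cup,\overline{\phantom{c}},+,-)\in\mathrm{PSPACE}$.
   Context: For $k\ge1$ let $\mathbb N_\infty^k=\mathbb N^k\cup\{\infty\}$ (natural numbers include $0$). Addition on $\mathbb N^k$ is componentwise, and $\infty+m=m+\infty=\infty+\infty=\infty$ for $m\in\mathbb N^k$. Subtraction is partial: for $a,b\in\mathbb N^k$, $a-b$ is defined (componentwise) iff $a_i-b_i\in\mathbb N$ for all $i$; $\infty-m=\infty$ for $m\in\mathbb N^k$; $m-\infty$ and $\infty-\infty$ are undefined. For $A,B\subseteq\mathbb N_\infty^k$: $A\cap B$, $A\cup B$ usual, $A+B=\{a+b:a\in A,b\in B\}$, $A-B=\{a-b: a\in A,b\in B, a-b \text{ defined}\}$, $\overline A=\mathbb N_\infty^k\setminus A$. For $\emptyset\ne\mathcal O\subseteq\{\cup,\cap,\overline{\phantom{c}},+,-\}$, an $\mathcal O$-circuit over $\mathbb N_\infty^k$ is a finite acyclic directed multigraph $C=(V,E,g_C,\alpha)$ with gates of indegree $0,1,2$, a designated output gate $g_C$, input gates labeled by elements of $\mathbb N_\infty^k$, indegree-$1$ gates labeled $\overline{\phantom{c}}$ (only if $\overline{\phantom{c}}\in\mathcal O$), indegree-$2$ gates labeled by operations in $\mathcal O\setminus\{\overline{\phantom{c}}\}$; result sets $I(g)$ are defined inductively ($\{\alpha(g)\}$ for inputs, complement of the predecessor's set, or $I(g_1)\sigma I(g_2)$ with predecessors $g_1\le g_2$), and $I(C)=I(g_C)$. Circuits are encoded as bit strings listing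 gates in reverse topological order with labels and predecessor lists, numbers in binary. $\mathrm{MC}^*(\mathcal O)$ is the set of all $(C,b)$ such that for some $k\ge1$, $C$ is an $\mathcal O$-circuit over $\mathbb N_\infty^k$, $b\in\mathbb N_\infty^k$, and $b\in I(C)$. -}

module Defs where

open import Data.Bool.Base using (Bool; true; false)
open import Data.Digit using (Bit; toDigits)
open import Data.Fin.Base as Fin using (Fin; zero; suc; toℕ)
open import Data.Fin.Induction using (spo-wellFounded)
open import Data.List.Base as List using (List; []; _∷_; _++_; [_]; length; concatMap; foldr; allFin)
open import Data.List.Membership.Propositional using () renaming (_∈_ to _∈ₗ_)
open import Data.List.Relation.Binary.Permutation.Propositional using (_↭_)
open import Data.List.Relation.Unary.AllPairs using (AllPairs)
open import Data.List.Relation.Unary.Any using (here; there)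
open import Data.Nat.Base as ℕ using (ℕ; suc; _≤_)
open import Data.Nat.GeneralisedArithmetic using (fold)
open import Data.Product.Base using (∃; ∃-syntax; ∃₂; _×_; _,_; proj₁)
open import Data.Sum.Base using (_⊎_)
open import Data.Vec.Base as Vec using (Vec; []; _∷_)
open import Data.Vec.Relation.Binary.Pointwise.Inductive using (Pointwise)
open import Function.Bundles using (_↔_; _⇔_)
open import Induction.WellFounded using (Acc; acc; WellFounded)
open import Level using (0ℓ) renaming (suc to lsuc)
open import Relation.Binary.Construct.Closure.Transitive as Plus using (TransClosure)
open import Relation.Binary.Core using (Rel)
open import Relation.Binary.PropositionalEquality using (_≡_; refl; isEquivalence; resp₂)
open import Relation.Nullary.Negation using (¬_)
open import Relation.Unary using (Pred; _∈_; _∩_; _∪_; ∁)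

------------------------------------------------------------------------
-- ℕᵏ ∪ {∞}

data ℕ∞ (k : ℕ) : Set where
  fin : Vec ℕ k → ℕ∞ k
  ∞   : ℕ∞ k

infixl 6 _+_ _⊕_ _⊖_

_+_ : ∀ {k} → ℕ∞ k → ℕ∞ k → ℕ∞ k
fin a + fin b = fin (Vec.zipWith ℕ._+_ a b)
fin _ + ∞     = ∞
∞     + _     = ∞

-- The graph of the partial subtraction: `a - b ≐ c` says that a - b is
-- defined and equal to c.  On the vectors admitted, ∸ does not truncate.
infix 4 _-_≐_

data _-_≐_ {k : ℕ} : ℕ∞ k → ℕ∞ k → ℕ∞ k → Set where
  fin-fin : ∀ {a b} → Pointwise _≤_ b a → fin a - fin b ≐ fin (Vec.zipWith ℕ._∸_ a b)
  ∞-fin   : ∀ {m} → ∞ - fin m ≐ ∞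

_⊕_ : ∀ {k} → Pred (ℕ∞ k) 0ℓ → Pred (ℕ∞ k) 0ℓ → Pred (ℕ∞ k) 0ℓ
(A ⊕ B) c = ∃₂ λ a b → a ∈ A × b ∈ B × a + b ≡ c

_⊖_ : ∀ {k} → Pred (ℕ∞ k) 0ℓ → Pred (ℕ∞ k) 0ℓ → Pred (ℕ∞ k) 0ℓ
(A ⊖ B) c = ∃₂ λ a b → a ∈ A × b ∈ B × a - b ≐ c

------------------------------------------------------------------------
-- Circuits

data BinOp : Set where
  cup cap plus minus : BinOp

data Op : Set where
  compl : Op
  bin   : BinOp → Op

⟦_⟧ : BinOp → ∀ {k} → Pred (ℕ∞ k) 0ℓ → Pred (ℕ∞ k) 0ℓ → Pred (ℕ∞ k) 0ℓ
⟦ cup   ⟧ A B = A ∪ B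
⟦ cap   ⟧ A B = A ∩ B
⟦ plus  ⟧ A B = A ⊕ B
⟦ minus ⟧ A B = A ⊖ B

-- A gate's label together with its incoming edges.  As the predecessors
-- g₁ ≤ g₂ of a binary gate are sorted, this is the same as a multiset of
-- incoming edges; g₁ = g₂ is a double edge.
data Gate (𝒪 : Pred Op 0ℓ) (k n : ℕ) : Set where
  input      : ℕ∞ k → Gate 𝒪 k n
  complement : compl ∈ 𝒪 → Fin n → Gate 𝒪 k n
  binary     : (σ : BinOp) → bin σ ∈ 𝒪 →
               (g₁ g₂ : Fin n) → g₁ Fin.≤ g₂ → Gate 𝒪 k n

predecessors : ∀ {𝒪 k n} → Gate 𝒪 k n → List (Fin n)
predecessors (input _)            = []
predecessors (complement _ g)     = g ∷ []
predecessors (binary _ _ g₁ g₂ _) = g₁ ∷ g₂ ∷ []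

resultOf : ∀ {𝒪 k n} (γ : Gate 𝒪 k n) →
           (∀ h → h ∈ₗ predecessors γ → Pred (ℕ∞ k) 0ℓ) → Pred (ℕ∞ k) 0ℓ
resultOf (input a)            _ = a ≡_
resultOf (complement _ g)     I = ∁ (I g (here refl))
resultOf (binary σ _ g₁ g₂ _) I = ⟦ σ ⟧ (I g₁ (here refl)) (I g₂ (there (here refl)))

-- The numbering of the gates by Fin size need not be topological.
record Circuit (𝒪 : Pred Op 0ℓ) (k : ℕ) : Set where
  field
    size   : ℕ
    gate   : Fin size → Gate 𝒪 k size
    output : Fin size

  infix 4 _◁_

  _◁_ : Rel (Fin size) 0ℓ
  h ◁ g = h ∈ₗ predecessors (gate g)

  field
    acyclic : ∀ g → ¬ TransClosure _◁_ g g

  ◁-wellFounded : WellFounded _◁_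
  ◁-wellFounded = Plus.wellFounded⁻ _◁_ (spo-wellFounded record
    { isEquivalence = isEquivalence
    ; irrefl        = λ { refl → acyclic _ }
    ; trans         = Plus.transitive _◁_
    ; <-resp-≈      = resp₂ _
    })

  resultAcc : ∀ g → Acc _◁_ g → Pred (ℕ∞ k) 0ℓ
  resultAcc g (acc rs) = resultOf (gate g) (λ h h◁g → resultAcc h (rs h◁g))

  I : Fin size → Pred (ℕ∞ k) 0ℓ
  I g = resultAcc g (◁-wellFounded g)

  -- Every gate is listed exactly once, and before all its predecessors.
  ReverseTopological : List (Fin size) → Set
  ReverseTopological gs = gs ↭ allFin size × AllPairs (λ g h → ¬ g ◁ h) gs

------------------------------------------------------------------------
-- Encoding of pairs (C , b) as bit strings

data Token : Set where
  digit    : Bit → Token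
  sep end  : Token
  infinity : Token
  op       : Op → Token

bits : Token → List Bool
bits (digit zero)       = false ∷ false ∷ false ∷ false ∷ []
bits (digit (suc zero)) = false ∷ false ∷ false ∷ true  ∷ []
bits sep                = false ∷ false ∷ true  ∷ false ∷ []
bits end                = false ∷ false ∷ true  ∷ true  ∷ []
bits infinity           = false ∷ true  ∷ false ∷ false ∷ []
bits (op compl)         = false ∷ true  ∷ false ∷ true  ∷ []
bits (op (bin cup))     = false ∷ true  ∷ true  ∷ false ∷ []
bits (op (bin cap))     = false ∷ true  ∷ true  ∷ true  ∷ []
bits (op (bin plus))    = true  ∷ false ∷ false ∷ false ∷ []
bits (op (bin minus))   = true  ∷ false ∷ false ∷ true  ∷ []

-- Binary without superfluous zeros, least significant digit first.
number : ℕ → List Token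
number n = List.map digit (proj₁ (toDigits 2 n)) ++ [ sep ]

value : ∀ {k} → ℕ∞ k → List Token
value (fin a) = concatMap number (Vec.toList a)
value ∞       = [ infinity ]

module _ {𝒪 : Pred Op 0ℓ} {k : ℕ} where

  labelAndPredecessors : ∀ {n} → Gate 𝒪 k n → List Token
  labelAndPredecessors (input a)            = value a
  labelAndPredecessors (complement _ g)     = op compl ∷ number (toℕ g)
  labelAndPredecessors (binary σ _ g₁ g₂ _) =
    op (bin σ) ∷ number (toℕ g₁) ++ number (toℕ g₂)

  -- The encoding does not mention k, which is not a component of (C , b).
  encode : (C : Circuit 𝒪 k) → List (Fin (Circuit.size C)) → ℕ∞ k → List Bool
  encode C gs b = concatMap bits
    (  number (toℕ output) ++ [ end ]
    ++ concatMap (λ g → number (toℕ g) ++ labelAndPredecessors (gate g) ++ [ end ]) gs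
    ++ value b ++ [ end ])
    where open Circuit C

Language : Set₁
Language = Pred (List Bool) 0ℓ

MC* : Pred Op 0ℓ → Language
MC* 𝒪 w = ∃[ k ] 1 ≤ k × ∃[ C ] ∃[ b ] ∃[ gs ]
  let open Circuit {𝒪} {k} C in
  ReverseTopological gs × w ≡ encode C gs b × b ∈ I output

------------------------------------------------------------------------
-- Deterministic multitape Turing machines

Finite : Set → Set
Finite A = ∃[ n ] (A ↔ Fin n)

data Symbol (Γ : Set) : Set where
  blank : Symbol Γ
  bit   : Bool → Symbol Γ
  work  : Γ → Symbol Γ

data Move : Set where
  left stay right : Move

data Control (Q : Set) : Set where
  accept reject : Control Q
  run           : Q → Control Q

-- A two-way infinite tape, restricted to the cells used so far: those to
-- the left of the head (nearest first), the scanned cell, and those to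
-- the right.
record Tape (Γ : Set) : Set where
  constructor tape
  field
    before  : List (Symbol Γ)
    scanned : Symbol Γ
    after   : List (Symbol Γ)

  cells : ℕ
  cells = length before ℕ.+ suc (length after)

move : ∀ {Γ} → Move → Tape Γ → Tape Γ
move left  (tape []       x rs)       = tape [] blank (x ∷ rs)
move left  (tape (l ∷ ls) x rs)       = tape ls l (x ∷ rs)
move stay  t                          = t
move right (tape ls       x [])       = tape (x ∷ ls) blank []
move right (tape ls       x (r ∷ rs)) = tape (x ∷ ls) r rs

act : ∀ {Γ} → Symbol Γ × Move → Tape Γ → Tape Γ
act (y , m) (tape ls _ rs) = move m (tape ls y rs)

emptyTape : ∀ {Γ} → Tape Γ
emptyTape = tape [] blank []

inputTape : ∀ {Γ} → List Bool → Tape Γ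
inputTape []      = emptyTape
inputTape (x ∷ w) = tape [] (bit x) (List.map bit w)

record Configuration (Q Γ : Set) (n : ℕ) : Set where
  constructor _∣_
  field
    control : Control Q
    tapes   : Vec (Tape Γ) n

  space : ℕ
  space = Vec.sum (Vec.map Tape.cells tapes)

open Configuration public using (control; space)

record TuringMachine : Set₁ where
  field
    Q        : Set
    Q-finite : Finite Q
    Γ        : Set
    Γ-finite : Finite Γ
    extra    : ℕ  -- tapes besides the one holding the input
    start    : Control Q
    δ        : Q → Vec (Symbol Γ) (suc extra) →
               Control Q × Vec (Symbol Γ × Move) (suc extra)

  Config : Set
  Config = Configuration Q Γ (suc extra)

  initial : List Bool → Config
  initial w = start ∣ (inputTape w ∷ Vec.replicate extra emptyTape)

  step : Config → Config
  step (accept ∣ ts) = accept ∣ ts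
  step (reject ∣ ts) = reject ∣ ts
  step (run q  ∣ ts) with δ q (Vec.map Tape.scanned ts)
  ... | c , actions = c ∣ Vec.zipWith act actions ts

  configuration : ℕ → List Bool → Config
  configuration t w = fold (initial w) step t

  Accepts Rejects : List Bool → Set
  Accepts w = ∃[ t ] control (configuration t w) ≡ accept
  Rejects w = ∃[ t ] control (configuration t w) ≡ reject

  Decides : Language → Set
  Decides L = ∀ w → (Accepts w ⊎ Rejects w) × (Accepts w ⇔ w ∈ L)

  RunsInSpace : (ℕ → ℕ) → Set
  RunsInSpace s = ∀ w t → space (configuration t w) ≤ s (length w)

-- The polynomial with the given coefficients, constant term first.
polynomial : List ℕ → ℕ → ℕ
polynomial p x = foldr (λ a y → a ℕ.+ x ℕ.* y) 0 p

PSPACE : Pred Language (lsuc 0ℓ)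
PSPACE L = ∃[ M ] ∃[ p ]
  let open TuringMachine M in Decides L × RunsInSpace (polynomial p)

{-# OPTIONS --safe #-}

-- In a circuit over ℕᵏ ∪ {∞} whose constants are smaller than m, membership in the set of a gate at
-- height h depends on components only up to m 2ʰ: a sum at most doubles this threshold, and
-- differences and Boolean operations do not increase it.  So b ∈ I(C) can be decided by a
-- recursion over the gates in which all summands, minuends and subtrahends are guessed below a
-- common bound of polynomial length.  The depth-first evaluation of this recursion needs a stack of
-- polynomial length, and the circuit itself is guessed and compared with the input.
--
-- Polynomial space is handled through functions on ℕ: a program with registers that can only be
-- incremented, decremented and tested runs on a Turing machine with one tape per register, in space
-- linear in the lengths of the binary numerals.  As time is free, the functions computed with registers of
-- polynomial length are closed under composition, recursion with bounded values, bounded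
-- quantification and iteration with bounded states, which suffices to express everything above.
module Submission where

open import Defs renaming (_+_ to _∞+_)

open import Data.Bool.Base using (Bool; true; false)
open import Data.Digit using (Bit; Expansion; fromDigits; toDigits)
open import Data.Empty using (⊥; ⊥-elim)
open import Data.Fin.Base as Fin using (Fin; zero; suc; toℕ; fromℕ<; _↑ˡ_; _↑ʳ_)
open import Data.Fin.Patterns using (0F; 1F; 2F; 3F; 4F; 5F; 6F; 7F; 8F; 9F)
open import Data.Fin.Properties as Fin using (+↔⊎; 1↔⊤; toℕ<n; toℕ-fromℕ<; toℕ-injective)
open import Data.List.Base as List
  using (List; []; _∷_; _++_; length; replicate; _ʳ++_; foldr; concat; concatMap)
  renaming (map to lmap)
open import Data.List.Membership.Propositional using () renaming (_∈_ to _∈ₗ_)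
open import Data.List.Membership.Propositional.Properties using (∈-allFin; ∈-tabulate⁺; ∈-lookup)
open import Data.List.Membership.Propositional.Properties.WithK using (unique∧set⇒bag)
open import Data.List.Properties
  using (length-++; length-map; length-replicate; length-tabulate; ++-assoc; ++-identityʳ; foldr-++)
open import Data.List.Relation.Binary.BagAndSetEquality using (∼bag⇒↭)
open import Data.List.Relation.Binary.Permutation.Propositional using (↭-sym; ↭⇒↭ₛ)
open import Data.List.Relation.Binary.Permutation.Propositional.Properties using (∈-resp-↭; ↭-length)
import Data.List.Relation.Binary.Permutation.Setoid.Properties as Permutationₛ
open import Data.List.Relation.Unary.All as All using ([]; _∷_)
open import Data.List.Relation.Unary.AllPairs using (AllPairs; []; _∷_)
import Data.List.Relation.Unary.AllPairs.Properties as AllPairs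
open import Data.List.Relation.Unary.Any as Any using (here; there)
open import Data.List.Relation.Unary.Any.Properties using (lookup-index)
open import Data.List.Relation.Unary.Unique.Propositional using (Unique)
import Data.List.Relation.Unary.Unique.Propositional.Properties as Unique
open import Data.Nat.Base
open import Data.Nat.DivMod
  using (m/n*n≤m; m/n≤m; m≡m%n+[m/n]*n; m%n<n; +-distrib-/-∣ʳ; m<n⇒m/n≡0; m*n/n≡m;
         m%n≡m∸m/n*n; /-monoˡ-≤; _divMod_; result)
open import Data.Nat.GeneralisedArithmetic using (fold)
open import Data.Nat.Induction using (<′-Rec; <′-wellFounded′)
open import Data.Nat.Properties
open import Data.Product.Base using (∃; ∃₂; _×_; _,_; proj₁; proj₂)
open import Data.Sum.Base using (_⊎_; inj₁; inj₂)
open import Data.Sum.Function.Propositional using (_⊎-↔_)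
open import Data.Unit.Base using (⊤; tt)
open import Data.Vec.Base as Vec
  using (Vec; []; _∷_; lookup; _[_]≔_; map; zipWith; last; init; _∷ʳ_; initLast; tabulate; toList)
  renaming (_++_ to _++ᵛ_)
open import Data.Vec.Properties as Vec
  using ([]≔-idempotent; []≔-lookup; []≔-commutes; lookup∘updateAt; lookup∘updateAt′; lookup-map;
         map-∘; map-cong; tabulate-∘; tabulate-cong; tabulate∘lookup; lookup∘tabulate;
         lookup-++ˡ; lookup-++ʳ; lookup-zipWith; lookup-replicate)
open import Data.Vec.Relation.Binary.Pointwise.Inductive using (Pointwise; []; _∷_)
open import Function.Base using (_∘_; id)
open import Function.Bundles using (mk⇔)
open import Function.Construct.Composition using (_↔-∘_)
open import Function.Construct.Identity using (↔-id)
open import Function.Construct.Symmetry using (↔-sym)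
open import Induction.WellFounded using (module Some; acc)
open import Level using (0ℓ)
open import Relation.Binary.Construct.Closure.Transitive using (TransClosure; [_]; _∷_)
open import Relation.Binary.Definitions using (tri<; tri≈; tri>)
open import Relation.Binary.PropositionalEquality hiding ([_])
open import Relation.Nullary.Decidable.Core using (yes; no)
open import Relation.Nullary.Negation using (¬_; contradiction)
open import Relation.Unary using (Pred; _∈_; U)

-- Counter programs

-- An obstacle is the dimension `k`, which the encoding does not contain. If a vector occurs in the
-- encoding, it contributes at least `k` tokens, so `k` is at most the length of the input. If only
-- `∞` occurs, `k` is not bounded at all, but then the threshold is 0: every set of the circuit
-- contains all vectors or none, and no component has to be known. Certificates with dimension 0
-- cover this case. The constants come from the numeral `w` of the input, whose length is `lg w`,
-- with `2 ^ lg w ≤ w + 1`. The number of gates is at most `lg w` and the constants are at most `w`,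
-- so the threshold is at most `(w + 1)²`. Hence truncated vectors are numbers with at most `lg w`
-- digits in base `1 + (w + 1)²`, and their length is polynomial. Truncation is also what makes
-- differences tractable: the minuend behind an element of a difference may be arbitrarily large,
-- but only its truncation has to be guessed.

infixr 4 _⨾_

data Cmd (n : ℕ) : Set where
  inc dec : Fin n → Cmd n
  _⨾_     : Cmd n → Cmd n → Cmd n
  while   : Fin n → Cmd n → Cmd n
  new     : Cmd (suc n) → Cmd n

-- Only `inc` can lengthen a numeral, so only `inc` checks the bound `2 ^ ℓ`. At its exit `new`
-- demands that the local register be zero again, so that one tape serves all local registers of the
-- same nesting level; `depth` counts these levels.
data Run (ℓ : ℕ) {n : ℕ} : Cmd n → Vec ℕ n → Vec ℕ n → Set where
  inc  : ∀ {i s} → suc (lookup s i) < 2 ^ ℓ → Run ℓ (inc i) s (s [ i ]≔ suc (lookup s i))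
  dec  : ∀ {i s v} → lookup s i ≡ suc v → Run ℓ (dec i) s (s [ i ]≔ v)
  _⨾_  : ∀ {p q s s′ s″} → Run ℓ p s s′ → Run ℓ q s′ s″ → Run ℓ (p ⨾ q) s s″
  stop : ∀ {i p s} → lookup s i ≡ 0 → Run ℓ (while i p) s s
  loop : ∀ {i p s s′ s″ v} → lookup s i ≡ suc v →
         Run ℓ p s s′ → Run ℓ (while i p) s′ s″ → Run ℓ (while i p) s s″
  new  : ∀ {p s s′} → Run ℓ p (0 ∷ s) (0 ∷ s′) → Run ℓ (new p) s s′

depth : ∀ {n} → Cmd n → ℕ
depth (inc _)     = 0
depth (dec _)     = 0
depth (p ⨾ q)     = depth p ⊔ depth q
depth (while _ p) = depth p
depth (new p)     = suc (depth p)

-- Bijective base 2, least significant digit first, with false and true for the digits 1 and 2: so the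
-- input word is itself a register.

numeral : List Bool → ℕ
numeral []          = 0
numeral (false ∷ l) = 1 + 2 * numeral l
numeral (true ∷ l)  = 2 + 2 * numeral l

sucᵇ : List Bool → List Bool
sucᵇ []          = false ∷ []
sucᵇ (false ∷ l) = true ∷ l
sucᵇ (true ∷ l)  = false ∷ sucᵇ l

-- A borrow turns a digit 1 into 2 and moves on. If that 1 is the top digit, there is nothing to
-- borrow from, and the numeral becomes shorter.
predᵇ : List Bool → List Bool
predᵇ []              = []
predᵇ (true ∷ l)      = false ∷ l
predᵇ (false ∷ [])    = []
predᵇ (false ∷ b ∷ l) = true ∷ predᵇ (b ∷ l)

numeral-sucᵇ : ∀ l → numeral (sucᵇ l) ≡ suc (numeral l)
numeral-sucᵇ []          = refl
numeral-sucᵇ (false ∷ l) = refl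
numeral-sucᵇ (true ∷ l)  rewrite numeral-sucᵇ l = cong suc (*-suc 2 (numeral l))

numeral-predᵇ : ∀ b l → suc (numeral (predᵇ (b ∷ l))) ≡ numeral (b ∷ l)
numeral-predᵇ true l             = refl
numeral-predᵇ false []           = refl
numeral-predᵇ false (b ∷ l)      rewrite sym (numeral-predᵇ b l) =
  sym (cong suc (*-suc 2 (numeral (predᵇ (b ∷ l)))))

2^length≤ : ∀ l → 2 ^ length l ≤ suc (numeral l)
2^length≤ [] = ≤-refl
2^length≤ (b ∷ l) = ≤-trans (*-monoʳ-≤ 2 (2^length≤ l)) (≤-trans (≤-reflexive (*-suc 2 (numeral l))) (le b))
  where
  le : ∀ b → 2 + 2 * numeral l ≤ suc (numeral (b ∷ l))
  le false = ≤-refl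
  le true  = n≤1+n _

<2^length : ∀ l → suc (numeral l) < 2 ^ suc (length l)
<2^length [] = ≤-refl
<2^length (b ∷ l) = ≤-trans (le b) (≤-trans (≤-reflexive (sym (*-distribˡ-+ 2 2 (numeral l))))
    (*-monoʳ-≤ 2 (<2^length l)))
  where
  le : ∀ b → 2 + numeral (b ∷ l) ≤ 4 + 2 * numeral l
  le false = n≤1+n _
  le true  = ≤-refl

2^-cancel-≤ : ∀ {a b} → 2 ^ a ≤ 2 ^ b → a ≤ b
2^-cancel-≤ {a} {b} le with a ≤? b
... | yes a≤b = a≤b
... | no a≰b  = contradiction le (<⇒≱ (^-monoʳ-< 2 (s≤s (s≤s z≤n)) (≰⇒> a≰b)))

length≤ : ∀ {ℓ} l → numeral l < 2 ^ ℓ → length l ≤ ℓ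
length≤ l lt = 2^-cancel-≤ (≤-trans (2^length≤ l) lt)

-- Numerals on tapes

Sym : Set
Sym = Symbol ⊥

-- The cells to the left of the least significant digit. An initial tape has none; on its way back
-- the head recognises the end by stepping on a blank there, and this cell remains.
data Edge : List Sym → Set where
  none : Edge []
  one  : Edge (blank ∷ [])

at : List Sym → List Sym → Tape ⊥
at ls []       = tape ls blank []
at ls (x ∷ rs) = tape ls x rs

blanks : ℕ → List Sym
blanks m = replicate m blank

-- The `m` blanks are cells left behind by a longer numeral. They count as space, so they share the
-- bound `H` with the digits.
data Rep (H : ℕ) : Tape ⊥ → ℕ → Set where
  rep : ∀ {ls l m} → Edge ls → length l + m ≤ H → Rep H (at ls (lmap bit l ++ blanks m)) (numeral l)

pattern carry  = zero
pattern borrow = suc zero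
pattern erase  = suc (suc zero)
pattern back   = suc (suc (suc zero))

-- The machine walks away from the least significant digit while it propagates a carry or a borrow,
-- and returns to it in the state back.
δ₁ : Fin 4 → Sym → (⊤ ⊎ Fin 4) × (Sym × Move)
δ₁ carry  (bit true)  = inj₂ carry  , bit false , right
δ₁ carry  (bit false) = inj₂ back   , bit true  , left
δ₁ carry  blank       = inj₂ back   , bit false , left
δ₁ borrow (bit true)  = inj₂ back   , bit false , left
δ₁ borrow (bit false) = inj₂ borrow , bit true  , right
δ₁ borrow blank       = inj₂ erase  , blank     , left
δ₁ erase  _           = inj₂ back   , blank     , left
δ₁ back   blank       = inj₁ tt     , blank     , right
δ₁ back   (bit b)     = inj₂ back   , bit b     , left

data Mini (H : ℕ) : Fin 4 → Tape ⊥ → Tape ⊥ → Set where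
  exit : ∀ {q t a} → Tape.cells t ≤ suc H → δ₁ q (Tape.scanned t) ≡ (inj₁ tt , a) →
         Mini H q t (act a t)
  next : ∀ {q q′ t t′ a} → Tape.cells t ≤ suc H → δ₁ q (Tape.scanned t) ≡ (inj₂ q′ , a) →
         Mini H q′ (act a t) t′ → Mini H q t t′

edge≤1 : ∀ {ls} → Edge ls → length ls ≤ 1
edge≤1 none = z≤n
edge≤1 one  = ≤-refl

length-digits : ∀ l m → length (lmap bit l ++ blanks m) ≡ length l + m
length-digits l m = trans (length-++ (lmap bit l)) (cong₂ _+_ (length-map bit l) (length-replicate m))

cells-zip : ∀ {H} us {ls} X → Edge ls → 1 ≤ H → length us + 1 ≤ H → length us + length X ≤ H →
            Tape.cells (at (lmap bit us ++ ls) X) ≤ suc H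
cells-zip us {ls} X e 1≤H h1 h2 = ≤-trans (go X h2)
    (+-monoʳ-≤ 1 ≤-refl)
  where
  le : length (lmap bit us ++ ls) ≤ suc (length us)
  le = begin
    length (lmap bit us ++ ls)        ≡⟨ length-++ (lmap bit us) ⟩
    length (lmap bit us) + length ls  ≡⟨ cong (_+ length ls) (length-map bit us) ⟩
    length us + length ls             ≤⟨ +-monoʳ-≤ (length us) (edge≤1 e) ⟩
    length us + 1                     ≡⟨ +-comm (length us) 1 ⟩
    suc (length us) ∎
    where open ≤-Reasoning
  go : ∀ X → length us + length X ≤ _ → Tape.cells (at (lmap bit us ++ ls) X) ≤ suc _
  go []       _ = ≤-trans (+-monoˡ-≤ 1 le) (s≤s h1)
  go (x ∷ xs) h = ≤-trans (+-monoˡ-≤ (suc (length xs)) le) (s≤s h)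

rewind : ∀ {H ls} us → Edge ls → ∀ y rs → suc (length us + length rs) ≤ H →
         Mini H back (move left (tape (lmap bit us ++ ls) y rs)) (at (blank ∷ []) (lmap bit us ʳ++ (y ∷ rs)))
rewind [] none y rs h = exit (s≤s h) refl
rewind [] one  y rs h = exit (s≤s h) refl
rewind {H} (u ∷ us) e y rs h =
  next (cells-zip us (bit u ∷ y ∷ rs) e (≤-trans (s≤s z≤n) h)
         (≤-trans (≤-reflexive (+-comm (length us) 1)) (≤-trans (s≤s (m≤m+n _ _)) (≤-trans (n≤1+n _) h)))
         (≤-trans (≤-reflexive (trans (+-suc _ _) (cong suc (+-suc _ _)))) h))
    refl
    (rewind us e (bit u) (y ∷ rs) (≤-trans (≤-reflexive (cong suc (+-suc _ _))) h))

move-right : ∀ ls y rs → move {⊥} right (tape ls y rs) ≡ at (y ∷ ls) rs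
move-right ls y []       = refl
move-right ls y (r ∷ rs) = refl

home : List Sym → Tape ⊥
home = at (blank ∷ [])

-- Generalised to a head in the middle of the numeral: `us` are the digits already passed, nearest
-- first, in their final form. The bound on `sucᵇ l` pays for the new cell if the carry runs off the
-- numeral; if a blank is left over there, it becomes the new digit.
inc-mini : ∀ {H ls} us → Edge ls → ∀ l m → length us + (length l + m) ≤ H → length us + length (sucᵇ l) ≤ H →
  ∃ λ m′ → Mini H carry (at (lmap bit us ++ ls) (lmap bit l ++ blanks m))
                        (home (lmap bit us ʳ++ (lmap bit (sucᵇ l) ++ blanks m′)))
           × length us + (length (sucᵇ l) + m′) ≤ H
inc-mini {H} us e [] zero h h′ = 0 ,
  next (cells-zip us [] e (≤-trans (m≤n+m 1 (length us)) h′) h′ h) refl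
    (rewind us e (bit false) [] (≤-trans (≤-reflexive (trans (cong suc (+-identityʳ _)) (+-comm 1 _))) h′)) ,
        h′
inc-mini {H} us e [] (suc m) h h′ = m ,
  next (cells-zip us (blanks (suc m)) e (≤-trans (m≤n+m 1 (length us)) h′) h′
         (≤-trans (≤-reflexive (cong (length us +_) (length-replicate (suc m)))) h)) refl
    (rewind us e (bit false) (blanks m) (≤-trans
        (≤-reflexive (trans (cong (λ z → suc (length us + z)) (length-replicate m)) (sym (+-suc _ m)))) h)) ,
            h
inc-mini {H} us e (false ∷ l) m h h′ = m ,
  next (cells-zip us (bit false ∷ lmap bit l ++ blanks m) e 1≤H
         (≤-trans (+-monoʳ-≤ (length us) (s≤s z≤n)) h′) le) refl
    (rewind us e (bit true) _ (≤-trans (≤-reflexive (sym (+-suc _ _))) le)) , h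
  where
  le : length us + length (bit {⊥} false ∷ lmap bit l ++ blanks m) ≤ H
  le = ≤-trans (≤-reflexive (cong (λ z → length us + suc z) (length-digits l m))) h
  1≤H : 1 ≤ H
  1≤H = ≤-trans (s≤s z≤n) (≤-trans (m≤n+m _ (length us)) h)
inc-mini {H} {ls} us e (true ∷ l) m h h′ with inc-mini (false ∷ us) e l
    m (≤-trans (≤-reflexive (sym (+-suc _ _))) h) (≤-trans (≤-reflexive (sym (+-suc _ _))) h′)
... | m′ , r , h″ = m′ ,
  next (cells-zip us (bit true ∷ lmap bit l ++ blanks m) e 1≤H
         (≤-trans (+-monoʳ-≤ (length us) (s≤s z≤n)) h) le) refl
    (subst (λ t → Mini H carry t _) (sym (move-right (lmap bit us ++ ls) (bit false) _)) r) ,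
  ≤-trans (≤-reflexive (+-suc _ _)) h″
  where
  le : length us + length (bit {⊥} true ∷ lmap bit l ++ blanks m) ≤ H
  le = ≤-trans (≤-reflexive (cong (λ z → length us + suc z) (length-digits l m))) h
  1≤H : 1 ≤ H
  1≤H = ≤-trans (s≤s z≤n) (≤-trans (m≤n+m _ (length us)) h)

-- The borrow learns that it has passed the top digit only on the blank behind it, which is why one
-- cell beyond the digits is required. By then the top digit 1 has been rewritten to 2, and the
-- state `erase` removes it.
dec-mini : ∀ {H ls} us → Edge ls → ∀ b l m → length us + (length (b ∷ l) + m) ≤ H →
    suc (length us + length (b ∷ l)) ≤ H →
  ∃ λ m′ → Mini H borrow (at (lmap bit us ++ ls) (lmap bit (b ∷ l) ++ blanks m))
                         (home (lmap bit us ʳ++ (lmap bit (predᵇ (b ∷ l)) ++ blanks m′)))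
           × length us + (length (predᵇ (b ∷ l)) + m′) ≤ H
dec-mini {H} us e true l m h h′ = m ,
  next (cells-zip us (bit true ∷ lmap bit l ++ blanks m) e (≤-trans (s≤s z≤n) h′)
         (≤-trans (+-monoʳ-≤ (length us) (s≤s z≤n)) h) le) refl
    (rewind us e (bit false) _ (≤-trans (≤-reflexive (sym (+-suc _ _))) le)) , h
  where
  le : length us + length (bit {⊥} true ∷ lmap bit l ++ blanks m) ≤ H
  le = ≤-trans (≤-reflexive (cong (λ z → length us + suc z) (length-digits l m))) h
dec-mini {H} {ls} us e false [] zero h h′ = 2 ,
  next (cells-zip us (bit false ∷ []) e (≤-trans (s≤s z≤n) h′) h h) refl
    (next (cells-zip (true ∷ us) [] e (≤-trans (s≤s z≤n) h′)
        h′ (≤-trans (≤-reflexive (+-identityʳ _)) (≤-trans (s≤s (m≤m+n _ 1)) h′))) refl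
      (next (cells-zip us (bit true ∷ blank ∷ []) e (≤-trans (s≤s z≤n) h′) (≤-trans (n≤1+n _) h′)
          (≤-trans (≤-reflexive (+-suc _ 1)) h′)) refl
        (rewind us e blank (blank ∷ []) h′))) ,
  ≤-trans (≤-reflexive (+-suc _ 1)) h′
dec-mini {H} {ls} us e false [] (suc m) h h′ = 2 + m ,
  next (cells-zip us (bit false ∷ blanks (suc m)) e (≤-trans (s≤s z≤n) h′) (≤-trans (n≤1+n _) h′) le) refl
    (next (cells-zip (true ∷ us) (blanks (suc m)) e (≤-trans (s≤s z≤n) h′)
        h′ (≤-trans (≤-reflexive (sym (+-suc _ _))) le)) refl
      (next (cells-zip us (bit true ∷ blank ∷ blanks m) e (≤-trans (s≤s z≤n) h′) (≤-trans (n≤1+n _) h′) le)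
          refl
        (rewind us e blank (blank ∷ blanks m) (≤-trans (≤-reflexive (sym (+-suc _ _))) le)))) ,
  h
  where
  le : length us + (2 + length (blanks m)) ≤ H
  le = ≤-trans (≤-reflexive (cong (λ z → length us + (2 + z)) (length-replicate m))) h
dec-mini {H} {ls} us e false (b ∷ l) m h h′ with dec-mini (true ∷ us) e b l
    m (≤-trans (≤-reflexive (sym (+-suc _ _))) h) (≤-trans (≤-reflexive (cong suc (sym (+-suc _ _)))) h′)
... | m′ , r , h″ = m′ ,
  next (cells-zip us (bit false ∷ lmap bit (b ∷ l) ++ blanks m) e (≤-trans (s≤s z≤n) h′)
         (≤-trans (+-monoʳ-≤ (length us) (s≤s z≤n)) h) le) refl r ,
  ≤-trans (≤-reflexive (+-suc _ _)) h″
  where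
  le : length us + length (bit {⊥} false ∷ lmap bit (b ∷ l) ++ blanks m) ≤ H
  le = ≤-trans (≤-reflexive (cong (λ z → length us + suc z) (length-digits (b ∷ l) m))) h

-- Compilation of counter programs

-- The ways to place a context of n registers on N tapes; push sets a tape aside for a local register.
data _⊑_ (n N : ℕ) : Set where
  full : n ≡ N → n ⊑ N
  push : suc n ⊑ N → n ⊑ N

room : ∀ {n N} → n ⊑ N → ℕ
room (full _) = 0
room (push e) = suc (room e)

embed : ∀ {n N} → n ⊑ N → Vec ℕ n → Vec ℕ N
embed (full refl) s = s
embed (push e)    s = embed e (0 ∷ s)

reg : ∀ {n N} → n ⊑ N → Fin n → Fin N
reg (full refl) i = i
reg (push e)    i = reg e (suc i)

lookup-embed : ∀ {n N} (e : n ⊑ N) s i → lookup (embed e s) (reg e i) ≡ lookup s i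
lookup-embed (full refl) s i = refl
lookup-embed (push e)    s i = lookup-embed e (0 ∷ s) (suc i)

embed-update : ∀ {n N} (e : n ⊑ N) s i v → embed e s [ reg e i ]≔ v ≡ embed e (s [ i ]≔ v)
embed-update (full refl) s i v = refl
embed-update (push e)    s i v = embed-update e (0 ∷ s) (suc i) v

St : ∀ {n} → Cmd n → Set
St (inc _)     = Fin 4
St (dec _)     = Fin 4
St (p ⨾ q)     = St p ⊎ St q
St (while _ p) = ⊤ ⊎ St p
St (new p)     = St p

entry : ∀ {n} (p : Cmd n) → St p
entry (inc _)     = carry
entry (dec _)     = borrow
entry (p ⨾ _)     = inj₁ (entry p)
entry (while _ p) = inj₁ tt
entry (new p)     = entry p

idle : ∀ {N} → Vec Sym N → Vec (Sym × Move) N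
idle = map (_, stay)

isBlank : {A : Set} → Sym → A → A → A
isBlank blank   x y = x
isBlank (bit _) x y = y

leave : {A : Set} → A → (Fin 4 → A) → ⊤ ⊎ Fin 4 → A
leave x k (inj₁ _) = x
leave x k (inj₂ q) = k q

mini-tr : ∀ {N} → Fin N → Fin 4 → {Q : Set} → (Fin 4 → Control Q) → Control Q →
          Vec Sym N → Control Q × Vec (Sym × Move) N
mini-tr i q k x ss = leave x k (proj₁ (δ₁ q (lookup ss i))) , idle ss [ i ]≔ proj₂ (δ₁ q (lookup ss i))

-- The transitions of p, given where its states are placed by k and where to go at its exit x.
tr : ∀ {n N} (p : Cmd n) → n ⊑ N → St p → {Q : Set} → (St p → Control Q) → Control Q →
     Vec Sym N → Control Q × Vec (Sym × Move) N
tr (inc i) e q k x ss = mini-tr (reg e i) q k x ss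
tr (dec i) e q k x ss = mini-tr (reg e i) q k x ss
tr (p ⨾ q) e (inj₁ s) k x ss = tr p e s (k ∘ inj₁) (k (inj₂ (entry q))) ss
tr (p ⨾ q) e (inj₂ s) k x ss = tr q e s (k ∘ inj₂) x ss
tr (while i p) e (inj₁ _) k x ss = isBlank (lookup ss (reg e i)) x (k (inj₂ (entry p))) , idle ss
tr (while i p) e (inj₂ s) k x ss = tr p e s (k ∘ inj₂) (k (inj₁ tt)) ss
tr (new p) (full _) s k x ss = x , idle ss
tr (new p) (push e) s k x ss = tr p e s k x ss

idle-act : ∀ {N} (ts : Vec (Tape ⊥) N) → zipWith act (idle (map Tape.scanned ts)) ts ≡ ts
idle-act []       = refl
idle-act (t ∷ ts) = cong (t ∷_) (idle-act ts)

update-act : ∀ {N} (ts : Vec (Tape ⊥) N) i a →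
  zipWith act (idle (map Tape.scanned ts) [ i ]≔ a) ts ≡ ts [ i ]≔ act a (lookup ts i)
update-act (t ∷ ts) zero    a = cong (_ ∷_) (idle-act ts)
update-act (t ∷ ts) (suc i) a = cong (t ∷_) (update-act ts i a)

record Small {N} (H : ℕ) (ts : Vec (Tape ⊥) N) : Set where
  constructor mk
  field small : ∀ i → Tape.cells (lookup ts i) ≤ suc H
open Small public

small-update : ∀ {N H} {ts : Vec (Tape ⊥) N} → Small H ts → ∀ i {t} → Tape.cells t ≤ suc H →
    Small H (ts [ i ]≔ t)
small-update {ts = ts} h i {t} le .small j with i Fin.≟ j
... | yes refl = subst (λ t′ → Tape.cells t′ ≤ _) (sym (lookup∘updateAt i ts)) le
... | no i≢j   = subst (λ t′ → Tape.cells t′ ≤ _) (sym (lookup∘updateAt′ j i (i≢j ∘ sym) ts)) (h .small j)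

record Reps {N} (H : ℕ) (ts : Vec (Tape ⊥) N) (s : Vec ℕ N) : Set where
  constructor mk
  field reps : ∀ i → Rep H (lookup ts i) (lookup s i)
open Reps public

reps-update : ∀ {N H} {ts : Vec (Tape ⊥) N} {s} → Reps H ts s → ∀ i {t v} → Rep H t v →
    Reps H (ts [ i ]≔ t) (s [ i ]≔ v)
reps-update {ts = ts} {s} h i {t} {v} r .reps j with i Fin.≟ j
... | yes refl = subst₂ (Rep _) (sym (lookup∘updateAt i ts)) (sym (lookup∘updateAt i s)) r
... | no i≢j   = subst₂ (Rep _) (sym (lookup∘updateAt′ j i (i≢j ∘ sym) ts))
    (sym (lookup∘updateAt′ j i (i≢j ∘ sym) s)) (h .reps j)

rep-small : ∀ {H t v} → 1 ≤ H → Rep H t v → Tape.cells t ≤ suc H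
rep-small {H} 1≤H (rep {ls} {l} {m} e h) =
  cells-zip [] (lmap bit l ++ blanks m) e 1≤H 1≤H (≤-trans (≤-reflexive (length-digits l m)) h)

reps-small : ∀ {N H} {ts : Vec (Tape ⊥) N} {s} → 1 ≤ H → Reps H ts s → Small H ts
reps-small 1≤H r .small i = rep-small 1≤H (r .reps i)

-- Zero is the empty numeral and has no other representation, so the symbol under the head decides
-- the test of a `while`.
zero-blank : ∀ {H t} → Rep H t 0 → Tape.scanned t ≡ blank
zero-blank r = go r refl
  where
  go : ∀ {H t v} → Rep H t v → v ≡ 0 → Tape.scanned t ≡ blank
  go (rep {l = []} {zero} e h)  eq = refl
  go (rep {l = []} {suc m} e h) eq = refl
  go (rep {l = false ∷ l} e h) ()
  go (rep {l = true ∷ l} e h) ()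

suc-bit : ∀ {H t v} → Rep H t (suc v) → ∃ λ b → Tape.scanned t ≡ bit b
suc-bit r = go r refl
  where
  go : ∀ {H t u v} → Rep H t u → u ≡ suc v → ∃ λ b → Tape.scanned t ≡ bit b
  go (rep {l = []} e h) ()
  go (rep {l = b ∷ l} e h) eq = b , refl

inc-rep : ∀ {ℓ t v} → Rep (suc ℓ) t v → suc v < 2 ^ ℓ → ∃ λ t′ →
    Mini (suc ℓ) carry t t′ × Rep (suc ℓ) t′ (suc v)
inc-rep {ℓ} (rep {l = l} {m} e h) lt with inc-mini {suc ℓ} [] e l m h
    (≤-trans (length≤ (sucᵇ l) (≤-trans (≤-reflexive (cong suc (numeral-sucᵇ l))) lt)) (n≤1+n ℓ))
... | m′ , r , h′ = _ , r , subst (Rep _ _) (numeral-sucᵇ l) (rep {l = sucᵇ l} {m′} one h′)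

dec-rep : ∀ {ℓ t v} → Rep (suc ℓ) t (suc v) → suc v < 2 ^ ℓ → ∃ λ t′ →
    Mini (suc ℓ) borrow t t′ × Rep (suc ℓ) t′ v
dec-rep {ℓ} r lt = go r refl lt
  where
  go : ∀ {t u v} → Rep (suc ℓ) t u → u ≡ suc v → suc v < 2 ^ ℓ → ∃ λ t′ →
      Mini (suc ℓ) borrow t t′ × Rep (suc ℓ) t′ v
  go (rep {l = []} e h) ()
  go (rep {l = b ∷ l} {m} e h) eq lt with dec-mini [] e b l m
      h (s≤s (length≤ (b ∷ l) (subst (_< 2 ^ ℓ) (sym eq) lt)))
  ... | m′ , r , h′ = _ , r , subst (Rep _ _) (suc-injective (trans (numeral-predᵇ b l) eq))
      (rep {l = predᵇ (b ∷ l)} {m′} one h′)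

record Below {n} (ℓ : ℕ) (s : Vec ℕ n) : Set where
  constructor mk
  field below : ∀ i → lookup s i < 2 ^ ℓ
open Below public

below-update : ∀ {n ℓ} {s : Vec ℕ n} → Below ℓ s → ∀ i {v} → v < 2 ^ ℓ → Below ℓ (s [ i ]≔ v)
below-update {s = s} h i {v} lt .below j with i Fin.≟ j
... | yes refl = subst (_< _) (sym (lookup∘updateAt i s)) lt
... | no i≢j   = subst (_< _) (sym (lookup∘updateAt′ j i (i≢j ∘ sym) s)) (h .below j)

below-∷ : ∀ {n ℓ v} {s : Vec ℕ n} → v < 2 ^ ℓ → Below ℓ s → Below ℓ (v ∷ s)
below-∷ lt h .below zero    = lt
below-∷ lt h .below (suc i) = h .below i

run-below : ∀ {n ℓ} {p : Cmd n} {s s′} → Run ℓ p s s′ → Below ℓ s → Below ℓ s′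
run-below (inc {i} lt) h = below-update h i lt
run-below (dec {i} eq) h = below-update h i (≤-trans (≤-trans (n≤1+n _) (≤-reflexive (cong suc (sym eq))))
    (h .below i))
run-below (r ⨾ r′) h = run-below r′ (run-below r h)
run-below (stop _) h = h
run-below (loop _ r r′) h = run-below r′ (run-below r h)
run-below {ℓ = ℓ} (new r) h .below i = run-below r (below-∷ (m^n>0 2 ℓ) h) .below (suc i)

-- Simulation of counter programs by a machine

module Simulation {Q : Set} {N : ℕ} (δ : Q → Vec Sym N → Control Q × Vec (Sym × Move) N) where

  infix 4 _⊢_⟶_

  data _⊢_⟶_ (H : ℕ) : Control Q × Vec (Tape ⊥) N → Control Q × Vec (Tape ⊥) N → Set where
    done : ∀ {c} → H ⊢ c ⟶ c
    next : ∀ {k q ts x as ts′ c} → k ≡ run q → Small H ts → δ q (map Tape.scanned ts) ≡ (x , as) →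
           zipWith act as ts ≡ ts′ → H ⊢ (x , ts′) ⟶ c → H ⊢ (k , ts) ⟶ c

  _⟫_ : ∀ {H c c′ c″} → H ⊢ c ⟶ c′ → H ⊢ c′ ⟶ c″ → H ⊢ c ⟶ c″
  done ⟫ r = r
  next a b c d r ⟫ r′ = next a b c d (r ⟫ r′)

  -- Asks only that the machine behave like `tr` on the states placed by `k`. Composing `k` with an
  -- injection into a sum therefore places a part of a program that is already placed.
  Placed : ∀ {n} (p : Cmd n) → n ⊑ N → (St p → Control Q) → Control Q → Set
  Placed p e k x = ∀ s → ∃ λ q → k s ≡ run q × (∀ ss → δ q ss ≡ tr p e s k x ss)

  mini : ∀ {H k x} i → (∀ s → ∃ λ q → k s ≡ run q × (∀ ss → δ q ss ≡ mini-tr i s k x ss)) →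
         ∀ {q t t′} → Mini H q t t′ → ∀ ts → lookup ts i ≡ t → Small H ts →
             H ⊢ (k q , ts) ⟶ (x , ts [ i ]≔ t′)
  mini {k = k} {x} i pl {q} (exit {t = t} {a} c≤ eq) ts refl sm with pl q
  ... | q′ , kq , δq = next kq sm (trans (δq _) δ≡) (update-act ts i a) done
    where
    δ≡ : mini-tr i q k x (map Tape.scanned ts) ≡ (x , idle (map Tape.scanned ts) [ i ]≔ a)
    δ≡ rewrite lookup-map i Tape.scanned ts | eq = refl
  mini {H} {k = k} {x} i pl {q} {t′ = t″} (next {q′ = q₁} {a = a} c≤ eq r) ts refl sm with pl q
  ... | q′ , kq , δq = next kq sm (trans (δq _) δ≡) (update-act ts i a)
      (subst (λ z → H ⊢ _ ⟶ (x , z)) ([]≔-idempotent ts i)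
        (mini i pl r (ts [ i ]≔ act a (lookup ts i)) (lookup∘updateAt i ts) (small-update sm i (small₁ r))))
    where
    small₁ : ∀ {q t t′} → Mini H q t t′ → Tape.cells t ≤ suc H
    small₁ (exit c _)   = c
    small₁ (next c _ _) = c
    δ≡ : mini-tr i q k x (map Tape.scanned ts) ≡ (k q₁ , idle (map Tape.scanned ts) [ i ]≔ a)
    δ≡ rewrite lookup-map i Tape.scanned ts | eq = refl

  -- By induction on the derivation of `Run`, which is finite for loops too; the termination of the
  -- machine is inherited from it. `Below` is carried along because a decrement needs a bound on the
  -- length of its register.
  simulate : ∀ {ℓ n} {p : Cmd n} {e k x s s′ ts} → Placed p e k x → depth p ≤ room e → Run ℓ p s s′ →
      Below ℓ s →
    Reps (suc ℓ) ts (embed e s) →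
    ∃ λ ts′ → (suc ℓ ⊢ (k (entry p) , ts) ⟶ (x , ts′)) × Reps (suc ℓ) ts′ (embed e s′)
  simulate {e = e} {s = s} {ts = ts} pl d (inc {i} lt) b r
    with inc-rep (subst (Rep _ _) (lookup-embed e s i) (r .reps (reg e i))) lt
  ... | t′ , m , r′ = _ , mini (reg e i) pl m ts refl (reps-small (s≤s z≤n) r) ,
                      subst (Reps _ _) (embed-update e s i _) (reps-update r (reg e i) r′)
  simulate {e = e} {s = s} {ts = ts} pl d (dec {i} eq) b r
    with dec-rep (subst (Rep _ _) (trans (lookup-embed e s i) eq) (r .reps (reg e i)))
        (subst (_< _) eq (b .below i))
  ... | t′ , m , r′ = _ , mini (reg e i) pl m ts refl (reps-small (s≤s z≤n) r) ,
                      subst (Reps _ _) (embed-update e s i _) (reps-update r (reg e i) r′)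
  simulate {p = p ⨾ q} pl d (h ⨾ h′) b r
    with simulate {p = p} (pl ∘ inj₁) (≤-trans (m≤m⊔n _ _) d) h b r
  ... | ts₁ , c₁ , r₁ with simulate {p = q} (pl ∘ inj₂) (≤-trans (m≤n⊔m (depth p) _) d) h′ (run-below h b) r₁
  ... | ts₂ , c₂ , r₂ = ts₂ , c₁ ⟫ c₂ , r₂
  simulate {p = while i p} {e = e} {s = s} {ts = ts} pl d (stop eq) b r with pl (inj₁ tt)
  ... | q , kq , δq = ts , next kq (reps-small (s≤s z≤n) r) (trans (δq _) (cong₂ _,_ exits refl))
      (idle-act ts) done , r
    where
    exits : ∀ {A : Set} {x y : A} → isBlank (lookup (map Tape.scanned ts) (reg e i)) x y ≡ x
    exits rewrite lookup-map (reg e i) Tape.scanned ts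
                | zero-blank (subst (Rep _ _) (trans (lookup-embed e s i) eq) (r .reps (reg e i))) = refl
  simulate {p = while i p} {e = e} {s = s} {ts = ts} pl d (loop eq h h′) b r
    with simulate {p = p} (pl ∘ inj₂) d h b r
  ... | ts₁ , c₁ , r₁ with simulate {p = while i p} pl d h′ (run-below h b) r₁
  ... | ts₂ , c₂ , r₂ with pl (inj₁ tt)
  ... | q , kq , δq = ts₂ , next kq (reps-small (s≤s z≤n) r) (trans (δq _) (cong₂ _,_ enters refl))
      (idle-act ts) (c₁ ⟫ c₂) , r₂
    where
    enters : ∀ {A : Set} {x y : A} → isBlank (lookup (map Tape.scanned ts) (reg e i)) x y ≡ y
    enters rewrite lookup-map (reg e i) Tape.scanned ts
                 | proj₂ (suc-bit (subst (Rep _ _) (trans (lookup-embed e s i) eq) (r .reps (reg e i)))) =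
                     refl
  simulate {p = new p} {e = full _} pl () (new h) b r
  simulate {ℓ} {p = new p} {e = push e} pl (s≤s d) (new h) b r =
    simulate {p = p} {e = e} pl d h (below-∷ (m^n>0 2 ℓ) b) r

St-finite : ∀ {n} (p : Cmd n) → Finite (St p)
St-finite (inc _)     = 4 , ↔-id _
St-finite (dec _)     = 4 , ↔-id _
St-finite (p ⨾ q)     with St-finite p | St-finite q
... | m , f | n , g   = m + n , ↔-sym +↔⊎ ↔-∘ (f ⊎-↔ g)
St-finite (while _ p) with St-finite p
... | m , f           = suc m , ↔-sym +↔⊎ ↔-∘ (↔-sym 1↔⊤ ⊎-↔ f)
St-finite (new p)     = St-finite p

-- The machine of a counter program

pad : ∀ {A : Set} {n N} → A → n ⊑ N → Vec A n → Vec A N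
pad z (full refl) s = s
pad z (push e)    s = pad z e (z ∷ s)

pad-embed : ∀ {n N} (e : n ⊑ N) s → pad 0 e s ≡ embed e s
pad-embed (full refl) s = refl
pad-embed (push e)    s = pad-embed e (0 ∷ s)

pad-snoc : ∀ {A : Set} {m M} (z : A) (e : suc m ⊑ suc M) x →
           pad z e (Vec.replicate m z ∷ʳ x) ≡ Vec.replicate M z ∷ʳ x
pad-snoc z (full refl) x = refl
pad-snoc z (push e)    x = pad-snoc z e x

fit : ∀ d n {N} → d + n ≡ N → n ⊑ N
fit zero    n eq = full eq
fit (suc d) n eq = push (fit d (suc n) (trans (+-suc d n) eq))

room-fit : ∀ d n {N} (eq : d + n ≡ N) → room (fit d n eq) ≡ d
room-fit zero    n eq = refl
room-fit (suc d) n eq = cong suc (room-fit d (suc n) _)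

empty-rep : ∀ {ℓ} → Rep (suc ℓ) emptyTape 0
empty-rep = rep {l = []} {m = 0} none z≤n

pad-reps : ∀ {ℓ n N} (e : n ⊑ N) {ts s} → Reps (suc ℓ) ts s → Reps (suc ℓ) (pad emptyTape e ts) (pad 0 e s)
pad-reps (full refl) r = r
pad-reps (push e) r = pad-reps e (mk λ where
  zero    → empty-rep
  (suc i) → r .reps i)

input-rep : ∀ {ℓ} w → length w ≤ ℓ → Rep (suc ℓ) (inputTape w) (numeral w)
input-rep {ℓ} w h = subst (λ t → Rep (suc ℓ) t (numeral w)) (eq w)
    (rep {l = w} {m = 0} none (≤-trans (≤-reflexive (+-identityʳ _)) (≤-trans h (n≤1+n ℓ))))
  where
  eq : ∀ w → at [] (lmap bit w ++ []) ≡ inputTape w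
  eq []      = refl
  eq (b ∷ w) = cong (tape [] (bit b)) (++-identityʳ (lmap bit w))

-- The input tape is the first tape of a machine but holds the outermost register.
toLast : ∀ {A : Set} {n} → Vec A (suc n) → Vec A (suc n)
toLast (x ∷ xs) = xs ∷ʳ x

fromLast : ∀ {A : Set} {n} → Vec A (suc n) → Vec A (suc n)
fromLast xs = last xs ∷ init xs

fromLast-∷ʳ : ∀ {A : Set} {n} (xs : Vec A n) x → fromLast (xs ∷ʳ x) ≡ x ∷ xs
fromLast-∷ʳ xs x = cong₂ _∷_ (Vec.last-∷ʳ x xs) (Vec.init-∷ʳ x xs)

zipWith-∷ʳ : ∀ {A B C : Set} {n} (f : A → B → C) (xs : Vec A n) x (ys : Vec B n) y →
             zipWith f (xs ∷ʳ x) (ys ∷ʳ y) ≡ zipWith f xs ys ∷ʳ f x y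
zipWith-∷ʳ f []       x []       y = refl
zipWith-∷ʳ f (_ ∷ xs) x (_ ∷ ys) y = cong (_ ∷_) (zipWith-∷ʳ f xs x ys y)

sum-cells-∷ʳ : ∀ {n} (ts : Vec (Tape ⊥) n) t →
  Vec.sum (map Tape.cells (ts ∷ʳ t)) ≡ Vec.sum (map Tape.cells (t ∷ ts))
sum-cells-∷ʳ []       t = refl
sum-cells-∷ʳ (u ∷ ts) t rewrite sum-cells-∷ʳ ts t =
  trans (sym (+-assoc (Tape.cells u) (Tape.cells t) _))
    (trans (cong (_+ Vec.sum (map Tape.cells ts)) (+-comm (Tape.cells u) _))
        (+-assoc (Tape.cells t) (Tape.cells u) _))

small-sum : ∀ {n H} {ts : Vec (Tape ⊥) n} → Small H ts → Vec.sum (map Tape.cells ts) ≤ n * suc H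
small-sum {ts = []}     h = z≤n
small-sum {ts = t ∷ ts} h = +-mono-≤ (h .small zero) (small-sum {ts = ts} (mk λ i → h .small (suc i)))

act-fromLast : ∀ {n} (as : Vec (Sym × Move) (suc n)) ts →
  zipWith act (fromLast as) (fromLast ts) ≡ fromLast (zipWith act as ts)
act-fromLast as ts with initLast as | initLast ts
... | as′ , a , refl | ts′ , t , refl = sym (trans (cong fromLast (zipWith-∷ʳ act as′ a ts′ t))
    (fromLast-∷ʳ _ _))

scan-fromLast : ∀ {n} (ts : Vec (Tape ⊥) (suc n)) →
    toLast (map Tape.scanned (fromLast ts)) ≡ map Tape.scanned ts
scan-fromLast ts with initLast ts
... | ts′ , t , refl = sym (Vec.map-∷ʳ Tape.scanned t ts′)

sum-fromLast : ∀ {n} (ts : Vec (Tape ⊥) (suc n)) →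
    Vec.sum (map Tape.cells (fromLast ts)) ≡ Vec.sum (map Tape.cells ts)
sum-fromLast ts with initLast ts
... | ts′ , t , refl = sym (sum-cells-∷ʳ ts′ t)

isBlank-zero : ∀ {H t v} {A : Set} {x y : A} → Rep H t v → v ≡ 0 → isBlank (Tape.scanned t) x y ≡ x
isBlank-zero r refl rewrite zero-blank r = refl

isBlank-suc : ∀ {H t v u} {A : Set} {x y : A} → Rep H t v → v ≡ suc u → isBlank (Tape.scanned t) x y ≡ y
isBlank-suc r refl rewrite proj₂ (suc-bit r) = refl

module Machine (P : Cmd 1) where

  d = depth P

  e : 1 ⊑ suc d
  e = fit d 1 (+-comm d 1)

  Q = ⊤ ⊎ St P

  place : St P → Control Q
  place = run ∘ inj₂

  δ : Q → Vec Sym (suc d) → Control Q × Vec (Sym × Move) (suc d)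
  -- The only state outside `P`. It is entered when `P` ends and accepts if the outermost register
  -- is positive.
  δ (inj₁ _) ss = isBlank (lookup ss (reg e zero)) reject accept , idle ss
  δ (inj₂ s) ss = tr P e s place (run (inj₁ tt)) ss

  open Simulation δ

  machine : TuringMachine
  machine = record
    { Q        = Q
    ; Q-finite = let m , f = St-finite P in suc m , ↔-sym +↔⊎ ↔-∘ (↔-sym 1↔⊤ ⊎-↔ f)
    ; Γ        = ⊥
    ; Γ-finite = 0 , ↔-sym Fin.0↔⊥
    ; extra    = d
    ; start    = place (entry P)
    ; δ        = λ q ss → let c , as = δ q (toLast ss) in c , fromLast as
    }

  open TuringMachine machine using (Config; step; initial; configuration; Accepts; Rejects; Decides;
      RunsInSpace)

  data Halted : Control Q → Set where
    accept : Halted accept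
    reject : Halted reject

  step-halted : ∀ {x} ts → Halted x → step (x ∣ ts) ≡ x ∣ ts
  step-halted ts accept = refl
  step-halted ts reject = refl

  fold-step : ∀ (c : Config) t → fold c step (suc t) ≡ fold (step c) step t
  fold-step c zero    = refl
  fold-step c (suc t) = cong step (fold-step c t)

  fold-halted : ∀ {x} ts → Halted x → ∀ t → fold (x ∣ ts) step t ≡ x ∣ ts
  fold-halted ts h zero    = refl
  fold-halted ts h (suc t) = trans (cong step (fold-halted ts h t)) (step-halted ts h)

  space-bound : ∀ {H} {ts : Vec (Tape ⊥) (suc d)} {x : Control Q} → Small H ts →
      space (x ∣ fromLast ts) ≤ suc d * suc H
  space-bound {H} {ts} {x} sm = ≤-trans (≤-reflexive (sum-fromLast ts)) (small-sum {ts = ts} sm)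

  -- A halted configuration is a fixed point of `step`. So only the finitely many configurations of
  -- the trace ever occur, all of them small, and the space bound holds at every time.
  trace : ∀ {H k ts x ts′} → H ⊢ (k , ts) ⟶ (x , ts′) → Halted x → Small H ts′ →
          (∀ t → space (fold (k ∣ fromLast ts) step t) ≤ suc d * suc H) ×
          ∃ λ t → fold (k ∣ fromLast ts) step t ≡ x ∣ fromLast ts′
  trace {H} {x = x} {ts′ = ts′} done h sm =
    (λ t → subst (λ c → space c ≤ suc d * suc H) (sym (fold-halted (fromLast ts′) h t))
        (space-bound {ts = ts′} {x} sm)) , 0 , refl
  trace {H} {ts = ts} {ts′ = ts′} (next {q = q} {x = x₁} {as} {ts₁} refl sm₁ eq refl r) h sm with trace r h sm
  ... | sp , t , eq′ = (λ where
      zero    → space-bound {ts = ts} {run q} sm₁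
      (suc t) → subst (λ c → space c ≤ suc d * suc H) (sym (fold₁ t)) (sp t)) ,
    suc t , trans (fold₁ t) eq′
    where
    step₁ : step (run q ∣ fromLast ts) ≡ x₁ ∣ fromLast ts₁
    step₁ rewrite scan-fromLast ts | eq = cong (x₁ ∣_) (act-fromLast as ts)
    fold₁ : ∀ t → fold (run q ∣ fromLast ts) step (suc t) ≡ fold (x₁ ∣ fromLast ts₁) step t
    fold₁ t = trans (fold-step _ t) (cong (λ c → fold c step t) step₁)

  placed : Placed P e place (run (inj₁ tt))
  placed s = inj₂ s , refl , λ _ → refl

  initial-tapes : ∀ w → inputTape w ∷ Vec.replicate d emptyTape
      ≡ fromLast (pad emptyTape e (inputTape w ∷ []))
  initial-tapes w = sym (trans (cong (fromLast {A = Tape ⊥})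
      (pad-snoc {A = Tape ⊥} emptyTape e (inputTape w)))
          (fromLast-∷ʳ {A = Tape ⊥} (Vec.replicate d emptyTape) (inputTape w)))

  computation : ∀ {ℓ v} w → length w ≤ ℓ → numeral w < 2 ^ ℓ → Run ℓ P (numeral w ∷ []) (v ∷ []) →
    (∀ t → space (configuration t w) ≤ suc d * suc (suc ℓ)) ×
    ((v ≡ 0 × Rejects w) ⊎ (∃ λ u → v ≡ suc u × Accepts w))
  computation {ℓ} {v} w h lt r
    with simulate {e = e} placed (≤-reflexive (sym (room-fit d 1 _))) r (below-∷ {s = []} lt (mk λ ()))
      (subst (Reps (suc ℓ) _) (pad-embed e (numeral w ∷ []))
          (pad-reps e {ts = inputTape w ∷ []} (mk λ { zero → input-rep w h })))
  ... | ts′ , c , rp = answer v refl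
    where
    sm : Small (suc ℓ) ts′
    sm = reps-small (s≤s z≤n) rp
    final : Rep (suc ℓ) (lookup ts′ (reg e zero)) v
    final = subst (Rep _ _) (lookup-embed e (v ∷ []) zero) (rp .reps (reg e zero))
    whole : ∀ {x} → isBlank (Tape.scanned (lookup ts′ (reg e zero))) reject accept ≡ x → Halted x →
      (∀ t → space (configuration t w) ≤ suc d * suc (suc ℓ)) × ∃ λ t → control (configuration t w) ≡ x
    whole {x} eq hx with trace (c ⟫ next refl sm
        (cong (_, idle (map Tape.scanned ts′))
            (trans (cong (λ y → isBlank y reject accept) (lookup-map (reg e zero) Tape.scanned ts′)) eq))
        (idle-act ts′) done) hx sm
    ... | sp , t , eq′ = (λ t → subst (λ ts → space (fold (place (entry P) ∣ ts) step t)
        ≤ suc d * suc (suc ℓ)) (sym (initial-tapes w)) (sp t)) ,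
      t , trans (cong (λ ts → control (fold (place (entry P) ∣ ts) step t)) (initial-tapes w))
          (cong control eq′)
    answer : ∀ v′ → v ≡ v′ → (∀ t → space (configuration t w) ≤ suc d * suc (suc ℓ)) ×
               ((v ≡ 0 × Rejects w) ⊎ (∃ λ u → v ≡ suc u × Accepts w))
    answer zero    eq = let sp , rj = whole (isBlank-zero final eq) reject in sp , inj₁ (eq , rj)
    answer (suc u) eq = let sp , ac = whole (isBlank-suc final eq) accept in sp , inj₂ (u , eq , ac)

  stays : ∀ w t u {x} → Halted x → control (configuration t w) ≡ x → control (configuration (u + t) w) ≡ x
  stays w t zero    h eq = eq
  stays w t (suc u) h eq with configuration (u + t) w | stays w t u h eq
  ... | x ∣ ts | refl = cong control (step-halted ts h)

  reject-accept : ∀ w → Rejects w → Accepts w → ⊥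
  reject-accept w (t , eq) (t′ , eq′)
    with trans (sym (stays w t t′ reject eq))
           (trans (cong (λ n → control (configuration n w)) (+-comm t′ t)) (stays w t′ t accept eq′))
  ... | ()

  decides : ∀ (L : Language) (f : ℕ → ℕ) (ℓ : ℕ → ℕ) →
    (∀ w → length w ≤ ℓ (length w) × numeral w < 2 ^ ℓ (length w)
        × Run (ℓ (length w)) P (numeral w ∷ []) (f (numeral w) ∷ [])) →
    (∀ w → (1 ≤ f (numeral w) → L w) × (L w → 1 ≤ f (numeral w))) →
    Decides L × RunsInSpace (λ n → suc d * suc (suc (ℓ n)))
  decides L f ℓ runs correct = dec′ , λ w t → let h , lt , r = runs w in proj₁ (computation {v = f (numeral w)} w h lt r) t
    where
    dec′ : Decides L
    dec′ w with runs w
    ... | h , lt , r with computation w h lt r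
    ... | _ , inj₁ (eq , rj) = inj₂ rj , mk⇔ (λ ac →
        ⊥-elim (reject-accept w (proj₁ rj , proj₂ rj) (proj₁ ac , proj₂ ac)))
                                             (λ l → ⊥-elim (1+n≰n
                                                 (≤-trans (proj₂ (correct w) l) (≤-reflexive eq))))
    ... | _ , inj₂ (u , eq , ac) = inj₁ ac , mk⇔
        (λ _ → proj₁ (correct w) (≤-trans (s≤s z≤n) (≤-reflexive (sym eq)))) (λ _ → ac)

-- Functions computed by counter programs in polynomial space

-- The base is at least 2 for every `L`, so a larger exponent absorbs constant factors and summands,
-- and the family is closed under composition up to the exponent.
poly : ℕ → ℕ → ℕ
poly c L = (2 + L) ^ c

poly-deg : ∀ {c c′} L → c ≤ c′ → poly c L ≤ poly c′ L
poly-deg L = ^-monoʳ-≤ (2 + L)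

poly-id : ∀ c L → L ≤ poly (suc c) L
poly-id c L = ≤-trans (m≤n+m L 2) (≤-trans (≤-reflexive (sym (^-identityʳ (2 + L))))
    (poly-deg {1} {suc c} L (s≤s z≤n)))

-- For `x = (2 + L) ^ a ≥ 1` the inner offset is absorbed by `2 + x ≤ 4x ≤ (2 + L)² x`.
poly-poly : ∀ a b L → poly b (poly a L) ≤ poly ((2 + a) * b) L
poly-poly a b L = ≤-trans (^-monoˡ-≤ b lemma) (≤-reflexive (^-*-assoc (2 + L) (2 + a) b))
  where
  open ≤-Reasoning
  x = poly a L
  lemma : 2 + x ≤ poly (2 + a) L
  lemma = begin
    2 + x                     ≤⟨ +-monoˡ-≤ x (≤-trans (s≤s (s≤s z≤n)) (*-monoʳ-≤ 3 (m^n>0 (2 + L) a))) ⟩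
    3 * x + x                 ≡⟨ +-comm (3 * x) x ⟩
    4 * x                     ≡⟨ *-assoc 2 2 x ⟩
    2 * (2 * x)               ≤⟨ *-mono-≤ (m≤m+n 2 L) (*-monoˡ-≤ x (m≤m+n 2 L)) ⟩
    (2 + L) * ((2 + L) * x)   ∎

2^-mono : ∀ {a b v} → a ≤ b → v < 2 ^ a → v < 2 ^ b
2^-mono le lt = ≤-trans lt (^-monoʳ-≤ 2 le)

below-mono : ∀ {n a b} {s : Vec ℕ n} → a ≤ b → Below a s → Below b s
below-mono le h .below i = 2^-mono le (h .below i)

below-tail : ∀ {n L x} {xs : Vec ℕ n} → Below L (x ∷ xs) → Below L xs
below-tail h .below i = h .below (suc i)

run-mono : ∀ {n ℓ ℓ′} {p : Cmd n} {s s′} → ℓ ≤ ℓ′ → Run ℓ p s s′ → Run ℓ′ p s s′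
run-mono le (inc lt)      = inc (2^-mono le lt)
run-mono le (dec eq)      = dec eq
run-mono le (r ⨾ r′)      = run-mono le r ⨾ run-mono le r′
run-mono le (stop eq)     = stop eq
run-mono le (loop eq r r′) = loop eq (run-mono le r) (run-mono le r′)
run-mono le (new r)       = new (run-mono le r)

run-≡ : ∀ {n ℓ} {p : Cmd n} {s s′ s″} → Run ℓ p s s′ → s′ ≡ s″ → Run ℓ p s s″
run-≡ r refl = r

inc-≡ : ∀ {n ℓ i v} {s : Vec ℕ n} → lookup s i ≡ v → suc v < 2 ^ ℓ → Run ℓ (inc i) s (s [ i ]≔ suc v)
inc-≡ refl lt = inc lt

-- Clearing, moving and copying registers

clear : ∀ {n} → Fin n → Cmd n
clear i = while i (dec i)

clear-run : ∀ {n ℓ} i (s : Vec ℕ n) → Run ℓ (clear i) s (s [ i ]≔ 0)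
clear-run {ℓ = ℓ} i s = go (lookup s i) s refl
  where
  go : ∀ v s → lookup s i ≡ v → Run ℓ (clear i) s (s [ i ]≔ 0)
  go zero    s eq = run-≡ (stop eq) (trans (sym ([]≔-lookup s i)) (cong (s [ i ]≔_) eq))
  go (suc v) s eq = loop eq (dec eq) (run-≡ (go v (s [ i ]≔ v) (lookup∘updateAt i s)) ([]≔-idempotent s i))

local : ∀ {n} → Cmd (suc n) → Cmd n
local p = new (p ⨾ clear zero)

local-run : ∀ {n ℓ x} {p : Cmd (suc n)} {s s′} → Run ℓ p (0 ∷ s) (x ∷ s′) → Run ℓ (local p) s s′
local-run r = new (r ⨾ clear-run zero _)

unload : ∀ {n} → Fin n → Cmd (suc n)
unload a = while (suc a) (dec (suc a) ⨾ inc zero)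

unload-run : ∀ {n ℓ} a x (s : Vec ℕ n) → lookup s a + x < 2 ^ ℓ →
    Run ℓ (unload a) (x ∷ s) (lookup s a + x ∷ s [ a ]≔ 0)
unload-run {ℓ = ℓ} a x s = go (lookup s a) x s refl
  where
  go : ∀ v x s → lookup s a ≡ v → v + x < 2 ^ ℓ → Run ℓ (unload a) (x ∷ s) (v + x ∷ s [ a ]≔ 0)
  go zero x s eq lt = run-≡ (stop eq) (cong (x ∷_) (trans (sym ([]≔-lookup s a)) (cong (s [ a ]≔_) eq)))
  go (suc v) x s eq lt = loop eq (dec eq ⨾ inc (≤-trans (s≤s (s≤s (m≤n+m x v))) lt))
    (run-≡ (go v (suc x) (s [ a ]≔ v) (lookup∘updateAt a s) (subst (_< 2 ^ ℓ) (sym (+-suc v x)) lt))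
      (cong₂ _∷_ (+-suc v x) ([]≔-idempotent s a)))

restore : ∀ {n} → Fin n → Fin n → Cmd (suc n)
restore a d = while zero (dec zero ⨾ inc (suc a) ⨾ inc (suc d))

restore-run : ∀ {n ℓ} a d → a ≢ d → ∀ x (s : Vec ℕ n) → lookup s a + x < 2 ^ ℓ → lookup s d + x < 2 ^ ℓ →
  Run ℓ (restore a d) (x ∷ s) (0 ∷ (s [ a ]≔ (lookup s a + x)) [ d ]≔ (lookup s d + x))
restore-run {ℓ = ℓ} a d a≢d x s = go x s refl refl
  where
  go : ∀ x s {u v} → lookup s a ≡ u → lookup s d ≡ v → u + x < 2 ^ ℓ → v + x < 2 ^ ℓ →
       Run ℓ (restore a d) (x ∷ s) (0 ∷ (s [ a ]≔ (u + x)) [ d ]≔ (v + x))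
  go zero s {u} {v} refl refl h k = run-≡ (stop refl) (cong (0 ∷_) (sym (begin
    (s [ a ]≔ (u + 0)) [ d ]≔ (v + 0) ≡⟨ cong₂ (λ y z → (s [ a ]≔ y) [ d ]≔ z) (+-identityʳ u)
        (+-identityʳ v) ⟩
    (s [ a ]≔ u) [ d ]≔ v             ≡⟨ cong (_[ d ]≔ v) ([]≔-lookup s a) ⟩
    s [ d ]≔ v                        ≡⟨ []≔-lookup s d ⟩
    s                                 ∎)))
    where open ≡-Reasoning
  go (suc x) s {u} {v} eq eq′ h k = loop refl
    (dec refl ⨾ inc-≡ eq (≤-trans (s≤s (s≤s (m≤m+n u x))) (subst (_< 2 ^ ℓ) (+-suc u x) h))
              ⨾ inc-≡ (trans (lookup∘updateAt′ d a (a≢d ∘ sym) s) eq′)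
                  (≤-trans (s≤s (s≤s (m≤m+n v x))) (subst (_< 2 ^ ℓ) (+-suc v x) k)))
    (run-≡ (go x ((s [ a ]≔ suc u) [ d ]≔ suc v)
             (trans (lookup∘updateAt′ a d a≢d (s [ a ]≔ suc u)) (lookup∘updateAt a s))
                 (lookup∘updateAt d (s [ a ]≔ suc u))
             (subst (_< 2 ^ ℓ) (+-suc u x) h) (subst (_< 2 ^ ℓ) (+-suc v x) k))
      (cong (0 ∷_) (begin
        (((s [ a ]≔ suc u) [ d ]≔ suc v) [ a ]≔ (suc u + x)) [ d ]≔ (suc v + x)
          ≡⟨ cong (_[ d ]≔ (suc v + x)) ([]≔-commutes (s [ a ]≔ suc u) d a (a≢d ∘ sym)) ⟩
        (((s [ a ]≔ suc u) [ a ]≔ (suc u + x)) [ d ]≔ suc v) [ d ]≔ (suc v + x)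
          ≡⟨ []≔-idempotent ((s [ a ]≔ suc u) [ a ]≔ (suc u + x)) d ⟩
        ((s [ a ]≔ suc u) [ a ]≔ (suc u + x)) [ d ]≔ (suc v + x)
          ≡⟨ cong (_[ d ]≔ (suc v + x)) ([]≔-idempotent s a) ⟩
        (s [ a ]≔ (suc u + x)) [ d ]≔ (suc v + x)
          ≡⟨ cong₂ (λ y z → (s [ a ]≔ y) [ d ]≔ z) (+-suc u x) (+-suc v x) ⟨
        (s [ a ]≔ (u + suc x)) [ d ]≔ (v + suc x) ∎)))
    where open ≡-Reasoning

skip : ∀ {n} → Cmd n
skip = new (clear zero)

-- A register can be read only by counting it down, so its value is first moved to a fresh register
-- and then counted back into `a` and `d` at once. If `d` were `a`, it would come back doubled;
-- hence the case distinction.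
copy : ∀ {n} → Fin n → Fin n → Cmd n
copy d a with d Fin.≟ a
... | yes _ = skip
... | no _  = new (unload a ⨾ clear (suc d) ⨾ restore a d)

copy-run : ∀ {n ℓ} d a (s : Vec ℕ n) → lookup s a < 2 ^ ℓ → Run ℓ (copy d a) s (s [ d ]≔ lookup s a)
copy-run {ℓ = ℓ} d a s lt with d Fin.≟ a
... | yes refl = run-≡ (new (clear-run zero _)) (sym ([]≔-lookup s d))
... | no d≢a = new (unload-run a 0 s (subst (_< 2 ^ ℓ) (sym (+-identityʳ v)) lt) ⨾ clear-run (suc d) _ ⨾
    run-≡ (restore-run a d (d≢a ∘ sym) (v + 0)
        s′ (lt′ (trans (lookup∘updateAt′ a d (d≢a ∘ sym) (s [ a ]≔ 0)) (lookup∘updateAt a s)))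
             (lt′ (lookup∘updateAt d (s [ a ]≔ 0))))
      (cong (0 ∷_) (begin
        (s′ [ a ]≔ (lookup s′ a + (v + 0))) [ d ]≔ (lookup s′ d + (v + 0))
          ≡⟨ cong₂ (λ y z → (s′ [ a ]≔ y) [ d ]≔ z)
               (val (trans (lookup∘updateAt′ a d (d≢a ∘ sym) (s [ a ]≔ 0)) (lookup∘updateAt a s)))
                   (val (lookup∘updateAt d (s [ a ]≔ 0))) ⟩
        (s′ [ a ]≔ v) [ d ]≔ v
          ≡⟨ cong (_[ d ]≔ v) ([]≔-commutes (s [ a ]≔ 0) d a d≢a) ⟩
        (((s [ a ]≔ 0) [ a ]≔ v) [ d ]≔ 0) [ d ]≔ v
          ≡⟨ []≔-idempotent ((s [ a ]≔ 0) [ a ]≔ v) d ⟩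
        ((s [ a ]≔ 0) [ a ]≔ v) [ d ]≔ v
          ≡⟨ cong (_[ d ]≔ v) (trans ([]≔-idempotent s a) ([]≔-lookup s a)) ⟩
        s [ d ]≔ v ∎)))
  where
  open ≡-Reasoning
  v = lookup s a
  s′ = (s [ a ]≔ 0) [ d ]≔ 0
  val : ∀ {y} → y ≡ 0 → y + (v + 0) ≡ v
  val refl = +-identityʳ v
  lt′ : ∀ {y} → y ≡ 0 → y + (v + 0) < 2 ^ ℓ
  lt′ eq = subst (_< 2 ^ ℓ) (sym (val eq)) lt

-- Closure properties of the functions computed in polynomial space

Grows : ∀ {n} → (Vec ℕ n → ℕ) → Set
Grows f = ∃ λ c → ∀ L xs → Below L xs → f xs < 2 ^ poly c L

-- The program works in any context: argument registers may coincide with each other and with the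
-- target `d`, and all registers but `d` end as they began. Only the arguments have to be below
-- `2 ^ L`, and time is not bounded. `growth` is what a composition needs in order to bound the
-- arguments of the next function.
record PS {n} (f : Vec ℕ n → ℕ) : Set where
  field
    prog    : ∀ {N} → Fin N → Vec (Fin N) n → Cmd N
    deg     : ℕ
    growth  : ∀ L xs → Below L xs → f xs < 2 ^ poly deg L
    assigns : ∀ {N} L (s : Vec ℕ N) d as → Below L (map (lookup s) as) →
              Run (poly deg L) (prog d as) s (s [ d ]≔ f (map (lookup s) as))

  grows : Grows f
  grows = deg , growth

open PS

ps-ext : ∀ {n} {f g : Vec ℕ n → ℕ} → PS f → (∀ xs → f xs ≡ g xs) → PS g
ps-ext F eq .prog = F .prog
ps-ext F eq .deg  = F .deg
ps-ext F eq .growth L xs b = subst (_< _) (eq xs) (F .growth L xs b)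
ps-ext F eq .assigns L s d as b = run-≡ (F .assigns L s d as b) (cong (s [ d ]≔_) (eq _))

map-lookup-map : ∀ {A : Set} {N m n} (s : Vec A N) (as : Vec (Fin N) n) (ρ : Vec (Fin n) m) →
  map (lookup s) (map (lookup as) ρ) ≡ map (lookup (map (lookup s) as)) ρ
map-lookup-map s as ρ = trans (sym (map-∘ (lookup s) (lookup as) ρ))
    (map-cong (λ i → sym (lookup-map i (lookup s) as)) ρ)

below-map : ∀ {m n L} {xs : Vec ℕ n} → Below L xs → (ρ : Vec (Fin n) m) → Below L (map (lookup xs) ρ)
below-map {L = L} {xs} b ρ .below i = subst (_< 2 ^ L) (sym (lookup-map i (lookup xs) ρ))
    (b .below (lookup ρ i))

ps-rename : ∀ {m n} {f : Vec ℕ m → ℕ} → PS f → (ρ : Vec (Fin n) m) → PS (λ xs → f (map (lookup xs) ρ))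
ps-rename F ρ .prog d as = F .prog d (map (lookup as) ρ)
ps-rename F ρ .deg = F .deg
ps-rename F ρ .growth L xs b = F .growth L _ (below-map b ρ)
ps-rename {f = f} F ρ .assigns L s d as b =
  run-≡ (F .assigns L s d (map (lookup as) ρ) (subst (Below L) (sym (map-lookup-map s as ρ)) (below-map b ρ)))
        (cong (λ ys → s [ d ]≔ f ys) (map-lookup-map s as ρ))

ps-zero : ∀ {n} → PS {n} (λ _ → 0)
ps-zero .prog d as = clear d
ps-zero .deg = 0
ps-zero .growth L xs b = s≤s z≤n
ps-zero .assigns L s d as b = clear-run d s

ps-var : ∀ {n} (i : Fin n) → PS (λ xs → lookup xs i)
ps-var i .prog d as = copy d (lookup as i)
ps-var i .deg = 1
ps-var i .growth L xs b = 2^-mono (poly-id 0 L) (b .below i)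
ps-var i .assigns L s d as b =
  run-≡ (copy-run d (lookup as i) s (subst (_< _) (lookup-map i (lookup s) as)
      (2^-mono (poly-id 0 L) (b .below i))))
        (cong (s [ d ]≔_) (sym (lookup-map i (lookup s) as)))

suc-below : ∀ {L v} → v < 2 ^ L → suc v < 2 ^ suc L
suc-below {L} {v} lt = ≤-trans (s≤s (≤-trans lt (m≤m+n (2 ^ L) 0))) (+-monoˡ-≤ (2 ^ L + 0) (m^n>0 2 L))

ps-suc : ∀ {n} {f : Vec ℕ n → ℕ} → PS f → PS (λ xs → suc (f xs))
ps-suc F .prog d as = F .prog d as ⨾ inc d
ps-suc F .deg = suc (F .deg)
ps-suc {f = f} F .growth L xs b = 2^-mono le (suc-below {poly (F .deg) L} (F .growth L xs b))
  where
  le : suc (poly (F .deg) L) ≤ poly (suc (F .deg)) L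
  le = +-mono-≤ (m^n>0 (2 + L) (F .deg)) (m≤m+n _ _)
ps-suc {f = f} F .assigns L s d as b =
  run-mono (poly-deg L (n≤1+n (F .deg))) (F .assigns L s d as b) ⨾
  run-≡ (inc-≡ (lookup∘updateAt d s) (ps-suc F .growth L _ b)) ([]≔-idempotent s d)

weaken : ∀ {A : Set} {N n} (x : A) (s : Vec A N) (as : Vec (Fin N) n) →
    map (lookup (x ∷ s)) (map suc as) ≡ map (lookup s) as
weaken x s as = sym (map-∘ (lookup (x ∷ s)) suc as)

-- The value of `g` and the old arguments are all below `2 ^ poly (suc a) L`, so `f` is run with the
-- length `poly (suc a) L`; `3 + a` is the factor that `poly-poly` then puts on its exponent. The
-- successor makes the exponent positive, as `L ≤ poly (suc a) L` requires.
ps-let : ∀ {n} {g : Vec ℕ n → ℕ} {f : Vec ℕ (suc n) → ℕ} → PS g → PS f → PS (λ xs → f (g xs ∷ xs))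
ps-let {n} {g} {f} G F = computes
  where
  a = G .deg
  c = suc a + (3 + a) * F .deg
  below-let : ∀ L xs → Below L xs → Below (poly (suc a) L) (g xs ∷ xs)
  below-let L xs b = below-∷ (2^-mono (poly-deg L (n≤1+n a)) (G .growth L xs b)) (below-mono (poly-id a L) b)
  leF : ∀ L → poly (F .deg) (poly (suc a) L) ≤ poly c L
  leF L = ≤-trans (poly-poly (suc a) (F .deg) L) (poly-deg L (m≤n+m _ (suc a)))
  computes : PS (λ xs → f (g xs ∷ xs))
  computes .prog d as = local (G .prog zero (map suc as) ⨾ F .prog (suc d) (zero ∷ map suc as))
  computes .deg = c
  computes .growth L xs b = 2^-mono (leF L) (F .growth _ _ (below-let L xs b))
  computes .assigns L s d as b = local-run
    (run-≡ (run-mono (poly-deg L (≤-trans (n≤1+n a) (m≤m+n (suc a) _)))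
              (G .assigns L (0 ∷ s) zero (map suc as) (subst (Below L) (sym (weaken 0 s as)) b)))
           (cong (λ ys → g ys ∷ s) (weaken 0 s as)) ⨾
     run-≡ (run-mono (leF L) (F .assigns (poly (suc a) L) (y ∷ s) (suc d) (zero ∷ map suc as)
              (subst (Below (poly (suc a) L)) (cong (y ∷_) (sym (weaken y s as))) (below-let L _ b))))
           (cong (λ ys → y ∷ s [ d ]≔ f (y ∷ ys)) (weaken y s as)))
    where y = g (map (lookup s) as)

rec : ∀ {n} → (Vec ℕ n → ℕ) → (Vec ℕ (2 + n) → ℕ) → Vec ℕ (suc n) → ℕ
rec g h (zero ∷ xs)  = g xs
rec g h (suc t ∷ xs) = h (rec g h (t ∷ xs) ∷ t ∷ xs)

-- The recursion runs over the value of its argument, which means exponentially many rounds in its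
-- length. Space remains polynomial because `Grows` bounds every intermediate result and all rounds
-- work in the same registers.
ps-rec : ∀ {n} {g : Vec ℕ n → ℕ} {h : Vec ℕ (2 + n) → ℕ} → PS g → PS h → Grows (rec g h) → PS (rec g h)
ps-rec {n} {g} {h} G H (r , bound) = computes
  where
  c = suc r + G .deg + (3 + r) * H .deg
  step-below : ∀ L i xs → Below L (i ∷ xs) → Below (poly (suc r) L) (rec g h (i ∷ xs) ∷ i ∷ xs)
  step-below L i xs b = below-∷ (2^-mono (poly-deg L (n≤1+n r)) (bound L _ b)) (below-mono (poly-id r L) b)
  leG : ∀ L → poly (G .deg) L ≤ poly c L
  leG L = poly-deg L (≤-trans (m≤n+m (G .deg) (suc r)) (m≤m+n _ _))
  leH : ∀ L → poly (H .deg) (poly (suc r) L) ≤ poly c L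
  leH L = ≤-trans (poly-poly (suc r) (H .deg) L) (poly-deg L (m≤n+m _ (suc r + G .deg)))
  leR : ∀ L → poly (suc r) L ≤ poly c L
  leR L = poly-deg L (≤-trans (m≤m+n (suc r) (G .deg)) (m≤m+n _ _))
  step : ∀ {N} → Vec (Fin N) n → Cmd (3 + N)
  step as = dec zero ⨾ H .prog (suc (suc zero)) (suc (suc zero) ∷ suc zero ∷ map suc (map suc (map suc as)))
      ⨾ inc (suc zero)
  body : ∀ {N} → Fin N → Vec (Fin N) n → Cmd (suc N)
  body t as = G .prog zero (map suc as) ⨾ local (local (copy zero (suc (suc (suc t))) ⨾ while zero (step as)))
  weaken³ : ∀ {N} x y z (s : Vec ℕ N) (as : Vec (Fin N) n) →
      map (lookup (x ∷ y ∷ z ∷ s)) (map suc (map suc (map suc as))) ≡ map (lookup s) as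
  weaken³ x y z s as = trans (weaken x (y ∷ z ∷ s) _) (trans (weaken y (z ∷ s) _) (weaken z s as))
  -- The registers are the number `T` of rounds left, the number `i` of rounds done, and the
  -- accumulator; `T + i` is the recursion argument throughout.
  loops : ∀ {N} L (s : Vec ℕ N) as T i → Below L (T + i ∷ map (lookup s) as) → let xs = map (lookup s) as in
    Run (poly c L) (while zero (step as)) (T ∷ i ∷ rec g h (i ∷ xs) ∷ s)
        (0 ∷ T + i ∷ rec g h (T + i ∷ xs) ∷ s)
  loops L s as zero    i b = stop refl
  loops L s as (suc T) i b = loop refl
    (dec refl ⨾
     run-≡ (run-mono (leH L) (H .assigns (poly (suc r) L) (T ∷ i ∷ rec g h (i ∷ xs) ∷ s) (suc (suc zero)) _
              (subst (Below _) (cong (λ ys → rec g h (i ∷ xs) ∷ i ∷ ys) (sym (weaken³ _ _ _ s as)))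
                  (step-below L i xs bi))))
           (cong (λ ys → T ∷ i ∷ h (rec g h (i ∷ xs) ∷ i ∷ ys) ∷ s) (weaken³ _ _ _ s as)) ⨾
     inc (2^-mono (≤-trans (poly-id r L) (leR L)) (≤-trans (s≤s (s≤s (m≤n+m i T))) (b .below zero))))
    (run-≡ (loops L s as T (suc i) (subst (λ k → Below L (k ∷ xs)) (sym (+-suc T i)) b))
      (cong (λ k → 0 ∷ k ∷ rec g h (k ∷ xs) ∷ s) (+-suc T i)))
    where
    xs = map (lookup s) as
    bi : Below L (i ∷ xs)
    bi = below-∷ (≤-trans (s≤s (m≤n+m i (suc T))) (b .below zero)) (below-tail b)
  computes : PS (rec g h)
  computes .prog d (t ∷ as) = local (body t as ⨾ copy (suc d) zero)
  computes .deg = c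
  computes .growth L xs b = 2^-mono (≤-trans (poly-deg L (n≤1+n r)) (leR L)) (bound L xs b)
  computes .assigns L s d (t ∷ as) b = local-run
    ((run-≡ (run-mono (leG L) (G .assigns L (0 ∷ s) zero (map suc as)
        (subst (Below L) (sym (weaken 0 s as)) (below-tail b))))
           (cong (λ ys → g ys ∷ s) (weaken 0 s as)) ⨾
      local-run (local-run (
        copy-run zero (suc (suc (suc t))) (0 ∷ 0 ∷ g xs ∷ s)
            (2^-mono (≤-trans (poly-id r L) (leR L)) (b .below zero)) ⨾
        run-≡ (loops L s as (lookup s t) 0 (subst (λ k → Below L (k ∷ xs)) (sym (+-identityʳ _)) b))
          (cong (λ k → 0 ∷ k ∷ rec g h (k ∷ xs) ∷ s) (+-identityʳ _))))) ⨾
     copy-run (suc d) zero _ (computes .growth L _ b))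
    where xs = map (lookup s) as

data Iter (h c : ℕ → ℕ) (bnd : ℕ) : ℕ → ℕ → Set where
  halt : ∀ {a} → a ≤ bnd → c a ≡ 0 → Iter h c bnd a a
  more : ∀ {a b v} → a ≤ bnd → c a ≡ suc v → Iter h c bnd (h a) b → Iter h c bnd a b

iter-≤ : ∀ {h c bnd a b} → Iter h c bnd a b → b ≤ bnd
iter-≤ (halt le _)   = le
iter-≤ (more _ _ it) = iter-≤ it

-- For loops whose number of rounds is not computed beforehand: the derivation of `Iter` ensures
-- that the loop ends, and its bound on all states ensures the space.
ps-while : ∀ {n} {f g : Vec ℕ n → ℕ} {h c : Vec ℕ (suc n) → ℕ} {bnd : Vec ℕ n → ℕ} →
  PS g → PS h → PS c → Grows bnd → (∀ xs → Iter (λ a → h (a ∷ xs)) (λ a → c (a ∷ xs)) (bnd xs) (g xs)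
      (f xs)) → PS f
ps-while {n} {f} {g} {h} {c} {bnd} G H C (r , bound) iters = computes
  where
  k = suc r + G .deg + (3 + r) * (H .deg + C .deg)
  acc-below : ∀ L a xs → Below L xs → a ≤ bnd xs → Below (poly (suc r) L) (a ∷ xs)
  acc-below L a xs b le = below-∷ (2^-mono (poly-deg L (n≤1+n r)) (≤-trans (s≤s le) (bound L xs b)))
      (below-mono (poly-id r L) b)
  leG : ∀ L → poly (G .deg) L ≤ poly k L
  leG L = poly-deg L (≤-trans (m≤n+m (G .deg) (suc r)) (m≤m+n _ _))
  leR : ∀ L → poly (suc r) L ≤ poly k L
  leR L = poly-deg L (≤-trans (m≤m+n (suc r) (G .deg)) (m≤m+n _ _))
  leHC : ∀ L {a} → a ≤ H .deg + C .deg → poly a (poly (suc r) L) ≤ poly k L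
  leHC L {a} le = ≤-trans (poly-poly (suc r) a L)
      (poly-deg L (≤-trans (*-monoʳ-≤ (3 + r) le) (m≤n+m _ (suc r + G .deg))))
  weaken² : ∀ {N} x y (s : Vec ℕ N) (as : Vec (Fin N) n) → map (lookup (x ∷ y ∷ s)) (map suc (map suc as))
      ≡ map (lookup s) as
  weaken² x y s as = trans (weaken x (y ∷ s) _) (weaken y s as)
  test body : ∀ {N} → Vec (Fin N) n → Cmd (2 + N)
  test as = C .prog zero (suc zero ∷ map suc (map suc as))
  body as = H .prog (suc zero) (suc zero ∷ map suc (map suc as)) ⨾ test as
  test-run : ∀ {N} L x a (s : Vec ℕ N) as → Below L (map (lookup s) as) → a ≤ bnd (map (lookup s) as) →
    Run (poly k L) (test as) (x ∷ a ∷ s) (c (a ∷ map (lookup s) as) ∷ a ∷ s)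
  test-run L x a s as b le =
    run-≡ (run-mono (leHC L (m≤n+m (C .deg) (H .deg))) (C .assigns (poly (suc r) L) (x ∷ a ∷ s) zero _
            (subst (Below _) (cong (a ∷_) (sym (weaken² x a s as))) (acc-below L a _ b le))))
          (cong (λ ys → c (a ∷ ys) ∷ a ∷ s) (weaken² x a s as))
  first-≤ : ∀ {h c bnd a b} → Iter h c bnd a b → a ≤ bnd
  first-≤ (halt le _)   = le
  first-≤ (more le _ _) = le
  loops : ∀ {N} L (s : Vec ℕ N) as a b → let xs = map (lookup s) as in Below L xs → Iter (λ a → h (a ∷ xs)) (λ a → c (a ∷ xs)) (bnd xs) a b →
    Run (poly k L) (while zero (body as)) (c (a ∷ xs) ∷ a ∷ s) (0 ∷ b ∷ s)
  loops L s as a _ b (halt le eq) = run-≡ (stop eq) (cong (_∷ a ∷ s) eq)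
  loops L s as a a′ b (more le eq it) = loop eq
    (run-≡ (run-mono (leHC L (m≤m+n (H .deg) (C .deg)))
        (H .assigns (poly (suc r) L) (c (a ∷ xs) ∷ a ∷ s) (suc zero) _
             (subst (Below _) (cong (a ∷_) (sym (weaken² _ a s as))) (acc-below L a _ b le))))
           (cong (λ ys → c (a ∷ xs) ∷ h (a ∷ ys) ∷ s) (weaken² _ a s as)) ⨾
     test-run L _ _ s as b (first-≤ it))
    (loops L s as (h (a ∷ xs)) a′ b it)
    where xs = map (lookup s) as
  computes : PS f
  computes .prog d as = local (G .prog zero (map suc as) ⨾ local (test as ⨾ while zero (body as))
      ⨾ copy (suc d) zero)
  computes .deg = k
  computes .growth L xs b = 2^-mono (≤-trans (poly-deg L (n≤1+n r)) (leR L))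
      (≤-trans (s≤s (iter-≤ (iters xs))) (bound L xs b))
  computes .assigns L s d as b = local-run
    (run-≡ (run-mono (leG L) (G .assigns L (0 ∷ s) zero (map suc as)
        (subst (Below L) (sym (weaken 0 s as)) b)))
           (cong (λ ys → g ys ∷ s) (weaken 0 s as)) ⨾
     local-run (test-run L 0 (g xs) s as b (first-≤ (iters xs)) ⨾ loops L s as (g xs) (f xs) b (iters xs)) ⨾
     copy-run (suc d) zero _ (computes .growth L _ b))
    where xs = map (lookup s) as

-- Expressions and arithmetic

infix 4 _≐_ _≼_

mutual
  data Exp (n : ℕ) : Set where
    var : Fin n → Exp n
    lit : ℕ → Exp n
    app : ∀ {m} {f : Vec ℕ m → ℕ} → PS f → Vec (Exp n) m → Exp n

  val : ∀ {n} → Exp n → Vec ℕ n → ℕ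
  val (var i) xs = lookup xs i
  val (lit k) xs = k
  val (app {f = f} F es) xs = f (vals es xs)

  vals : ∀ {m n} → Vec (Exp n) m → Vec ℕ n → Vec ℕ m
  vals []       xs = []
  vals (e ∷ es) xs = val e xs ∷ vals es xs

ps-lit : ∀ {n} k → PS {n} (λ _ → k)
ps-lit zero    = ps-zero
ps-lit (suc k) = ps-suc (ps-lit k)

suffix : ∀ m {n} → Vec (Fin (m + n)) n
suffix m = tabulate (m ↑ʳ_)

prefix : ∀ m {n} → Vec (Fin (m + n)) m
prefix m {n} = tabulate (_↑ˡ n)

map-lookup-tabulate : ∀ {m n} (s : Vec ℕ m) (ρ : Fin n → Fin m) (t : Vec ℕ n) →
    (∀ i → lookup s (ρ i) ≡ lookup t i) →
  map (lookup s) (tabulate ρ) ≡ t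
map-lookup-tabulate s ρ t eq = trans (sym (tabulate-∘ (lookup s) ρ))
    (trans (tabulate-cong eq) (tabulate∘lookup t))

lookup-suffix : ∀ {m n} (as : Vec ℕ m) (xs : Vec ℕ n) → map (lookup (as ++ᵛ xs)) (suffix m) ≡ xs
lookup-suffix {m} as xs = map-lookup-tabulate (as ++ᵛ xs) (m ↑ʳ_) xs (lookup-++ʳ as xs)

lookup-prefix : ∀ {m n} (as : Vec ℕ m) (xs : Vec ℕ n) → map (lookup (as ++ᵛ xs)) (prefix m) ≡ as
lookup-prefix {m} {n} as xs = map-lookup-tabulate (as ++ᵛ xs) (_↑ˡ n) as (lookup-++ˡ as xs)

lookup-tail : ∀ {n} x (xs : Vec ℕ n) → map (lookup (x ∷ xs)) (tabulate suc) ≡ xs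
lookup-tail x xs = map-lookup-tabulate (x ∷ xs) suc xs (λ _ → refl)

mutual
  ps-exp : ∀ {n} (e : Exp n) → PS (val e)
  ps-exp (var i) = ps-var i
  ps-exp (lit k) = ps-lit k
  ps-exp {n} (app {m} {f} F es) =
    ps-ext (ps-exps es (ps-rename F (prefix m))) (λ xs → cong f (lookup-prefix (vals es xs) xs))

  ps-exps : ∀ {m n} (es : Vec (Exp n) m) {f : Vec ℕ (m + n) → ℕ} → PS f → PS (λ xs → f (vals es xs ++ᵛ xs))
  ps-exps [] F = F
  ps-exps {suc m} (e ∷ es) {f} F =
    ps-ext (ps-exps es (ps-let (ps-rename (ps-exp e) (suffix m)) F))
           (λ xs → cong (λ ys → f (val e ys ∷ vals es xs ++ᵛ xs)) (lookup-suffix (vals es xs) xs))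

grows-≤ : ∀ {n} {f g : Vec ℕ n → ℕ} → Grows g → (∀ xs → f xs ≤ g xs) → Grows f
grows-≤ (c , h) le = c , λ L xs b → ≤-trans (s≤s (le xs)) (h L xs b)

-- Limited recursion in the style of Grzegorczyk: a majorant `b` that is already an expression
-- supplies `Grows`.
ps-recᵉ : ∀ {n} {f : Vec ℕ (suc n) → ℕ} (g : Exp n) (h : Exp (2 + n)) (b : Exp (suc n)) →
  (∀ xs → f xs ≡ rec (val g) (val h) xs) → (∀ xs → f xs ≤ val b xs) → PS f
ps-recᵉ g h b eq le = ps-ext (ps-rec (ps-exp g) (ps-exp h)
  (grows-≤ (grows (ps-exp b)) (λ xs → subst (_≤ val b xs) (eq xs) (le xs)))) (λ xs → sym (eq xs))

⟨_⟩₁ : (ℕ → ℕ) → Vec ℕ 1 → ℕ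
⟨ f ⟩₁ (x ∷ []) = f x

⟨_⟩₂ : (ℕ → ℕ → ℕ) → Vec ℕ 2 → ℕ
⟨ f ⟩₂ (x ∷ y ∷ []) = f x y

⟨_⟩₃ : (ℕ → ℕ → ℕ → ℕ) → Vec ℕ 3 → ℕ
⟨ f ⟩₃ (x ∷ y ∷ z ∷ []) = f x y z

ps-pred : PS ⟨ pred ⟩₁
ps-pred = ps-recᵉ (lit 0) (var 1F) (var 0F) (λ { (zero ∷ []) → refl ; (suc x ∷ []) → refl })
    (λ { (x ∷ []) → pred[n]≤n })

-- No expression available at this point majorises a sum, so the growth is estimated directly: two
-- numbers below `2 ^ L` have a sum below `2 ^ (1 + L)`.
ps-add : PS ⟨ _+_ ⟩₂
ps-add = ps-ext (ps-rec (ps-var 0F) (ps-suc (ps-var 0F)) (1 , bound)) (λ { (x ∷ y ∷ []) → eq x y })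
  where
  eq : ∀ x y → rec (λ xs → lookup xs 0F) (λ xs → suc (lookup xs 0F)) (x ∷ y ∷ []) ≡ x + y
  eq zero    y = refl
  eq (suc x) y = cong suc (eq x y)
  bound : ∀ L xs → Below L xs → rec (λ xs → lookup xs 0F) (λ xs → suc (lookup xs 0F)) xs < 2 ^ poly 1 L
  bound L (x ∷ y ∷ []) b = begin-strict
    rec _ _ (x ∷ y ∷ []) ≡⟨ eq x y ⟩
    x + y                <⟨ +-mono-< (b .below 0F) (b .below 1F) ⟩
    2 ^ L + 2 ^ L        ≡⟨ cong (2 ^ L +_) (+-identityʳ _) ⟨
    2 ^ (1 + L)          ≤⟨ ^-monoʳ-≤ 2 (≤-trans (n≤1+n _) (≤-reflexive (sym (*-identityʳ (2 + L))))) ⟩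
    2 ^ poly 1 L            ∎
    where open ≤-Reasoning

infixl 6 _+′_ _∸′_
infixl 7 _*′_

_+′_ : ∀ {n} → Exp n → Exp n → Exp n
e +′ e′ = app ps-add (e ∷ e′ ∷ [])

ps-mul : PS ⟨ _*_ ⟩₂
ps-mul = ps-ext (ps-rec (ps-lit 0) (ps-exp (var 2F +′ var 0F)) (2 , bound)) (λ { (x ∷ y ∷ []) → eq x y })
  where
  eq : ∀ x y → rec (λ _ → 0) (val (var 2F +′ var 0F)) (x ∷ y ∷ []) ≡ x * y
  eq zero    y = refl
  eq (suc x) y = cong (y +_) (eq x y)
  bound : ∀ L xs → Below L xs → rec (λ _ → 0) (val (var 2F +′ var 0F)) xs < 2 ^ poly 2 L
  bound L (x ∷ y ∷ []) b = begin-strict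
    rec _ _ (x ∷ y ∷ []) ≡⟨ eq x y ⟩
    x * y                <⟨ *-mono-< (b .below 0F) (b .below 1F) ⟩
    2 ^ L * 2 ^ L        ≡⟨ ^-distribˡ-+-* 2 L L ⟨
    2 ^ (L + L)          ≤⟨ ^-monoʳ-≤ 2 le ⟩
    2 ^ poly 2 L            ∎
    where
    open ≤-Reasoning
    le : L + L ≤ (2 + L) * ((2 + L) * 1)
    le = begin
      L + L                   ≡⟨ cong (L +_) (+-identityʳ L) ⟨
      2 * L                   ≤⟨ *-mono-≤ (m≤m+n 2 L) (m≤n+m L 2) ⟩
      (2 + L) * (2 + L)       ≡⟨ cong ((2 + L) *_) (*-identityʳ (2 + L)) ⟨
      (2 + L) * ((2 + L) * 1) ∎

_*′_ : ∀ {n} → Exp n → Exp n → Exp n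
e *′ e′ = app ps-mul (e ∷ e′ ∷ [])

ps-monus : PS ⟨ _∸_ ⟩₂
ps-monus = ps-ext (ps-rename (ps-recᵉ {f = ⟨ (λ x y → y ∸ x) ⟩₂} (var 0F) (app ps-pred (var 0F ∷ [])) (var 1F)
    (λ { (x ∷ y ∷ []) → eq x y }) (λ { (x ∷ y ∷ []) → m∸n≤m y x })) (1F ∷ 0F ∷ []))
        (λ { (x ∷ y ∷ []) → refl })
  where
  eq : ∀ x y → y ∸ x ≡ rec (λ xs → lookup xs 0F) (val (app ps-pred (var 0F ∷ []))) (x ∷ y ∷ [])
  eq zero    y = refl
  eq (suc x) y = trans (sym (pred[m∸n]≡m∸[1+n] y x)) (cong pred (eq x y))

_∸′_ : ∀ {n} → Exp n → Exp n → Exp n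
e ∸′ e′ = app ps-monus (e ∷ e′ ∷ [])

-- Formulas

-- Every positive number counts as true, so that `*` and `+` serve as conjunction and disjunction.
-- Testing `x` decides `P`; in this way membership in the sets of a circuit, complements included,
-- becomes decidable.
Reflects : ℕ → Set → Set
Reflects x P = (1 ≤ x → P) × (P → 1 ≤ x)

infixr 3 _∧_ ∃<_∙_ ∀<_∙_
infixr 2 _∨_
infixr 1 _⇒_

data Fm (n : ℕ) : Set where
  _≐_ _≼_ : Exp n → Exp n → Fm n
  _∧_ _∨_ _⇒_ : Fm n → Fm n → Fm n
  ¬′      : Fm n → Fm n
  ∃<_∙_ ∀<_∙_ : Exp n → Fm (suc n) → Fm n

⟦_⟧ᶠ : ∀ {n} → Fm n → Vec ℕ n → Set
⟦ e ≐ e′ ⟧ᶠ xs   = val e xs ≡ val e′ xs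
⟦ e ≼ e′ ⟧ᶠ xs   = val e xs ≤ val e′ xs
⟦ φ ∧ ψ ⟧ᶠ xs    = ⟦ φ ⟧ᶠ xs × ⟦ ψ ⟧ᶠ xs
⟦ φ ∨ ψ ⟧ᶠ xs    = ⟦ φ ⟧ᶠ xs ⊎ ⟦ ψ ⟧ᶠ xs
⟦ φ ⇒ ψ ⟧ᶠ xs    = ⟦ φ ⟧ᶠ xs → ⟦ ψ ⟧ᶠ xs
⟦ ¬′ φ ⟧ᶠ xs     = ¬ ⟦ φ ⟧ᶠ xs
⟦ ∃< e ∙ φ ⟧ᶠ xs = ∃ λ z → z < val e xs × ⟦ φ ⟧ᶠ (z ∷ xs)
⟦ ∀< e ∙ φ ⟧ᶠ xs = ∀ z → z < val e xs → ⟦ φ ⟧ᶠ (z ∷ xs)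

-- `1 ∸ (1 ∸ x)` is the sign of `x`. Taking it in every round keeps the accumulator at most 1, which
-- is the majorant that `ps-bounded` works with.
some every : (ℕ → ℕ) → ℕ → ℕ
some f zero    = 0
some f (suc t) = 1 ∸ (1 ∸ (some f t + f t))
every f zero    = 1
every f (suc t) = 1 ∸ (1 ∸ every f t * f t)

χ : ∀ {n} → Fm n → Vec ℕ n → ℕ
χ (e ≐ e′) xs   = 1 ∸ ((val e xs ∸ val e′ xs) + (val e′ xs ∸ val e xs))
χ (e ≼ e′) xs   = 1 ∸ (val e xs ∸ val e′ xs)
χ (φ ∧ ψ) xs    = χ φ xs * χ ψ xs
χ (φ ∨ ψ) xs    = χ φ xs + χ ψ xs
χ (φ ⇒ ψ) xs    = (1 ∸ χ φ xs) + χ ψ xs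
χ (¬′ φ) xs     = 1 ∸ χ φ xs
χ (∃< e ∙ φ) xs = some (λ z → χ φ (z ∷ xs)) (val e xs)
χ (∀< e ∙ φ) xs = every (λ z → χ φ (z ∷ xs)) (val e xs)

ref-not : ∀ {x P} → Reflects x P → Reflects (1 ∸ x) (¬ P)
ref-not {zero}  (f , g) = (λ _ p → 1+n≰n (g p)) , λ _ → s≤s z≤n
ref-not {suc x} (f , g) = (λ le → contradiction (≤-trans le (≤-reflexive (0∸n≡0 x))) λ ()) , λ ¬p →
    contradiction (f (s≤s z≤n)) ¬p

ref-and : ∀ {x y P Q} → Reflects x P → Reflects y Q → Reflects (x * y) (P × Q)
ref-and {zero}  {y} (f , g) (h , k) = (λ ()) , λ (p , q) → g p
ref-and {suc x} {zero}  (f , g) (h , k) = (λ le → contradiction (≤-trans le (≤-reflexive (*-zeroʳ x))) λ ()) ,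
    λ (p , q) → contradiction (k q) λ ()
ref-and {suc x} {suc y} (f , g) (h , k) = (λ _ → f (s≤s z≤n) , h (s≤s z≤n)) , λ _ → s≤s z≤n

ref-or : ∀ {x y P Q} → Reflects x P → Reflects y Q → Reflects (x + y) (P ⊎ Q)
ref-or {zero}  (f , g) (h , k) = (λ le → inj₂ (h le)) ,
    λ { (inj₁ p) → contradiction (g p) λ () ; (inj₂ q) → k q }
ref-or {suc x} (f , g) (h , k) = (λ _ → inj₁ (f (s≤s z≤n))) , λ _ → s≤s z≤n

ref-sg : ∀ {x P} → Reflects x P → Reflects (1 ∸ (1 ∸ x)) P
ref-sg {zero}  r = r
ref-sg {suc x} (f , g) = (λ _ → f (s≤s z≤n)) , λ _ → ≤-reflexive (sym (cong (1 ∸_) (0∸n≡0 x)))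

ref-map : ∀ {x P Q} → Reflects x P → (P → Q) → (Q → P) → Reflects x Q
ref-map (f , g) to from = to ∘ f , g ∘ from

ref-some : ∀ {f : ℕ → ℕ} {P : ℕ → Set} → (∀ z → Reflects (f z) (P z)) → ∀ t →
    Reflects (some f t) (∃ λ z → z < t × P z)
ref-some r zero    = (λ ()) , λ ()
ref-some {P = P} r (suc t) = ref-sg (ref-map (ref-or (ref-some r t) (r t)) to from)
  where
  to : (∃ λ z → z < t × P z) ⊎ P t → ∃ λ z → z < suc t × P z
  to (inj₁ (z , lt , p)) = z , m≤n⇒m≤1+n lt , p
  to (inj₂ p) = t , ≤-refl , p
  from : (∃ λ z → z < suc t × P z) → (∃ λ z → z < t × P z) ⊎ P t
  from (z , s≤s le , p) with m≤n⇒m<n∨m≡n le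
  ... | inj₁ lt   = inj₁ (z , lt , p)
  ... | inj₂ refl = inj₂ p

ref-every : ∀ {f : ℕ → ℕ} {P : ℕ → Set} → (∀ z → Reflects (f z) (P z)) → ∀ t →
    Reflects (every f t) (∀ z → z < t → P z)
ref-every r zero    = (λ _ z ()) , λ _ → s≤s z≤n
ref-every {P = P} r (suc t) = ref-sg (ref-map (ref-and (ref-every r t) (r t))
    to (λ h → (λ z lt → h z (m≤n⇒m≤1+n lt)) , h t ≤-refl))
  where
  to : (∀ z → z < t → P z) × P t → ∀ z → z < suc t → P z
  to (h , p) z (s≤s le) with m≤n⇒m<n∨m≡n le
  ... | inj₁ lt   = h z lt
  ... | inj₂ refl = p

ref-≤ : ∀ x y → Reflects (1 ∸ (x ∸ y)) (x ≤ y)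
ref-≤ x y = (λ le → m∸n≡0⇒m≤n (go (x ∸ y) le)) , λ le → ≤-reflexive (sym (cong (1 ∸_) (m≤n⇒m∸n≡0 le)))
  where
  go : ∀ v → 1 ≤ 1 ∸ v → v ≡ 0
  go zero    le = refl
  go (suc v) le = contradiction (≤-trans le (≤-reflexive (0∸n≡0 v))) λ ()

ref-≡ : ∀ x y → Reflects (1 ∸ ((x ∸ y) + (y ∸ x))) (x ≡ y)
ref-≡ x y = (λ le → ≤-antisym (m∸n≡0⇒m≤n (proj₁ (go (x ∸ y) _ le))) (m∸n≡0⇒m≤n (proj₂ (go (x ∸ y) _ le)))) ,
            λ { refl → ≤-reflexive (sym (cong (1 ∸_) (cong₂ _+_ (n∸n≡0 x) (n∸n≡0 x)))) }
  where
  go : ∀ u v → 1 ≤ 1 ∸ (u + v) → u ≡ 0 × v ≡ 0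
  go zero    zero    le = refl , refl
  go zero    (suc v) le = contradiction (≤-trans le (≤-reflexive (0∸n≡0 v))) λ ()
  go (suc u) v       le = contradiction (≤-trans le (≤-reflexive (0∸n≡0 (u + v)))) λ ()

reflects : ∀ {n} (φ : Fm n) xs → Reflects (χ φ xs) (⟦ φ ⟧ᶠ xs)
reflects (e ≐ e′) xs   = ref-≡ _ _
reflects (e ≼ e′) xs   = ref-≤ _ _
reflects (φ ∧ ψ) xs    = ref-and (reflects φ xs) (reflects ψ xs)
reflects (φ ∨ ψ) xs    = ref-or (reflects φ xs) (reflects ψ xs)
reflects (φ ⇒ ψ) xs    = ref-map (ref-or (ref-not (reflects φ xs)) (reflects ψ xs))
  (λ { (inj₁ ¬p) p → contradiction p ¬p ; (inj₂ q) p → q }) (λ h → from h (χ φ xs) refl)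
  where
  from : (⟦ φ ⟧ᶠ xs → ⟦ ψ ⟧ᶠ xs) → ∀ v → χ φ xs ≡ v → ¬ ⟦ φ ⟧ᶠ xs ⊎ ⟦ ψ ⟧ᶠ xs
  from h zero    eq = inj₁ (λ p → contradiction (≤-trans (proj₂ (reflects φ xs) p) (≤-reflexive eq)) λ ())
  from h (suc v) eq = inj₂ (h (proj₁ (reflects φ xs) (≤-trans (s≤s z≤n) (≤-reflexive (sym eq)))))
reflects (¬′ φ) xs     = ref-not (reflects φ xs)
reflects (∃< e ∙ φ) xs = ref-some (λ z → reflects φ (z ∷ xs)) (val e xs)
reflects (∀< e ∙ φ) xs = ref-every (λ z → reflects φ (z ∷ xs)) (val e xs)

ps-bounded : ∀ {n} {q : (ℕ → ℕ) → ℕ → ℕ} {k} (h : Exp 2) → (∀ f → q f 0 ≡ k) →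
    (∀ f t → q f (suc t) ≡ val h (q f t ∷ f t ∷ [])) →
  (∀ f t → q f t ≤ 1) → {f : Vec ℕ (suc n) → ℕ} → PS f → PS {suc n} (λ { (t ∷ xs) → q (λ z → f (z ∷ xs)) t })
ps-bounded {n} {q} {k} h q0 qs q≤1 {f} F = ps-ext
    (ps-rec (ps-lit k) (ps-exp step) (grows-≤ (grows (ps-lit 1))
        (λ { (t ∷ xs) → subst (_≤ 1) (eq t xs) (q≤1 _ t) })))
    (λ { (t ∷ xs) → sym (eq t xs) })
  where
  step : Exp (2 + n)
  step = app (ps-exp h) (var 0F ∷ app (ps-rename F (tabulate suc)) (tabulate var) ∷ [])
  vals-var : ∀ {m} (ys : Vec ℕ m) {j} (ρ : Fin j → Fin m) →
      vals (tabulate (var ∘ ρ)) ys ≡ tabulate (lookup ys ∘ ρ)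
  vals-var ys {zero}  ρ = refl
  vals-var ys {suc j} ρ = cong (lookup ys (ρ zero) ∷_) (vals-var ys (ρ ∘ suc))
  ctx : ℕ → Vec ℕ n → Vec ℕ (2 + n)
  ctx t xs = rec (λ _ → k) (val step) (t ∷ xs) ∷ t ∷ xs
  eq : ∀ t xs → q (λ z → f (z ∷ xs)) t ≡ rec (λ _ → k) (val step) (t ∷ xs)
  eq zero    xs = q0 _
  eq (suc t) xs = trans (qs _ t) (cong₂ (λ a b → val h (a ∷ b ∷ [])) (eq t xs)
    (cong f (sym (trans (cong (λ ys → map (lookup ys) (tabulate suc))
        (trans (vals-var (ctx t xs) id) (tabulate∘lookup (ctx t xs))))
      (lookup-tail (rec (λ _ → k) (val step) (t ∷ xs)) (t ∷ xs))))))

sg≤1 : ∀ x → 1 ∸ x ≤ 1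
sg≤1 x = m∸n≤m 1 x

ps-χ : ∀ {n} (φ : Fm n) → PS (χ φ)
ps-χ (e ≐ e′) = ps-exp (lit 1 ∸′ ((e ∸′ e′) +′ (e′ ∸′ e)))
ps-χ (e ≼ e′) = ps-exp (lit 1 ∸′ (e ∸′ e′))
ps-χ (φ ∧ ψ)  = ps-ext (ps-let (ps-χ φ) (ps-let (ps-rename (ps-χ ψ) (tabulate suc))
    (ps-exp (var 1F *′ var 0F))))
  (λ xs → cong (λ ys → χ φ xs * χ ψ ys) (lookup-tail (χ φ xs) xs))
ps-χ (φ ∨ ψ)  = ps-ext (ps-let (ps-χ φ) (ps-let (ps-rename (ps-χ ψ) (tabulate suc))
    (ps-exp (var 1F +′ var 0F))))
  (λ xs → cong (λ ys → χ φ xs + χ ψ ys) (lookup-tail (χ φ xs) xs))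
ps-χ (φ ⇒ ψ)  = ps-ext (ps-let (ps-χ φ) (ps-let (ps-rename (ps-χ ψ) (tabulate suc))
    (ps-exp ((lit 1 ∸′ var 1F) +′ var 0F))))
  (λ xs → cong (λ ys → (1 ∸ χ φ xs) + χ ψ ys) (lookup-tail (χ φ xs) xs))
ps-χ (¬′ φ)   = ps-let (ps-χ φ) (ps-exp (lit 1 ∸′ var 0F))
ps-χ (∃< e ∙ φ) = ps-let (ps-exp e) (ps-bounded {q = some} (lit 1 ∸′ (lit 1 ∸′ (var 0F +′ var 1F)))
    (λ _ → refl) (λ _ _ → refl)
  (λ { f zero → z≤n ; f (suc t) → sg≤1 (1 ∸ (some f t + f t)) }) (ps-χ φ))
ps-χ (∀< e ∙ φ) = ps-let (ps-exp e) (ps-bounded {q = every} (lit 1 ∸′ (lit 1 ∸′ (var 0F *′ var 1F)))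
    (λ _ → refl) (λ _ _ → refl)
  (λ { f zero → ≤-refl ; f (suc t) → sg≤1 (1 ∸ every f t * f t) }) (ps-χ φ))

-- Case distinction, division and digits

cond : ℕ → ℕ → ℕ → ℕ
cond zero    x y = y
cond (suc _) x y = x

ps-cond : PS ⟨ cond ⟩₃
ps-cond = ps-ext (ps-exp ((lit 1 ∸′ (lit 1 ∸′ var 0F)) *′ var 1F +′ (lit 1 ∸′ var 0F) *′ var 2F))
    λ { (zero ∷ x ∷ y ∷ []) → +-identityʳ y ; (suc c ∷ x ∷ y ∷ []) → eq c x y }
  where
  eq : ∀ c x y → (1 ∸ (0 ∸ c)) * x + (0 ∸ c) * y ≡ x
  eq c x y rewrite 0∸n≡0 c = trans (+-identityʳ _) (+-identityʳ x)

cond′ : ∀ {n} → Exp n → Exp n → Exp n → Exp n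
cond′ c e e′ = app ps-cond (c ∷ e ∷ e′ ∷ [])

min′ : ∀ {n} → Exp n → Exp n → Exp n
min′ = λ e e′ → app ps-min (e ∷ e′ ∷ [])
  where
  eq : ∀ x y → x ∸ (x ∸ y) ≡ x ⊓ y
  eq x y with ≤-total x y
  ... | inj₁ le = trans (cong (x ∸_) (m≤n⇒m∸n≡0 le)) (sym (m≤n⇒m⊓n≡m le))
  ... | inj₂ le = trans (m∸[m∸n]≡n le) (sym (m≥n⇒m⊓n≡n le))
  ps-min : PS ⟨ _⊓_ ⟩₂
  ps-min = ps-ext (ps-exp (var 0F ∸′ (var 0F ∸′ var 1F))) λ { (x ∷ y ∷ []) → eq x y }

-- The value `n` for the divisor 0 is what the count in `ps-quot` yields, since every candidate then
-- passes its test; it also keeps `quot n m ≤ n` without exception.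
quot : ℕ → ℕ → ℕ
quot n zero      = n
quot n m@(suc _) = n / m

rem : ℕ → ℕ → ℕ
rem n m = n ∸ quot n m * m

quot*≤ : ∀ n m → quot n m * m ≤ n
quot*≤ n zero    = ≤-trans (≤-reflexive (*-zeroʳ n)) z≤n
quot*≤ n (suc m) = m/n*n≤m n (suc m)

quot≤ : ∀ n m → quot n m ≤ n
quot≤ n zero    = ≤-refl
quot≤ n (suc m) = m/n≤m n (suc m)

<quot* : ∀ n m → n < suc (quot n (suc m)) * suc m
<quot* n m = begin-strict
  n                                     ≡⟨ m≡m%n+[m/n]*n n (suc m) ⟩
  n % suc m + (n / suc m) * suc m       <⟨ +-monoˡ-< _ (m%n<n n (suc m)) ⟩
  suc m + (n / suc m) * suc m           ∎
  where open ≤-Reasoning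

quot-digit : ∀ {B x} y → x < B → quot (x + B * y) B ≡ y
quot-digit {suc m} {x} y lt = trans (cong (_/ suc m) (cong (x +_) (*-comm (suc m) y)))
  (trans (+-distrib-/-∣ʳ x {y * suc m} {suc m} (divides-refl y))
    (cong₂ _+_ (m<n⇒m/n≡0 lt) (m*n/n≡m y (suc m))))
  where open import Data.Nat.Divisibility using (divides-refl)

rem-digit : ∀ {B x} y → x < B → rem (x + B * y) B ≡ x
rem-digit {B} {x} y lt = begin
  x + B * y ∸ quot (x + B * y) B * B ≡⟨ cong (λ z → x + B * y ∸ z * B) (quot-digit y lt) ⟩
  x + B * y ∸ y * B                  ≡⟨ cong (λ z → x + z ∸ y * B) (*-comm B y) ⟩
  x + y * B ∸ y * B                  ≡⟨ m+n∸n≡m x (y * B) ⟩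
  x                                  ∎
  where open ≡-Reasoning

rem< : ∀ s {B} → 1 ≤ B → rem s B < B
rem< s {suc m} _ = subst (_< suc m) (m%n≡m∸m/n*n s (suc m)) (m%n<n s (suc m))

-- After `t` rounds the count is `t ⊓ quot n m`: it rises as long as one more multiple of `m` fits
-- into `n`. As the quotient is at most `n`, `n` rounds suffice.
ps-quot : PS ⟨ quot ⟩₂
ps-quot = ps-ext (ps-rename ps-count (0F ∷ 0F ∷ 1F ∷ []))
    (λ { (n ∷ m ∷ []) → trans (count-quot n m n ≤-refl) (m≥n⇒m⊓n≡n (quot≤ n m)) })
  where
  step : Exp 4
  step = var 0F +′ (lit 1 ∸′ ((lit 1 +′ var 0F) *′ var 3F ∸′ var 2F))
  count : ℕ → ℕ → ℕ → ℕ
  count zero    n m = 0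
  count (suc t) n m = val step (count t n m ∷ t ∷ n ∷ m ∷ [])
  count≤ : ∀ t n m → count t n m ≤ t
  count≤ zero    n m = z≤n
  count≤ (suc t) n m = ≤-trans (+-mono-≤ (count≤ t n m) (sg≤1 (suc (count t n m) * m ∸ n)))
      (≤-reflexive (+-comm t 1))
  ps-count : PS ⟨ count ⟩₃
  ps-count = ps-recᵉ (lit 0) step (var 0F) (λ { (t ∷ n ∷ m ∷ []) → eq t n m })
      (λ { (t ∷ n ∷ m ∷ []) → count≤ t n m })
    where
    eq : ∀ t n m → count t n m ≡ rec (λ _ → 0) (val step) (t ∷ n ∷ m ∷ [])
    eq zero    n m = refl
    eq (suc t) n m = cong (λ a → val step (a ∷ t ∷ n ∷ m ∷ [])) (eq t n m)
  count-quot : ∀ n m t → t ≤ n → count t n m ≡ t ⊓ quot n m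
  count-quot n m zero    le = refl
  count-quot n m (suc t) le with t <? quot n m
  ... | yes t<q rewrite count-quot n m t (<⇒≤ le) | m≤n⇒m⊓n≡m (<⇒≤ t<q) | m≤n⇒m⊓n≡m t<q
                      | m≤n⇒m∸n≡0 (≤-trans (*-monoˡ-≤ m t<q) (quot*≤ n m)) = +-comm t 1
  ... | no t≮q rewrite count-quot n m t (<⇒≤ le) | m≥n⇒m⊓n≡n (≮⇒≥ t≮q) | m≥n⇒m⊓n≡n (m≤n⇒m≤1+n (≮⇒≥ t≮q))
      with m
  ... | zero   = contradiction le t≮q
  ... | suc m′ with suc (quot n (suc m′)) * suc m′ ∸ n in eq
  ... | zero  = contradiction (m∸n≡0⇒m≤n eq) (<⇒≱ (<quot* n m′))
  ... | suc v = trans (cong (quot n (suc m′) +_) (0∸n≡0 v)) (+-identityʳ _)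

quot′ rem′ : ∀ {n} → Exp n → Exp n → Exp n
quot′ e e′ = app ps-quot (e ∷ e′ ∷ [])
rem′ e e′ = e ∸′ quot′ e e′ *′ e′

shift : ℕ → ℕ → ℕ → ℕ
shift B s zero    = s
shift B s (suc i) = quot (shift B s i) B

shift≤ : ∀ B s i → shift B s i ≤ s
shift≤ B s zero    = ≤-refl
shift≤ B s (suc i) = ≤-trans (quot≤ (shift B s i) B) (shift≤ B s i)

shift-suc : ∀ B s i → shift B s (suc i) ≡ shift B (quot s B) i
shift-suc B s zero    = refl
shift-suc B s (suc i) = cong (λ z → quot z B) (shift-suc B s i)

ps-shift : PS ⟨ shift ⟩₃
ps-shift = ps-ext (ps-rename (ps-recᵉ {f = f} (var 1F) (quot′ (var 0F) (var 2F)) (var 2F)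
    (λ { (i ∷ B ∷ s ∷ []) → eq i B s })
    (λ { (i ∷ B ∷ s ∷ []) → shift≤ B s i })) (2F ∷ 0F ∷ 1F ∷ [])) (λ { (B ∷ s ∷ i ∷ []) → refl })
  where
  f : Vec ℕ 3 → ℕ
  f (i ∷ B ∷ s ∷ []) = shift B s i
  eq : ∀ i B s → shift B s i ≡ rec (val (var 1F)) (val (quot′ (var 0F) (var 2F))) (i ∷ B ∷ s ∷ [])
  eq zero    B s = refl
  eq (suc i) B s = cong (λ z → quot z B) (eq i B s)

shift′ : ∀ {n} → Exp n → Exp n → Exp n → Exp n
shift′ B s i = app ps-shift (B ∷ s ∷ i ∷ [])

opaque
  digitAt : ℕ → ℕ → ℕ → ℕ
  digitAt B s i = rem (shift B s i) B

  ps-digitAt : PS ⟨ digitAt ⟩₃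
  ps-digitAt = ps-ext (ps-exp (rem′ (shift′ (var 0F) (var 1F) (var 2F)) (var 0F)))
      λ { (B ∷ s ∷ i ∷ []) → refl }

  digitAt-zero : ∀ B s → digitAt B s 0 ≡ rem s B
  digitAt-zero B s = refl

  digitAt-suc : ∀ B s i → digitAt B s (suc i) ≡ digitAt B (quot s B) i
  digitAt-suc B s i = cong (λ z → rem z B) (shift-suc B s i)

  digitAt< : ∀ {B} s i → 1 ≤ B → digitAt B s i < B
  digitAt< s i 1≤B = rem< _ 1≤B

  digitAt≤ : ∀ B s i → digitAt B s i ≤ s
  digitAt≤ B s i = ≤-trans (m∸n≤m (shift B s i) (quot (shift B s i) B * B)) (shift≤ B s i)

digitAt′ : ∀ {n} → Exp n → Exp n → Exp n → Exp n
digitAt′ B s i = app ps-digitAt (B ∷ s ∷ i ∷ [])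

code : ℕ → ∀ {n} → (Fin n → ℕ) → ℕ
code B {zero}  f = 0
code B {suc n} f = f zero + B * code B (f ∘ suc)

code< : ∀ B {n} (f : Fin n → ℕ) → (∀ i → f i < B) → code B f < B ^ n
code< B {zero}  f h = s≤s z≤n
code< B {suc n} f h = begin-strict
  f zero + B * code B (f ∘ suc) <⟨ +-monoˡ-< _ (h zero) ⟩
  B + B * code B (f ∘ suc)      ≡⟨ *-suc B _ ⟨
  B * suc (code B (f ∘ suc))    ≤⟨ *-monoʳ-≤ B (code< B (f ∘ suc) (h ∘ suc)) ⟩
  B * B ^ n                     ∎
  where open ≤-Reasoning

digit-code : ∀ B {n} (f : Fin n → ℕ) → (∀ i → f i < B) → ∀ i → digitAt B (code B f) (toℕ i) ≡ f i
digit-code B f h zero    = trans (digitAt-zero B _) (rem-digit _ (h zero))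
digit-code B f h (suc i) = trans (digitAt-suc B _ (toℕ i))
  (trans (cong (λ z → digitAt B z (toℕ i)) (quot-digit _ (h zero))) (digit-code B (f ∘ suc) (h ∘ suc) i))

-- Logarithmic length

≤quot : ∀ {m n k} → m * suc k ≤ n → m ≤ quot n (suc k)
≤quot {m} {n} {k} le = ≤-trans (≤-reflexive (sym (m*n/n≡m m (suc k)))) (/-monoˡ-≤ (suc k) le)

-- Together with `shift≥` the adjunction between multiplication by `2 ^ a` and `shift 2 n a`, which
-- is the floor of `n / 2 ^ a`.
≤shift : ∀ a n m → m * 2 ^ a ≤ n → m ≤ shift 2 n a
≤shift zero    n m le = ≤-trans (≤-reflexive (sym (*-identityʳ m))) le
≤shift (suc a) n m le = ≤quot (≤shift a n (m * 2) (≤-trans (≤-reflexive (*-assoc m 2 (2 ^ a))) le))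

shift≥ : ∀ a n m → m ≤ shift 2 n a → m * 2 ^ a ≤ n
shift≥ zero    n m le = ≤-trans (≤-reflexive (*-identityʳ m)) le
shift≥ (suc a) n m le = ≤-trans (≤-reflexive (sym (*-assoc m 2 (2 ^ a))))
  (shift≥ a n (m * 2) (≤-trans (*-monoˡ-≤ 2 le) (quot*≤ _ 2)))

lgStep : Exp 3
lgStep = var 0F +′ (lit 1 ∸′ (lit 1 ∸′ shift′ (lit 2) (lit 1 +′ var 2F) (lit 1 +′ var 0F)))

lgUpTo : ℕ → ℕ → ℕ
lgUpTo zero    w = 0
lgUpTo (suc t) w = val lgStep (lgUpTo t w ∷ t ∷ w ∷ [])

lgUpTo≤ : ∀ t w → lgUpTo t w ≤ t
lgUpTo≤ zero    w = z≤n
lgUpTo≤ (suc t) w = ≤-trans (+-mono-≤ (lgUpTo≤ t w) (sg≤1 (1 ∸ shift 2 (suc w) (suc (lgUpTo t w)))))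
    (≤-reflexive (+-comm t 1))

<2^ : ∀ j → j < 2 ^ j
<2^ zero    = s≤s z≤n
<2^ (suc j) = ≤-trans (+-mono-≤ (m^n>0 2 j) (<2^ j)) (+-monoʳ-≤ (2 ^ j) (m≤m+n _ 0))

opaque
  -- The largest `j` with `2 ^ j ≤ suc w`. In bijective base 2 this is the number of digits, so
  -- `lg (numeral v)` is the length of the word `v`: the input length recovered from the number.
  lg : ℕ → ℕ
  lg w = lgUpTo w w

  ps-lg : PS ⟨ lg ⟩₁
  ps-lg = ps-ext (ps-rename (ps-recᵉ {f = ⟨ lgUpTo ⟩₂} (lit 0) lgStep (var 0F) (λ { (t ∷ w ∷ []) → eq t w })
      (λ { (t ∷ w ∷ []) → lgUpTo≤ t w })) (0F ∷ 0F ∷ [])) λ { (w ∷ []) → refl }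
    where
    eq : ∀ t w → lgUpTo t w ≡ rec (λ _ → 0) (val lgStep) (t ∷ w ∷ [])
    eq zero    w = refl
    eq (suc t) w = cong (λ a → val lgStep (a ∷ t ∷ w ∷ [])) (eq t w)

  2^lg≤ : ∀ w → 2 ^ lg w ≤ suc w
  2^lg≤ w = go w
    where
    go : ∀ t → 2 ^ lgUpTo t w ≤ suc w
    go zero = s≤s z≤n
    go (suc t) with shift 2 (suc w) (suc (lgUpTo t w)) in eq
    ... | zero  = subst (λ z → 2 ^ z ≤ suc w) (sym (+-identityʳ (lgUpTo t w))) (go t)
    ... | suc v = subst (λ z → 2 ^ z ≤ suc w)
        (trans (+-comm 1 _) (cong (lgUpTo t w +_) (sym (cong (1 ∸_) (0∸n≡0 v)))))
      (≤-trans (≤-reflexive (sym (*-identityˡ _)))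
          (shift≥ (suc (lgUpTo t w)) (suc w) 1 (≤-trans (s≤s z≤n) (≤-reflexive (sym eq)))))

  lg≤ : ∀ w → lg w ≤ w
  lg≤ w = lgUpTo≤ w w

  ≤lg : ∀ {j w} → 2 ^ j ≤ suc w → j ≤ lg w
  -- `j < 2 ^ j ≤ suc w` gives `j ≤ w`, so `w` rounds are enough to reach `j`.
  ≤lg {j} {w} le = subst (_≤ lg w) (m≥n⇒m⊓n≡n (≤-pred (≤-trans (<2^ j) le))) (go w)
    where
    go : ∀ t → t ⊓ j ≤ lgUpTo t w
    go zero    = z≤n
    go (suc t) with j ≤? lgUpTo t w
    ... | yes j≤ = ≤-trans (m⊓n≤n (suc t) j) (≤-trans j≤ (m≤m+n _ _))
    ... | no j≰  = ≤-trans (m⊓n≤m (suc t) j) (≤-trans (s≤s t≤)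
        (≤-trans (≤-reflexive (+-comm 1 _)) (+-monoʳ-≤ (lgUpTo t w) (≤-reflexive (sym step≡1)))))
      where
      t≤ : t ≤ lgUpTo t w
      t≤ with ⊓-sel t j
      ... | inj₁ t≡ = subst (_≤ lgUpTo t w) t≡ (go t)
      ... | inj₂ j≡ = contradiction (subst (_≤ lgUpTo t w) j≡ (go t)) j≰
      step≡1 : 1 ∸ (1 ∸ shift 2 (suc w) (suc (lgUpTo t w))) ≡ 1
      step≡1 with shift 2 (suc w) (suc (lgUpTo t w)) | ≤shift (suc (lgUpTo t w)) (suc w) 1
                  (≤-trans (≤-reflexive (*-identityˡ _)) (≤-trans (^-monoʳ-≤ 2 (≰⇒> j≰)) le))
      ... | suc v | _ = cong (1 ∸_) (0∸n≡0 v)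

-- A variant of the smash function of bounded arithmetic: its length is about the product of the
-- lengths of `B` and `w`. The bounds on codes, arrays and stacks are built from it.
smash : ℕ → ℕ → ℕ
smash B w = B ^ lg w

-- Powers with a free exponent `i` grow too fast for `ps-rec`, whose hypothesis concerns all
-- arguments. So the recursion computes `B ^ (i ⊓ lg w)` and is then taken at `i = lg w`.
ps-smash : PS ⟨ smash ⟩₂
ps-smash = ps-ext (ps-let (ps-exp (app ps-lg (var 1F ∷ []))) ps-powers)
    λ { (B ∷ w ∷ []) → cong (B ^_) (⊓-idem (lg w)) }
  where
  f : Vec ℕ 3 → ℕ
  f (i ∷ B ∷ w ∷ []) = B ^ (i ⊓ lg w)
  step : Exp 4
  step = cond′ (app ps-lg (var 3F ∷ []) ∸′ var 1F) (var 2F *′ var 0F) (var 0F)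
  eq : ∀ i B w → f (i ∷ B ∷ w ∷ []) ≡ rec (λ _ → 1) (val step) (i ∷ B ∷ w ∷ [])
  eq zero    B w = refl
  eq (suc i) B w with lg w ∸ i in e
  ... | zero  = trans (cong (B ^_) (trans (m≥n⇒m⊓n≡n (m≤n⇒m≤1+n lg≤i)) (sym (m≥n⇒m⊓n≡n lg≤i)))) (eq i B w)
    where
    lg≤i : lg w ≤ i
    lg≤i = m∸n≡0⇒m≤n e
  ... | suc v = trans (cong (B ^_) (trans (m≤n⇒m⊓n≡m i<lg) (cong suc (sym (m≤n⇒m⊓n≡m (<⇒≤ i<lg))))))
      (cong (B *_) (eq i B w))
    where
    i<lg : i < lg w
    i<lg = m∸n≢0⇒n<m (λ z → contradiction (trans (sym z) e) λ ())
  bound : ∀ L xs → Below L xs → f xs < 2 ^ poly 2 L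
  bound L (i ∷ B ∷ w ∷ []) b = begin-strict
    B ^ (i ⊓ lg w)        ≤⟨ ^-monoˡ-≤ (i ⊓ lg w) (<⇒≤ (b .below 1F)) ⟩
    (2 ^ L) ^ (i ⊓ lg w)  ≡⟨ ^-*-assoc 2 L (i ⊓ lg w) ⟩
    2 ^ (L * (i ⊓ lg w))  <⟨ ^-monoʳ-< 2 (s≤s (s≤s z≤n)) lt ⟩
    2 ^ poly 2 L             ∎
    where
    open ≤-Reasoning
    lg≤L : lg w ≤ L
    lg≤L = 2^-cancel-≤ (≤-trans (2^lg≤ w) (b .below 2F))
    lt : L * (i ⊓ lg w) < (2 + L) * ((2 + L) * 1)
    lt = begin-strict
      L * (i ⊓ lg w)          ≤⟨ *-monoʳ-≤ L (≤-trans (m⊓n≤n i (lg w)) lg≤L) ⟩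
      L * L                   ≤⟨ *-monoʳ-≤ L (m≤n+m L 2) ⟩
      L * (2 + L)             <⟨ *-monoˡ-< (2 + L) (s≤s (n≤1+n L)) ⟩
      (2 + L) * (2 + L)       ≡⟨ cong ((2 + L) *_) (*-identityʳ (2 + L)) ⟨
      (2 + L) * ((2 + L) * 1) ∎
  ps-powers : PS f
  ps-powers = ps-ext (ps-rec (ps-lit 1) (ps-exp step) (2 , λ L xs b → subst (_< _) (eq′ xs) (bound L xs b)))
      (λ xs → sym (eq′ xs))
    where
    eq′ : ∀ xs → f xs ≡ rec (λ _ → 1) (val step) xs
    eq′ (i ∷ B ∷ w ∷ []) = eq i B w

lg′ : ∀ {n} → Exp n → Exp n
lg′ e = app ps-lg (e ∷ [])

smash′ : ∀ {n} → Exp n → Exp n → Exp n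
smash′ e e′ = app ps-smash (e ∷ e′ ∷ [])

-- Depth-first evaluation with a stack

-- Differs from `some` in trying the candidates upwards, in the order in which a frame on the stack
-- steps through them.
first : (ℕ → ℕ) → ℕ → ℕ → ℕ
first f zero    z = 0
first f (suc k) z = cond (f z) 1 (first f k (suc z))

first≤1 : ∀ f k z → first f k z ≤ 1
first≤1 f zero    z = z≤n
first≤1 f (suc k) z with f z
... | zero  = first≤1 f k (suc z)
... | suc _ = ≤-refl

ref-first : ∀ {f : ℕ → ℕ} {P : ℕ → Set} → (∀ z → Reflects (f z) (P z)) → ∀ k z →
    Reflects (first f k z) (∃ λ y → y < k × P (z + y))
ref-first r zero z = (λ ()) , λ ()
ref-first {f} {P} r (suc k) z with f z in eq
... | zero = ref-map (ref-first r k (suc z))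
    (λ (y , lt , p) → suc y , s≤s lt , subst P (sym (+-suc z y)) p) λ where
      (zero  , lt , p)      → contradiction (≤-trans (proj₂ (r z) (subst P (+-identityʳ z) p))
          (≤-reflexive eq)) λ ()
      (suc y , s≤s lt , p)  → y , lt , subst P (+-suc z y) p
... | suc v = (λ _ → 0 , s≤s z≤n , subst P (sym (+-identityʳ z))
    (proj₁ (r z) (≤-trans (s≤s z≤n) (≤-reflexive (sym eq))))) , λ _ → ≤-refl

module Search (Z : ℕ) (q₁ q₂ : ℕ → ℕ → ℕ) (comb : ℕ → ℕ → ℕ → ℕ → ℕ) where

  ev : ℕ → ℕ → ℕ
  ev zero    x = 0
  ev (suc d) x = first (λ z → comb (ev d (q₁ x z)) (ev d (q₂ x z)) x z) Z 0

  ev≤1 : ∀ d x → ev d x ≤ 1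
  ev≤1 zero    x = z≤n
  ev≤1 (suc d) x = first≤1 _ Z 0

  -- A state consists of the last returned value and the stack of pending calls, in base B.
  -- A frame has phase 1 before its first call, 2 during it, and 3 + r during the second one.
  module Stack (B : ℕ) where

    state : ℕ → ℕ → ℕ
    state r F = r + B * F

    frame : ℕ → ℕ → ℕ → ℕ → ℕ → ℕ
    frame ph d x z S = ph + B * (d + B * (x + B * (z + B * S)))

    transition : ℕ → ℕ → ℕ → ℕ → ℕ → ℕ → ℕ
    transition r ph d x z S =
      cond (ph ∸ 2) (cond (comb (ph ∸ 3) r x z) (state 1 S) (state 0 (frame 1 d x (1 + z) S)))
        (cond (ph ∸ 1) (state 0 (frame 1 (d ∸ 1) (q₂ x z) 0 (frame (3 + r) d x z S)))
          -- The product vanishes if the fuel is used up or no guess is left; in both cases the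
          -- answer is 0.
          (cond (d * (Z ∸ z)) (state 0 (frame 1 (d ∸ 1) (q₁ x z) 0 (frame 2 d x z S))) (state 0 S)))

    next-state : ℕ → ℕ
    next-state s = transition (digitAt B s 0) (digitAt B s 1) (digitAt B s 2) (digitAt B s 3) (digitAt B s 4)
        (shift B s 5)

    module _ (5≤B : 5 ≤ B) (Z<B : Z < B) (q₁<B : ∀ x z → z < Z → q₁ x z < B)
        (q₂<B : ∀ x z → z < Z → q₂ x z < B)
             (D : ℕ) (D<B : D < B) where

      -- One digit for the returned value and four for each of at most `suc D` frames: a call with
      -- fuel `d` on top of `h` frames satisfies `h + d ≤ D`.
      bnd : ℕ
      bnd = B ^ suc (4 * suc D)

      Chain : ℕ → ℕ → Set
      Chain = Iter next-state (λ s → shift B s 1) bnd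

      tiny : ∀ {v} → v ≤ 4 → v < B
      tiny le = ≤-trans (s≤s le) 5≤B

      digit-state : ∀ {r F} i → r < B → digitAt B (state r F) (suc i) ≡ digitAt B F i
      digit-state {r} {F} i lt = trans (digitAt-suc B (state r F) i)
          (cong (λ z → digitAt B z i) (quot-digit F lt))

      shift-state : ∀ {r F} i → r < B → shift B (state r F) (suc i) ≡ shift B F i
      shift-state {r} {F} i lt = trans (shift-suc B (state r F) i)
          (cong (λ z → shift B z i) (quot-digit F lt))

      next-frame : ∀ {r ph d x z} S → r < B → ph < B → d < B → x < B → z < B →
        next-state (state r (frame ph d x z S)) ≡ transition r ph d x z S
      next-frame {r} {ph} {d} {x} {z} S hr hp hd hx hz = transition-cong
          (trans (digitAt-zero B _) (rem-digit s₁ hr))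
          (trans (digit-state 0 hr) (trans (digitAt-zero B _) (rem-digit s₂ hp)))
          (trans (digit-state 1 hr) (trans (digit-state 0 hp) (trans (digitAt-zero B _) (rem-digit s₃ hd))))
          (trans (digit-state 2 hr) (trans (digit-state 1 hp)
              (trans (digit-state 0 hd) (trans (digitAt-zero B _) (rem-digit s₄ hx)))))
          (trans (digit-state 3 hr) (trans (digit-state 2 hp)
              (trans (digit-state 1 hd) (trans (digit-state 0 hx)
                  (trans (digitAt-zero B _) (rem-digit S hz))))))
          (trans (shift-state 4 hr) (trans (shift-state 3 hp)
              (trans (shift-state 2 hd) (trans (shift-state 1 hx) (shift-state 0 hz)))))
        where
        s₄ = z + B * S
        s₃ = x + B * s₄
        s₂ = d + B * s₃
        s₁ = ph + B * s₂
        transition-cong : ∀ {r′ ph′ d′ x′ z′ S′} → r′ ≡ r → ph′ ≡ ph → d′ ≡ d → x′ ≡ x → z′ ≡ z → S′ ≡ S →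
          transition r′ ph′ d′ x′ z′ S′ ≡ transition r ph d x z S
        transition-cong refl refl refl refl refl refl = refl

      cons< : ∀ {r F} e → r < B → F < B ^ e → state r F < B ^ suc e
      cons< {r} {F} e hr hF = begin-strict
        r + B * F    <⟨ +-monoˡ-< (B * F) hr ⟩
        B + B * F    ≡⟨ *-suc B F ⟨
        B * suc F    ≤⟨ *-monoʳ-≤ B hF ⟩
        B * B ^ e    ∎
        where open ≤-Reasoning

      frame< : ∀ {ph d x z S} h → ph < B → d < B → x < B → z < B → S < B ^ (4 * h) →
          frame ph d x z S < B ^ (4 * suc h)
      frame< {ph} {d} {x} {z} {S} h hp hd hx hz hS = subst (λ e → frame ph d x z S < B ^ e) (sym (*-suc 4 h))
        (cons< (3 + 4 * h) hp (cons< (2 + 4 * h) hd (cons< (1 + 4 * h) hx (cons< (4 * h) hz hS))))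

      state≤ : ∀ {r F} h → h ≤ D → r < B → F < B ^ (4 * suc h) → state r F ≤ bnd
      state≤ h le hr hF = ≤-trans (<⇒≤ (cons< (4 * suc h) hr hF))
          (^-monoʳ-≤ B {{>-nonZero (≤-trans (s≤s z≤n) 5≤B)}} (s≤s (*-monoʳ-≤ 4 (s≤s le))))

      -- Phases start at 1, so a stack with a frame is a nonzero number, and the loop recognises the
      -- empty stack as 0.
      frames≢0 : ∀ {r ph d x z S} → r < B → ∃ λ v → shift B (state r (frame (suc ph) d x z S)) 1 ≡ suc v
      frames≢0 hr = _ , shift-state 0 hr

      -- In continuation form: whatever follows once the answer lies on top of `S` may be prefixed
      -- by the call. Thus the two nested calls and the remaining guesses plug into each other. The
      -- outer induction is on the fuel, the inner one on the number `k` of guesses left.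
      run-call : ∀ d x {r S b} h → h + d ≤ D → r < B → x < B → S < B ^ (4 * h) →
        Chain (state (ev d x) S) b → Chain (state r (frame 1 d x 0 S)) b
      run-call zero x {r} {S} {b} h le hr hx hS ch =
        more (state≤ h (≤-trans (m≤m+n h 0) le) hr (frame< h (tiny (s≤s z≤n)) (tiny z≤n) hx (tiny z≤n) hS))
            (proj₂ (frames≢0 hr))
          (subst (λ s → Chain s b) (sym (next-frame S hr (tiny (s≤s z≤n)) (tiny z≤n) hx (tiny z≤n))) ch)
      run-call (suc d) x {r} {S} {b} h le hr hx hS = tries Z 0 refl hr
        where
        f : ℕ → ℕ
        f z = comb (ev d (q₁ x z)) (ev d (q₂ x z)) x z
        h≤D : h ≤ D
        h≤D = ≤-trans (m≤m+n h (suc d)) le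
        le′ : suc h + d ≤ D
        le′ = ≤-trans (≤-reflexive (sym (+-suc h d))) le
        hd : suc d < B
        hd = ≤-trans (s≤s (≤-trans (m≤n+m (suc d) h) le)) D<B
        ev<B : ∀ d x → ev d x < B
        ev<B d x = tiny (≤-trans (ev≤1 d x) (s≤s z≤n))
        ph<B : ∀ d x → 3 + ev d x < B
        ph<B d x = tiny (s≤s (s≤s (s≤s (ev≤1 d x))))
        tries : ∀ k z {r} → z + k ≡ Z → r < B → Chain (state (first f k z) S) b →
            Chain (state r (frame 1 (suc d) x z S)) b
        tries zero z eq hr ch =
          more (state≤ h h≤D hr (frame< h (tiny (s≤s z≤n)) hd hx hz hS)) (proj₂ (frames≢0 hr))
            (subst (λ s → Chain s b) (sym (trans (next-frame S hr (tiny (s≤s z≤n)) hd hx hz) fails)) ch)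
          where
          z≡Z : z ≡ Z
          z≡Z = trans (sym (+-identityʳ z)) eq
          hz : z < B
          hz = subst (_< B) (sym z≡Z) Z<B
          fails : ∀ {u v} → cond (suc d * (Z ∸ z)) u v ≡ v
          fails rewrite z≡Z | n∸n≡0 Z | *-zeroʳ d = refl
        tries (suc k) z {r} eq hr ch =
          more (state≤ h h≤D hr (frame< h (tiny (s≤s z≤n)) hd hx hz hS)) (proj₂ (frames≢0 hr))
            (subst (λ s → Chain s b) (sym (trans (next-frame S hr (tiny (s≤s z≤n)) hd hx hz) descends))
              (run-call d (q₁ x z) (suc h) le′ (tiny z≤n) (q₁<B x z z<Z)
                  (frame< h (tiny (s≤s (s≤s z≤n))) hd hx hz hS)
                (more (state≤ h h≤D (ev<B d _) (frame< h (tiny (s≤s (s≤s z≤n))) hd hx hz hS))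
                    (proj₂ (frames≢0 (ev<B d _)))
                  (subst (λ s → Chain s b) (sym (next-frame S (ev<B d _) (tiny (s≤s (s≤s z≤n))) hd hx hz))
                    (run-call d (q₂ x z) (suc h) le′ (tiny z≤n) (q₂<B x z z<Z)
                        (frame< h (ph<B d _) hd hx hz hS)
                      (more (state≤ h h≤D (ev<B d _) (frame< h (ph<B d _) hd hx hz hS))
                          (proj₂ (frames≢0 (ev<B d _)))
                        (subst (λ s → Chain s b) (sym (next-frame S (ev<B d _) (ph<B d _) hd hx hz))
                          (decides ch))))))))
          where
          z<Z : z < Z
          z<Z = subst (z <_) eq (≤-trans (s≤s (m≤m+n z k)) (≤-reflexive (sym (+-suc z k))))
          hz : z < B
          hz = <-trans z<Z Z<B
          descends : ∀ {u v} → cond (suc d * (Z ∸ z)) u v ≡ u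
          descends with Z ∸ z in e
          ... | zero  = contradiction (m∸n≡0⇒m≤n e) (<⇒≱ z<Z)
          ... | suc _ = refl
          decides : Chain (state (cond (f z) 1 (first f k (suc z))) S) b →
              Chain (cond (f z) (state 1 S) (state 0 (frame 1 (suc d) x (1 + z) S))) b
          decides ch with f z
          ... | zero  = tries k (suc z) (trans (sym (+-suc z k)) eq) (tiny z≤n) ch
          ... | suc _ = ch

      run-search : ∀ d x → d ≤ D → x < B → Chain (state 0 (frame 1 d x 0 0)) (ev d x)
      run-search d x d≤D x<B = run-call d x 0 d≤D (tiny z≤n) x<B ≤-refl
        (halt′ (state-ok (tiny (≤-trans (ev≤1 d x) (s≤s z≤n)))))
        where
        state0 : state (ev d x) 0 ≡ ev d x
        state0 = trans (cong (ev d x +_) (*-zeroʳ B)) (+-identityʳ _)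
        state-ok : ev d x < B → ev d x ≤ bnd
        state-ok lt = ≤-trans (≤-trans (<⇒≤ lt) (≤-reflexive (sym (^-identityʳ B))))
            (^-monoʳ-≤ B {{>-nonZero (≤-trans (s≤s z≤n) 5≤B)}} {1} {suc (4 * suc D)} (s≤s z≤n))
        halt′ : ev d x ≤ bnd → Chain (state (ev d x) 0) (ev d x)
        halt′ le = subst (λ s → Chain s (ev d x)) (sym state0) (halt le
          (trans (cong (λ s → shift B s 1) (sym state0))
              (shift-state {ev d x} {0} 0 (tiny (≤-trans (ev≤1 d x) (s≤s z≤n))))))

pattern 10F = suc 9F
pattern 11F = suc 10F

-- Evaluation of coded circuits

-- The code 0 stands for ∞, and 1 + s for the vector whose components, truncated at R - 1, are the
-- base-R digits of s.
opaque
  radix bound base : ℕ → ℕ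
  radix w = 1 + (1 + w) * (1 + w)
  bound w = smash (radix w) w + (radix w + 8)
  base w = bound w * bound w + 1

  radix-def : ∀ w → radix w ≡ 1 + (1 + w) * (1 + w)
  radix-def w = refl

  bound-def : ∀ w → bound w ≡ smash (radix w) w + (radix w + 8)
  bound-def w = refl

  base-def : ∀ w → base w ≡ bound w * bound w + 1
  base-def w = refl

  ps-radix : PS ⟨ radix ⟩₁
  ps-radix = ps-ext (ps-exp (lit 1 +′ (lit 1 +′ var 0F) *′ (lit 1 +′ var 0F))) λ { (w ∷ []) → refl }

  ps-bound : PS ⟨ bound ⟩₁
  ps-bound = ps-ext (ps-exp (smash′ r (var 0F) +′ (r +′ lit 8))) λ { (w ∷ []) → refl }
    where
    r : Exp 1
    r = app ps-radix (var 0F ∷ [])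

  ps-base : PS ⟨ base ⟩₁
  ps-base = ps-ext (ps-exp (app ps-bound (var 0F ∷ []) *′ app ps-bound (var 0F ∷ []) +′ lit 1))
      λ { (w ∷ []) → refl }

radix′ bound′ base′ : ∀ {n} → Exp n → Exp n
radix′ w = app ps-radix (w ∷ [])
bound′ w = app ps-bound (w ∷ [])
base′ w = app ps-base (w ∷ [])

-- Serves three kinds of gates: a difference is read as a sum too, and an input is compared by
-- adding the zero vector. The digit `R ∸ 1` stands for all components from `R ∸ 1` on, so sums
-- saturate there.
sumᶠ : Fm 5
sumᶠ = (α ≐ lit 0 ∨ β ≐ lit 0) ∧ γ ≐ lit 0
     ∨ lit 1 ≼ α ∧ lit 1 ≼ β ∧ lit 1 ≼ γ ∧ ∀< var 3F ∙ component γ′ ≐ min′ (component α′ +′ component β′)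
         (var 5F ∸′ lit 1)
  where
  α β γ : Exp 5
  α = var 0F
  β = var 1F
  γ = var 2F
  α′ β′ γ′ : Exp 6
  α′ = var 1F
  β′ = var 2F
  γ′ = var 3F
  component : Exp 6 → Exp 6
  component e = digitAt′ (var 5F) (e ∸′ lit 1) (var 0F)

opaque
  TruncatedSum : (k R α β γ : ℕ) → Set
  TruncatedSum k R α β γ = ⟦ sumᶠ ⟧ᶠ (α ∷ β ∷ γ ∷ k ∷ R ∷ [])

  χ-sum : (α β γ k R : ℕ) → ℕ
  χ-sum α β γ k R = χ sumᶠ (α ∷ β ∷ γ ∷ k ∷ R ∷ [])

  ref-sum : ∀ {α β γ k R} → Reflects (χ-sum α β γ k R) (TruncatedSum k R α β γ)
  ref-sum {α} {β} {γ} {k} {R} = reflects sumᶠ (α ∷ β ∷ γ ∷ k ∷ R ∷ [])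

χ-sumⱽ : Vec ℕ 5 → ℕ
χ-sumⱽ (α ∷ β ∷ γ ∷ k ∷ R ∷ []) = χ-sum α β γ k R

opaque
  unfolding χ-sum

  ps-χ-sum : PS χ-sumⱽ
  ps-χ-sum = ps-ext (ps-χ sumᶠ) λ { (α ∷ β ∷ γ ∷ k ∷ R ∷ []) → refl }

  truncatedSum-def : ∀ {k R α β γ} → TruncatedSum k R α β γ ≡
    ((α ≡ 0 ⊎ β ≡ 0) × γ ≡ 0 ⊎ (1 ≤ α × 1 ≤ β × 1 ≤ γ ×
      (∀ i → i < k → digitAt R (γ ∸ 1) i ≡ (digitAt R (α ∸ 1) i + digitAt R (β ∸ 1) i) ⊓ (R ∸ 1))))
  truncatedSum-def = refl

-- Kinds: 0 input, 1 complement, 2 union, 3 intersection, 4 sum, 5 difference.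
combᶠ : Fm 9
combᶠ = kind ≐ lit 0 ∧ sum v (lit 1) c
      ∨ kind ≐ lit 1 ∧ a ≐ c ∧ r₁ ≐ lit 0
      ∨ kind ≐ lit 2 ∧ a ≐ c ∧ b ≐ c ∧ (lit 1 ≼ r₁ ∨ lit 1 ≼ r₂)
      ∨ kind ≐ lit 3 ∧ a ≐ c ∧ b ≐ c ∧ lit 1 ≼ r₁ ∧ lit 1 ≼ r₂
      ∨ kind ≐ lit 4 ∧ lit 1 ≼ r₁ ∧ lit 1 ≼ r₂ ∧ sum a b c
      ∨ kind ≐ lit 5 ∧ lit 1 ≼ r₁ ∧ lit 1 ≼ r₂ ∧ lit 1 ≼ b ∧ sum b c a
  where
  r₁ r₂ a b c kind v : Exp 9
  r₁ = var 0F
  r₂ = var 1F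
  a = var 2F
  b = var 3F
  c = var 4F
  kind = var 5F
  v = var 6F
  sum : Exp 9 → Exp 9 → Exp 9 → Fm 9
  sum x y z = lit 1 ≼ app ps-χ-sum (x ∷ y ∷ z ∷ var 7F ∷ var 8F ∷ [])

module Evaluate (w k kd p₁ p₂ vl : ℕ) where

  -- With `K = bound w`, a query is the pair `g * K + c` of a gate and the code of a value, and a
  -- guess is the pair `a * K + b` of the codes asked of its two predecessors.
  call₁ call₂ : ℕ → ℕ → ℕ
  call₁ x z = digitAt (bound w) p₁ (quot x (bound w)) * bound w + quot z (bound w)
  call₂ x z = digitAt (bound w) p₂ (quot x (bound w)) * bound w + rem z (bound w)

  combine : ℕ → ℕ → ℕ → ℕ → ℕ
  combine r₁ r₂ x z = χ combᶠ (r₁ ∷ r₂ ∷ quot z (bound w) ∷ rem z (bound w) ∷ rem x (bound w) ∷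
    digitAt (bound w) kd (quot x (bound w)) ∷ digitAt (bound w) vl (quot x (bound w)) ∷ k ∷ radix w ∷ [])

  open Search (bound w * bound w) call₁ call₂ combine public
  open Stack (base w) public

  -- The entries of a certificate are arbitrary numbers. Cutting the fuel to `lg w` and the query to
  -- one digit makes the bound on the stack hold for all of them, as `ps-while` demands.
  evaluate : ℕ → ℕ → ℕ
  evaluate d x = ev (d ⊓ lg w) (rem x (base w))

radix≤bound : ∀ w → radix w + 8 ≤ bound w
radix≤bound w = ≤-trans (m≤n+m _ (smash (radix w) w)) (≤-reflexive (sym (bound-def w)))

1≤bound : ∀ w → 1 ≤ bound w
1≤bound w = ≤-trans (≤-trans (s≤s z≤n) (m≤n+m 8 (radix w))) (radix≤bound w)

w<radix : ∀ w → w < radix w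
w<radix w = ≤-trans (s≤s (≤-trans (n≤1+n w) (m≤m+n (suc w) (w * suc w)))) (≤-reflexive (sym (radix-def w)))

w<bound : ∀ w → w < bound w
w<bound w = ≤-trans (w<radix w) (≤-trans (m≤m+n (radix w) 8) (radix≤bound w))

pair< : ∀ {K u v} → u < K → v < K → u * K + v < K * K
pair< {K} {u} {v} hu hv = begin-strict
  u * K + v <⟨ +-monoʳ-< (u * K) hv ⟩
  u * K + K ≡⟨ +-comm (u * K) K ⟩
  suc u * K ≤⟨ *-monoˡ-≤ K hu ⟩
  K * K     ∎
  where open ≤-Reasoning

quot< : ∀ {z K} → z < K * K → quot z K < K
quot< {z} {zero} ()
quot< {z} {suc m} lt = *-cancelʳ-< (suc m) (quot z (suc m)) (suc m) (≤-trans (s≤s (quot*≤ z (suc m))) lt)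

module EvaluateProperties (w k kd p₁ p₂ vl : ℕ) where

  open Evaluate w k kd p₁ p₂ vl
  K = bound w

  chain : ∀ d x → Iter next-state (λ s → shift (base w) s 1) (base w ^ suc (4 * suc (lg w)))
            (state 0 (frame 1 (d ⊓ lg w) (rem x (base w)) 0 0)) (evaluate d x)
  chain d x = run-search
      (≤-trans (s≤s (s≤s (s≤s (s≤s (s≤s z≤n))))) (≤-trans (m≤n+m 8 (radix w)) (≤-trans (radix≤bound w) K≤)))
      KK<
      (λ x z lt → <-trans (pair< (digitAt< p₁ (quot x K) (1≤bound w)) (quot< lt)) KK<)
      (λ x z lt → <-trans (pair< (digitAt< p₂ (quot x K) (1≤bound w)) (rem< z (1≤bound w))) KK<)
      (lg w) (≤-trans (s≤s (lg≤ w)) (≤-trans (w<bound w) K≤))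
      (d ⊓ lg w) (rem x (base w)) (m⊓n≤n d (lg w)) (rem< x (≤-trans (s≤s z≤n) KK<))
    where
    -- Besides queries and guesses the frames contain the exhausted guess `K * K`, which must be a
    -- digit as well; hence the `+ 1` in `base w`.
    KK< : K * K < base w
    KK< = ≤-reflexive (trans (+-comm 1 (K * K)) (sym (base-def w)))
    K≤ : K ≤ base w
    K≤ = ≤-trans (≤-reflexive (sym (*-identityʳ K))) (≤-trans (*-monoʳ-≤ K (1≤bound w)) (<⇒≤ KK<))

  Body : ℕ → ℕ → ℕ → ℕ → ℕ → Set
  Body d g c a b = ⟦ combᶠ ⟧ᶠ (ev d (digitAt K p₁ g * K + a) ∷ ev d (digitAt K p₂ g * K + b) ∷ a ∷ b ∷ c ∷
    digitAt K kd g ∷ digitAt K vl g ∷ k ∷ radix w ∷ [])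

  pair-quot : ∀ {u v} → v < K → quot (u * K + v) K ≡ u
  pair-quot {u} {v} lt = trans (cong (λ y → quot y K) (trans (+-comm (u * K) v) (cong (v +_) (*-comm u K))))
      (quot-digit u lt)

  pair-rem : ∀ {u v} → v < K → rem (u * K + v) K ≡ v
  pair-rem {u} {v} lt = trans (cong (λ y → rem y K) (trans (+-comm (u * K) v) (cong (v +_) (*-comm u K))))
      (rem-digit u lt)

  ref-ev : ∀ d {g c} → c < K → Reflects (ev (suc d) (g * K + c)) (∃₂ λ a b → a < K × b < K × Body d g c a b)
  ref-ev d {g} {c} c<K = ref-map (ref-first (λ z → reflects combᶠ (args z)) (K * K) 0) to from
    where
    x = g * K + c
    args : ℕ → Vec ℕ 9
    args z = ev d (call₁ x z) ∷ ev d (call₂ x z) ∷ quot z K ∷ rem z K ∷ rem x K ∷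
      digitAt K kd (quot x K) ∷ digitAt K vl (quot x K) ∷ k ∷ radix w ∷ []
    body-args : ℕ → ℕ → Vec ℕ 9
    body-args a b = ev d (digitAt K p₁ g * K + a) ∷ ev d (digitAt K p₂ g * K + b) ∷ a ∷ b ∷ c ∷
      digitAt K kd g ∷ digitAt K vl g ∷ k ∷ radix w ∷ []
    args≡ : ∀ z → args z ≡ body-args (quot z K) (rem z K)
    args≡ z = cong₂ (λ g′ c′ → ev d (digitAt K p₁ g′ * K + quot z K) ∷ ev
        d (digitAt K p₂ g′ * K + rem z K) ∷ quot z K ∷ rem z K ∷ c′ ∷
      digitAt K kd g′ ∷ digitAt K vl g′ ∷ k ∷ radix w ∷ []) (pair-quot {g} c<K) (pair-rem {g} c<K)
    to : (∃ λ z → z < K * K × ⟦ combᶠ ⟧ᶠ (args z)) → ∃₂ λ a b → a < K × b < K × Body d g c a b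
    to (z , lt , body) = quot z K , rem z K , quot< lt , rem< z (1≤bound w) , subst ⟦ combᶠ ⟧ᶠ (args≡ z) body
    from : (∃₂ λ a b → a < K × b < K × Body d g c a b) → ∃ λ z → z < K * K × ⟦ combᶠ ⟧ᶠ (args z)
    from (a , b , a<K , b<K , body) = a * K + b , pair< a<K b<K ,
      subst ⟦ combᶠ ⟧ᶠ (sym (trans (args≡ (a * K + b))
          (cong₂ body-args (pair-quot {a} b<K) (pair-rem {a} b<K)))) body

⟨_⟩₈ : (ℕ → ℕ → ℕ → ℕ → ℕ → ℕ → ℕ → ℕ → ℕ) → Vec ℕ 8 → ℕ
⟨ f ⟩₈ (d ∷ x ∷ w ∷ k ∷ kd ∷ p₁ ∷ p₂ ∷ vl ∷ []) = f w k kd p₁ p₂ vl d x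

ps-call₁ : PS ⟨ Evaluate.call₁ ⟩₈
ps-call₁ = ps-ext (ps-exp (digitAt′ K (var 5F) (quot′ (var 0F) K) *′ K +′ quot′ (var 1F) K))
    λ { (x ∷ z ∷ w ∷ k ∷ kd ∷ p₁ ∷ p₂ ∷ vl ∷ []) → refl }
  where K = bound′ (var 2F)

ps-call₂ : PS ⟨ Evaluate.call₂ ⟩₈
ps-call₂ = ps-ext (ps-exp (digitAt′ K (var 6F) (quot′ (var 0F) K) *′ K +′ rem′ (var 1F) K))
    λ { (x ∷ z ∷ w ∷ k ∷ kd ∷ p₁ ∷ p₂ ∷ vl ∷ []) → refl }
  where K = bound′ (var 2F)

combineⱽ : Vec ℕ 10 → ℕ
combineⱽ (r₁ ∷ r₂ ∷ x ∷ z ∷ w ∷ k ∷ kd ∷ p₁ ∷ p₂ ∷ vl ∷ []) = Evaluate.combine w k kd p₁ p₂ vl r₁ r₂ x z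

ps-combine : PS combineⱽ
ps-combine = ps-ext (ps-exp (app (ps-χ combᶠ)
    (var 0F ∷ var 1F ∷ quot′ (var 3F) K ∷ rem′ (var 3F) K ∷ rem′ (var 2F) K ∷
    digitAt′ K (var 6F) (quot′ (var 2F) K) ∷ digitAt′ K (var 9F) (quot′ (var 2F) K) ∷ var
        5F ∷ radix′ (var 4F) ∷ [])))
    λ { (r₁ ∷ r₂ ∷ x ∷ z ∷ w ∷ k ∷ kd ∷ p₁ ∷ p₂ ∷ vl ∷ []) → refl }
  where K = bound′ (var 4F)

transitionⱽ : Vec ℕ 12 → ℕ
transitionⱽ (r ∷ ph ∷ d ∷ x ∷ z ∷ S ∷ w ∷ k ∷ kd ∷ p₁ ∷ p₂ ∷ vl ∷ []) =
    Evaluate.transition w k kd p₁ p₂ vl r ph d x z S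

ps-transition : PS transitionⱽ
ps-transition = ps-ext (ps-exp E) λ { (r ∷ ph ∷ d ∷ x ∷ z ∷ S ∷ w ∷ k ∷ kd ∷ p₁ ∷ p₂ ∷ vl ∷ []) → refl }
  where
  r ph d x z S B : Exp 12
  r = var 0F
  ph = var 1F
  d = var 2F
  x = var 3F
  z = var 4F
  S = var 5F
  B = base′ (var 6F)
  params : Vec (Exp 12) 6
  params = var 6F ∷ var 7F ∷ var 8F ∷ var 9F ∷ var 10F ∷ var 11F ∷ []
  mk′ : Exp 12 → Exp 12 → Exp 12
  mk′ e F = e +′ B *′ F
  frame′ : Exp 12 → Exp 12 → Exp 12 → Exp 12 → Exp 12 → Exp 12
  frame′ e₁ e₂ e₃ e₄ e₅ = e₁ +′ B *′ (e₂ +′ B *′ (e₃ +′ B *′ (e₄ +′ B *′ e₅)))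
  E : Exp 12
  E = cond′ (ph ∸′ lit 2) (cond′ (app ps-combine (ph ∸′ lit 3 ∷ r ∷ x ∷ z ∷ params)) (mk′ (lit 1) S)
      (mk′ (lit 0) (frame′ (lit 1) d x (lit 1 +′ z) S)))
        (cond′ (ph ∸′ lit 1) (mk′ (lit 0) (frame′ (lit 1) (d ∸′ lit 1) (app ps-call₂ (x ∷ z ∷ params)) (lit 0)
            (frame′ (lit 3 +′ r) d x z S)))
          (cond′ (d *′ (bound′ (var 6F) *′ bound′ (var 6F) ∸′ z))
              (mk′ (lit 0) (frame′ (lit 1) (d ∸′ lit 1) (app ps-call₁ (x ∷ z ∷ params)) (lit 0)
                  (frame′ (lit 2) d x z S))) (mk′ (lit 0) S)))

ps-evaluate : PS ⟨ Evaluate.evaluate ⟩₈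
ps-evaluate = ps-while {h = val next′} {c = val (shift′ (B (var 3F)) (var 0F) (lit 1))}
    {bnd = ⟨ (λ w _ _ _ _ _ _ _ → base w ^ suc (4 * suc (lg w))) ⟩₈} (ps-exp start)
    (ps-exp next′) (ps-exp (shift′ (B (var 3F)) (var 0F) (lit 1)))
    (grows-≤ {g = val top} (grows (ps-exp top)) λ { (d ∷ x ∷ w ∷ k ∷ kd ∷ p₁ ∷ p₂ ∷ vl ∷ []) →
        ≤-reflexive (power w) })
    λ { (d ∷ x ∷ w ∷ k ∷ kd ∷ p₁ ∷ p₂ ∷ vl ∷ []) → EvaluateProperties.chain w k kd p₁ p₂ vl d x }
  where
  B : ∀ {n} → Exp n → Exp n
  B w = base′ w
  start : Exp 8
  start = lit 0 +′ B (var 2F) *′ (lit 1 +′ B (var 2F) *′ (min′ (var 0F) (lg′ (var 2F)) +′ B (var 2F) *′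
            (rem′ (var 1F) (B (var 2F)) +′ B (var 2F) *′ (lit 0 +′ B (var 2F) *′ lit 0))))
  next′ : Exp 9
  next′ = app ps-transition (digitAt′ (B (var 3F)) (var 0F) (lit 0) ∷ digitAt′ (B (var 3F)) (var 0F)
      (lit 1) ∷ digitAt′ (B (var 3F)) (var 0F) (lit 2) ∷
    digitAt′ (B (var 3F)) (var 0F) (lit 3) ∷ digitAt′ (B (var 3F)) (var 0F) (lit 4) ∷ shift′ (B (var 3F))
        (var 0F) (lit 5) ∷
    var 3F ∷ var 4F ∷ var 5F ∷ var 6F ∷ var 7F ∷ var 8F ∷ [])
  topB : Exp 8
  topB = B (var 2F)
  top : Exp 8
  top = topB *′ (smash′ (topB *′ topB *′ topB *′ topB) (var 2F) *′ (topB *′ topB *′ topB *′ topB))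
  -- `smash` raises to the exponent `lg w` only, so the bound on the stack is computed from the
  -- fourth power of `b` and two further factors.
  power : ∀ w → let b = base w in b ^ suc (4 * suc (lg w)) ≡ b * ((b * b * b * b) ^ lg w * (b * b * b * b))
  power w = cong (b *_) (begin
    b ^ (4 * suc (lg w))                         ≡⟨ ^-*-assoc b 4 (suc (lg w)) ⟨
    (b ^ 4) ^ suc (lg w)                         ≡⟨ cong (_^ suc (lg w)) b⁴ ⟩
    (b * b * b * b) * (b * b * b * b) ^ lg w     ≡⟨ *-comm (b * b * b * b) _ ⟩
    (b * b * b * b) ^ lg w * (b * b * b * b)     ∎)
    where
    open ≡-Reasoning
    b = base w
    b⁴ : b ^ 4 ≡ b * b * b * b
    b⁴ = trans (cong (λ y → b * (b * (b * y))) (*-identityʳ b)) (trans (cong (b *_) (sym (*-assoc b b b)))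
           (trans (sym (*-assoc b (b * b) b)) (cong (_* b) (sym (*-assoc b b b)))))

-- Canonical binary expansions

data Binary : ℕ → List Bit → Set where
  lsb : ∀ r → Binary (toℕ r) (r ∷ [])
  bits-∷ : ∀ r x {ds} → Binary (suc x) ds → Binary (toℕ r + suc x * 2) (r ∷ ds)

lsb′ : ∀ r → Binary (toℕ r + 0) (r ∷ [])
lsb′ r = subst (λ n → Binary n (r ∷ [])) (sym (+-identityʳ (toℕ r))) (lsb r)

Digits : ℕ → Set
Digits n = ∃ λ (ds : Expansion 2) → fromDigits ds ≡ n

Canonical : (∀ n → <′-Rec Digits n → List Bit) → Set
Canonical f = ∀ n (rec : <′-Rec Digits n) → (∀ {m} (m<n : m <′ n) → Binary m (proj₁ (rec m<n))) →
    Binary n (f n rec)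

canonical-wfRec : ∀ {f : ∀ n → <′-Rec Digits n → Digits n} → Canonical (λ n rec → proj₁ (f n rec)) →
  ∀ {n} a {m} (m<n : m <′ n) → Binary m (proj₁ (Some.wfRecBuilder Digits f n a m<n))
canonical-wfRec c (acc rs) m<n = c _ _ (canonical-wfRec c (rs m<n))

-- toDigits is defined by well-founded recursion with a local step function.  The two
-- underscores stand for that function; they are solved in the proof of toDigits-binary.
step-canonical₀ : ∀ (r : Bit) (y : ℕ) → Canonical _
step-canonical₁ : ∀ (r : Bit) (y : ℕ) → Canonical _

toDigits-binary : ∀ n → Binary n (proj₁ (toDigits 2 n))
toDigits-binary n with <′-wellFounded′ n | n divMod 2
... | _ | result zero    r refl = lsb′ r
... | a | result (suc x) r refl with suc x divMod 2
... | result zero    (suc zero) refl = bits-∷ r _ (lsb _)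
... | result (suc y) zero       refl = bits-∷ r _ (bits-∷ _ _ (canonical-wfRec (step-canonical₀ r y) (a _) _))
... | result (suc y) (suc zero) refl = bits-∷ r _ (bits-∷ _ _ (canonical-wfRec (step-canonical₁ r y) (a _) _))

step-canonical₀ r y n rec h with n divMod 2
... | result zero    r refl = lsb′ r
... | result (suc x) r refl = bits-∷ r x (h _)

step-canonical₁ r y n rec h with n divMod 2
... | result zero    r refl = lsb′ r
... | result (suc x) r refl = bits-∷ r x (h _)

-- Reading tokens off a numeral

numeral-++ : ∀ u v → numeral (u ++ v) ≡ numeral u + 2 ^ length u * numeral v
numeral-++ []          v = sym (+-identityʳ _)
numeral-++ (false ∷ u) v rewrite numeral-++ u v | *-distribˡ-+ 2 (numeral u) (2 ^ length u * numeral v) =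
  cong (λ z → suc (2 * numeral u + z)) (sym (*-assoc 2 (2 ^ length u) (numeral v)))
numeral-++ (true ∷ u)  v rewrite numeral-++ u v | *-distribˡ-+ 2 (numeral u) (2 ^ length u * numeral v) =
  cong (λ z → suc (suc (2 * numeral u + z))) (sym (*-assoc 2 (2 ^ length u) (numeral v)))

-- Four bijective binary digits have a value from 15 to 30, so a word of tokens is a numeral in base
-- 16 with these values as its digits.
token : Token → ℕ
token t = numeral (bits t)

put : List Token → ℕ → ℕ
put ts r = foldr (λ t s → token t + 16 * s) r ts

length-bits : ∀ t → length (bits t) ≡ 4
length-bits (digit zero)       = refl
length-bits (digit (suc zero)) = refl
length-bits sep                = refl
length-bits end                = refl
length-bits infinity           = refl
length-bits (op compl)         = refl
length-bits (op (bin cup))     = refl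
length-bits (op (bin cap))     = refl
length-bits (op (bin plus))    = refl
length-bits (op (bin minus))   = refl

numeral-bits : ∀ ts → numeral (concatMap bits ts) ≡ put ts 0
numeral-bits []       = refl
numeral-bits (t ∷ ts) = trans (numeral-++ (bits t) _)
  (cong₂ (λ l n → token t + 2 ^ l * n) (length-bits t) (numeral-bits ts))

put-++ : ∀ ts us r → put (ts ++ us) r ≡ put ts (put us r)
put-++ ts us r = foldr-++ _ r ts us

eatᶠ : Fm 2
eatᶠ = lit 1 +′ var 0F ≼ var 1F ∧ quot′ (var 1F ∸′ (lit 1 +′ var 0F)) (lit 16) *′ lit 16 ≐ var 1F
    ∸′ (lit 1 +′ var 0F)

-- Nothing is parsed: the certificate prescribes the tokens `ts`, and `F` strips them off the input.
-- `only` makes acceptance conclusive: if `F` takes `suc w` to 1, which means no mismatch and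
-- nothing left, then `w` is the numeral of exactly these tokens.
record Eats (F : ℕ → ℕ) (ts : List Token) : Set where
  constructor eating
  field
    succeeds : ∀ r → F (suc (put ts r)) ≡ suc r
    only     : ∀ v r → F v ≡ suc r → v ≡ suc (put ts r)

-- Gives the iteration of readers its majorant: the state never exceeds the initial one.
Shrinks : (ℕ → ℕ) → Set
Shrinks F = ∀ v → F v ≤ v

cond-true : ∀ {c x y} → 1 ≤ c → cond c x y ≡ x
cond-true (s≤s _) = refl

opaque
  -- The state of the reader is 0 after a mismatch, and otherwise 1 + the numeral of the remaining input.
  eat : ℕ → ℕ → ℕ
  eat c v = cond (χ eatᶠ (c ∷ v ∷ [])) (suc (quot (v ∸ suc c) 16)) 0

  ps-eat : PS ⟨ eat ⟩₂
  ps-eat = ps-ext (ps-exp (cond′ (app (ps-χ eatᶠ) (var 0F ∷ var 1F ∷ []))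
      (lit 1 +′ quot′ (var 1F ∸′ (lit 1 +′ var 0F)) (lit 16)) (lit 0)))
    λ { (c ∷ v ∷ []) → refl }

  eat-shrinks : ∀ c → Shrinks (eat c)
  eat-shrinks c v with χ eatᶠ (c ∷ v ∷ []) | proj₁ (reflects eatᶠ (c ∷ v ∷ []))
  ... | zero  | _ = z≤n
  ... | suc _ | h = ≤-trans (s≤s (quot≤ (v ∸ suc c) 16)) (≤-trans (m≤n+m (suc (v ∸ suc c)) c)
      (≤-reflexive (trans (+-suc c _) (m+[n∸m]≡n (proj₁ (h (s≤s z≤n)))))))

  eat-eats : ∀ t → Eats (eat (token t)) (t ∷ [])
  eat-eats t = eating forth back′
    where
    c : ℕ
    c = token t
    quot16 : ∀ r → quot (16 * r) 16 ≡ r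
    quot16 r = quot-digit {16} {0} r (s≤s z≤n)
    rest : ∀ r → suc (c + 16 * r) ∸ suc c ≡ 16 * r
    rest r = m+n∸m≡n c (16 * r)
    forth : ∀ r → eat c (suc (c + 16 * r)) ≡ suc r
    forth r = trans (cond-true (proj₂ (reflects eatᶠ (c ∷ suc (c + 16 * r) ∷ []))
        (s≤s (m≤m+n c (16 * r)) ,
         trans (cong (λ z → quot z 16 * 16) (rest r))
             (trans (cong (_* 16) (quot16 r)) (trans (*-comm r 16) (sym (rest r)))))))
      (cong suc (trans (cong (λ z → quot z 16) (rest r)) (quot16 r)))
    back′ : ∀ v r → eat c v ≡ suc r → v ≡ suc (c + 16 * r)
    back′ v r eq with χ eatᶠ (c ∷ v ∷ []) | proj₁ (reflects eatᶠ (c ∷ v ∷ []))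
    back′ v r () | zero | _
    back′ v r refl | suc _ | h with h (s≤s z≤n)
    ... | le , eq = trans (sym (m+[n∸m]≡n le))
        (cong (suc c +_) (trans (sym eq) (*-comm (quot (v ∸ suc c) 16) 16)))

eats-∘ : ∀ {F G ts us} → Eats F ts → Eats G us → Eats (G ∘ F) (ts ++ us)
eats-∘ {F} {G} {ts} {us} (eating f f′) (eating g g′) = eating
  (λ r → trans (cong (G ∘ F ∘ suc) (put-++ ts us r)) (trans (cong G (f (put us r))) (g r)))
  (λ v r eq → trans (f′ v _ (g′ (F v) r eq)) (cong suc (sym (put-++ ts us r))))

eats-id : Eats id []
eats-id = eating (λ r → refl) (λ v r eq → eq)

eats-≗ : ∀ {F G ts us} → Eats F ts → (∀ v → G v ≡ F v) → ts ≡ us → Eats G us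
eats-≗ (eating f f′) eq refl = eating (λ r → trans (eq _) (f r)) (λ v r e → f′ v r (trans (sym (eq v)) e))

iterateTo : (ℕ → ℕ → ℕ) → ℕ → ℕ → ℕ
iterateTo F zero    v = v
iterateTo F (suc n) v = F n (iterateTo F n v)

iterate-shrinks : ∀ {F} → (∀ i → Shrinks (F i)) → ∀ n → Shrinks (iterateTo F n)
iterate-shrinks h zero    v = ≤-refl
iterate-shrinks h (suc n) v = ≤-trans (h n _) (iterate-shrinks h n v)

concatTo : {A : Set} → (ℕ → List A) → ℕ → List A
concatTo f zero    = []
concatTo f (suc n) = concatTo f n ++ f n

concatTo-cons : ∀ {A : Set} (f : ℕ → List A) n → concatTo f (suc n) ≡ f 0 ++ concatTo (f ∘ suc) n
concatTo-cons f zero    = sym (++-identityʳ (f 0))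
concatTo-cons f (suc n) = trans (cong (_++ f (suc n)) (concatTo-cons f n)) (++-assoc (f 0) _ _)

concatTo-cong : ∀ {A : Set} {f g : ℕ → List A} n → (∀ i → i < n → f i ≡ g i) → concatTo f n ≡ concatTo g n
concatTo-cong zero    h = refl
concatTo-cong (suc n) h = cong₂ _++_ (concatTo-cong n (λ i lt → h i (m≤n⇒m≤1+n lt))) (h n ≤-refl)

iterate-eats : ∀ {F ts} n → (∀ i → i < n → Eats (F i) (ts i)) → Eats (iterateTo F n) (concatTo ts n)
iterate-eats zero    h = eats-id
iterate-eats (suc n) h = eats-∘ (iterate-eats n (λ i lt → h i (m≤n⇒m≤1+n lt))) (h n ≤-refl)

ps-iterate : ∀ {m} {F : Vec ℕ (2 + m) → ℕ} → PS F → (∀ i v xs → F (i ∷ v ∷ xs) ≤ v) →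
  PS {2 + m} (λ { (n ∷ v ∷ xs) → iterateTo (λ i v → F (i ∷ v ∷ xs)) n v })
ps-iterate {m} {F} P h = ps-ext (ps-rec (ps-var 0F) (ps-rename P ρ)
    (grows-≤ (grows (ps-var 1F)) (λ { (n ∷ v ∷ xs) →
        subst (_≤ v) (eq n v xs) (iterate-shrinks (λ i v → h i v xs) n v) })))
    (λ { (n ∷ v ∷ xs) → sym (eq n v xs) })
  where
  ρ : Vec (Fin (3 + m)) (2 + m)
  ρ = 1F ∷ 0F ∷ tabulate (λ i → suc (suc (suc i)))
  step : Vec ℕ (3 + m) → ℕ
  step ys = F (map (lookup ys) ρ)
  eq : ∀ n v xs → iterateTo (λ i v → F (i ∷ v ∷ xs)) n v ≡ rec (λ ys → lookup ys 0F) step (n ∷ v ∷ xs)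
  eq zero    v xs = refl
  eq (suc n) v xs = trans (cong (λ a → F (n ∷ a ∷ xs)) (eq n v xs))
    (cong (λ ys → F (n ∷ a ∷ ys)) (sym (map-lookup-tabulate (a ∷ n ∷ v ∷ xs) (λ i → suc (suc (suc i)))
        xs (λ _ → refl))))
    where a = rec (λ ys → lookup ys 0F) step (n ∷ v ∷ xs)

cond-shrinks : ∀ {F G} c → Shrinks F → Shrinks G → Shrinks (λ v → cond c (F v) (G v))
cond-shrinks zero    f g = g
cond-shrinks (suc _) f g = f

-- Digit j of x belongs to the expansion if j = 0 or x ≥ 2 ^ j.
eatDigit : ℕ → ℕ → ℕ → ℕ
eatDigit x j v = cond ((1 ∸ j) + shift 2 x j) (eat (15 + 8 * rem (shift 2 x j) 2) v) v

eatDigit-shrinks : ∀ x j → Shrinks (eatDigit x j)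
eatDigit-shrinks x j = cond-shrinks ((1 ∸ j) + shift 2 x j) (eat-shrinks _) (λ v → ≤-refl)

toBit : ℕ → Bit
toBit zero    = zero
toBit (suc _) = suc zero

digitTokens : ℕ → ℕ → List Token
digitTokens y zero    = []
digitTokens y (suc _) = digit (toBit (rem y 2)) ∷ []

tokensAt : ℕ → ℕ → List Token
tokensAt x j = digitTokens (shift 2 x j) ((1 ∸ j) + shift 2 x j)

-- The bit patterns of the two digit tokens differ in their last place only, which has weight 8.
token-toBit : ∀ {b} → b < 2 → 15 + 8 * b ≡ token (digit (toBit b))
token-toBit {zero}        lt = refl
token-toBit {suc zero}    lt = refl
token-toBit {suc (suc b)} (s≤s (s≤s ()))

eatDigit-eats : ∀ x j → Eats (eatDigit x j) (tokensAt x j)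
eatDigit-eats x j with (1 ∸ j) + shift 2 x j
... | zero  = eats-id
... | suc _ = subst (λ c → Eats (eat c) (digit (toBit (rem (shift 2 x j) 2)) ∷ []))
    (sym (token-toBit (rem< (shift 2 x j) (s≤s z≤n)))) (eat-eats (digit (toBit (rem (shift 2 x j) 2))))

toBit-toℕ : ∀ (r : Bit) → toBit (toℕ r) ≡ r
toBit-toℕ zero       = refl
toBit-toℕ (suc zero) = refl

shift-zero : ∀ j → shift 2 0 j ≡ 0
shift-zero j = n≤0⇒n≡0 (shift≤ 2 0 j)

tokens-small : ∀ {x} → quot x 2 ≡ 0 → ∀ n → concatTo (tokensAt x ∘ suc) n ≡ []
tokens-small eq zero    = refl
tokens-small {x} eq (suc n) = cong₂ _++_ (tokens-small eq n)
  (trans (cong (λ y → digitTokens y ((0 ∸ n) + y))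
      (trans (shift-suc 2 x n) (trans (cong (λ y → shift 2 y n) eq) (shift-zero n))))
    (cong (digitTokens 0) (trans (+-identityʳ _) (0∸n≡0 n))))

tokens-large : ∀ {x y} → quot x 2 ≡ suc y → ∀ j → tokensAt x (suc j) ≡ tokensAt (suc y) j
tokens-large {x} {y} eq j = trans
    (cong (λ z → digitTokens z ((0 ∸ j) + z)) (trans (shift-suc 2 x j) (cong (λ z → shift 2 z j) eq)))
    (trans (cong (λ z → digitTokens (shift 2 (suc y) j) (z + shift 2 (suc y) j)) (0∸n≡0 j)) (positive j))
  where
  positive : ∀ j → digitTokens (shift 2 (suc y) j) (shift 2 (suc y) j) ≡ tokensAt (suc y) j
  positive zero    = refl
  positive (suc j) = cong (λ z → digitTokens (shift 2 (suc y) (suc j)) (z + shift 2 (suc y) (suc j)))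
      (sym (0∸n≡0 j))

tokens-first : ∀ r x → tokensAt (toℕ r + 2 * x) 0 ≡ digit r ∷ []
tokens-first r x = cong (λ b → digit b ∷ []) (trans (cong toBit (rem-digit x (toℕ<n r))) (toBit-toℕ r))

-- Rounds past the top digit produce nothing, so running through all `j ≤ n` yields the whole
-- expansion as soon as `x ≤ n`. Halving a positive number makes it smaller, so after the first
-- digit the remaining rounds still suffice.
tokens-binary : ∀ {x ds} → Binary x ds → ∀ n → x ≤ n → concatTo (tokensAt x) (suc n) ≡ lmap digit ds
tokens-binary (lsb r) n le = trans (concatTo-cons (tokensAt (toℕ r)) n)
  (cong₂ _++_ (trans (cong (λ z → tokensAt z 0) (sym (+-identityʳ (toℕ r)))) (tokens-first r 0))
    (tokens-small (trans (cong (λ z → quot z 2) (sym (+-identityʳ (toℕ r)))) (quot-digit 0 (toℕ<n r))) n))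
tokens-binary (bits-∷ r x b) zero le = contradiction (≤-trans (m≤n+m _ (toℕ r)) le) λ ()
tokens-binary (bits-∷ r x b) (suc n) le = trans (concatTo-cons (tokensAt z) (suc n))
  (cong₂ _++_ (trans (cong (λ y → tokensAt (toℕ r + y) 0) (*-comm (suc x) 2)) (tokens-first r (suc x)))
    (trans (concatTo-cong (suc n) (λ j _ → tokens-large
        (trans (cong (λ y → quot (toℕ r + y) 2) (*-comm (suc x) 2)) (quot-digit (suc x) (toℕ<n r))) j))
      (tokens-binary b n (≤-pred (≤-trans (s≤s (s≤s (m≤m*n x 2)))
          (≤-trans (m≤n+m (2 + x * 2) (toℕ r)) le))))))
  where z = toℕ r + suc x * 2

opaque
  eatNumber : ℕ → ℕ → ℕ
  eatNumber x v = eat (token sep) (iterateTo (eatDigit x) (suc x) v)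

  eatNumber-shrinks : ∀ x → Shrinks (eatNumber x)
  eatNumber-shrinks x v = ≤-trans (eat-shrinks (token sep) _) (iterate-shrinks (eatDigit-shrinks x) (suc x) v)

  eatNumber-eats : ∀ x → Eats (eatNumber x) (number x)
  eatNumber-eats x = eats-≗ (eats-∘ (iterate-eats (suc x) (λ j _ → eatDigit-eats x j)) (eat-eats sep))
      (λ v → refl)
    (cong (_++ sep ∷ []) (tokens-binary (toDigits-binary x) x ≤-refl))

  ps-eatNumber : PS ⟨ eatNumber ⟩₂
  ps-eatNumber = ps-ext (ps-exp (app ps-eat (lit (token sep) ∷ app
      (ps-iterate ps-eatDigit (λ { j v (x ∷ []) → eatDigit-shrinks x j v }))
      (lit 1 +′ var 0F ∷ var 1F ∷ var 0F ∷ []) ∷ []))) λ { (x ∷ v ∷ []) → refl }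
    where
    F : Vec ℕ 3 → ℕ
    F (j ∷ v ∷ x ∷ []) = eatDigit x j v
    ps-eatDigit : PS F
    ps-eatDigit = ps-ext (ps-exp (cond′ ((lit 1 ∸′ var 0F) +′ y)
        (app ps-eat (lit 15 +′ lit 8 *′ rem′ y (lit 2) ∷ var 1F ∷ [])) (var 1F)))
        λ { (j ∷ v ∷ x ∷ []) → refl }
      where
      y : Exp 3
      y = shift′ (lit 2) (var 2F) (var 0F)

-- Readers for values, gates and circuits

⟨_⟩₄ : (ℕ → ℕ → ℕ → ℕ → ℕ) → Vec ℕ 4 → ℕ
⟨ f ⟩₄ (x ∷ y ∷ z ∷ u ∷ []) = f x y z u

opaque
  eatValue : (k R α v : ℕ) → ℕ
  eatValue k R α v = cond α (iterateTo (λ i → eatNumber (digitAt R (α ∸ 1) i)) k v) (eat (token infinity) v)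

  eatValue-shrinks : ∀ k R α → Shrinks (eatValue k R α)
  eatValue-shrinks k R α = cond-shrinks α (iterate-shrinks (λ i → eatNumber-shrinks _) k)
      (eat-shrinks (token infinity))

  ps-eatValue : PS ⟨ eatValue ⟩₄
  ps-eatValue = ps-ext (ps-exp (cond′ (var 2F)
      (app (ps-iterate ps-component (λ { i v (R ∷ α ∷ []) → eatNumber-shrinks (digitAt R (α ∸ 1) i) v }))
      (var 0F ∷ var 3F ∷ var 1F ∷ var 2F ∷ [])) (app ps-eat (lit (token infinity) ∷ var 3F ∷ []))))
          λ { (k ∷ R ∷ α ∷ v ∷ []) → refl }
    where
    F : Vec ℕ 4 → ℕ
    F (i ∷ v ∷ R ∷ α ∷ []) = eatNumber (digitAt R (α ∸ 1) i) v
    ps-component : PS F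
    ps-component = ps-ext (ps-exp (app ps-eatNumber
        (digitAt′ (var 2F) (var 3F ∸′ lit 1) (var 0F) ∷ var 1F ∷ []))) λ { (i ∷ v ∷ R ∷ α ∷ []) → refl }

operation : ℕ → ℕ
operation kind = cond (kind ∸ 4) (token (op (bin minus))) (cond (kind ∸ 3) (token (op (bin plus)))
  (cond (kind ∸ 2) (token (op (bin cap))) (token (op (bin cup)))))

opaque
  eatGate : (kind p₁ p₂ α k R v : ℕ) → ℕ
  eatGate kind p₁ p₂ α k R v = cond (kind ∸ 1) (eatNumber p₂ (eatNumber p₁ (eat (operation kind) v)))
    (cond kind (eatNumber p₁ (eat (token (op compl)) v)) (eatValue k R α v))

  eatGate-shrinks : ∀ kind p₁ p₂ α k R → Shrinks (eatGate kind p₁ p₂ α k R)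
  eatGate-shrinks kind p₁ p₂ α k R = cond-shrinks (kind ∸ 1)
    (λ v → ≤-trans (eatNumber-shrinks p₂ _) (≤-trans (eatNumber-shrinks p₁ _)
        (eat-shrinks (operation kind) v)))
    (cond-shrinks kind (λ v → ≤-trans (eatNumber-shrinks p₁ _) (eat-shrinks (token (op compl)) v))
        (eatValue-shrinks k R α))

eatGateⱽ : Vec ℕ 7 → ℕ
eatGateⱽ (kind ∷ p₁ ∷ p₂ ∷ α ∷ k ∷ R ∷ v ∷ []) = eatGate kind p₁ p₂ α k R v

opaque
  unfolding eatGate

  ps-eatGate : PS eatGateⱽ
  ps-eatGate = ps-ext (ps-exp (cond′ (kind ∸′ lit 1)
      (num (var 2F) (num (var 1F) (app ps-eat (opn ∷ var 6F ∷ []))))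
      (cond′ kind (num (var 1F) (app ps-eat (lit (token (op compl)) ∷ var 6F ∷ [])))
          (app ps-eatValue (var 4F ∷ var 5F ∷ var 3F ∷ var 6F ∷ [])))))
      λ { (kind ∷ p₁ ∷ p₂ ∷ α ∷ k ∷ R ∷ v ∷ []) → refl }
    where
    kind opn : Exp 7
    kind = var 0F
    opn = cond′ (kind ∸′ lit 4) (lit (token (op (bin minus))))
        (cond′ (kind ∸′ lit 3) (lit (token (op (bin plus))))
            (cond′ (kind ∸′ lit 2) (lit (token (op (bin cap)))) (lit (token (op (bin cup))))))
    num : Exp 7 → Exp 7 → Exp 7
    num x v = app ps-eatNumber (x ∷ v ∷ [])

opaque
  eatEntry : (ord kd p₁ p₂ vl k w j v : ℕ) → ℕ
  eatEntry ord kd p₁ p₂ vl k w j v = let K = bound w ; g = digitAt K ord j in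
    eat (token end) (eatGate (digitAt K kd g) (digitAt K p₁ g) (digitAt K p₂ g) (digitAt K vl g) k (radix w)
        (eatNumber g v))

  eatEntry-shrinks : ∀ ord kd p₁ p₂ vl k w j → Shrinks (eatEntry ord kd p₁ p₂ vl k w j)
  eatEntry-shrinks ord kd p₁ p₂ vl k w j v = ≤-trans (eat-shrinks (token end) _)
      (≤-trans (eatGate-shrinks _ _ _ _ k (radix w) _) (eatNumber-shrinks _ v))

eatEntryⱽ : Vec ℕ 9 → ℕ
eatEntryⱽ (j ∷ v ∷ ord ∷ kd ∷ p₁ ∷ p₂ ∷ vl ∷ k ∷ w ∷ []) = eatEntry ord kd p₁ p₂ vl k w j v

opaque
  unfolding eatEntry

  ps-eatEntry : PS eatEntryⱽ
  ps-eatEntry = ps-ext (ps-exp (app ps-eat (lit (token end) ∷ app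
      ps-eatGate (digitAt′ K (var 3F) g ∷ digitAt′ K (var 4F) g ∷ digitAt′ K (var 5F) g ∷
      digitAt′ K (var 6F) g ∷ var 7F ∷ radix′ (var 8F) ∷ app ps-eatNumber (g ∷ var 1F ∷ []) ∷ []) ∷ [])))
      λ { (j ∷ v ∷ ord ∷ kd ∷ p₁ ∷ p₂ ∷ vl ∷ k ∷ w ∷ []) → refl }
    where
    K g : Exp 9
    K = bound′ (var 8F)
    g = digitAt′ K (var 2F) (var 0F)

opaque
  eatCircuit : (w k n out ord kd p₁ p₂ vl b : ℕ) → ℕ
  eatCircuit w k n out ord kd p₁ p₂ vl b =
    eat (token end) (eatValue k (radix w) b (iterateTo (eatEntry ord kd p₁ p₂ vl k w)
        n (eat (token end) (eatNumber out (suc w)))))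

eatCircuitⱽ : Vec ℕ 10 → ℕ
eatCircuitⱽ (w ∷ k ∷ n ∷ out ∷ ord ∷ kd ∷ p₁ ∷ p₂ ∷ vl ∷ b ∷ []) = eatCircuit w k n out ord kd p₁ p₂ vl b

opaque
  unfolding eatCircuit

  ps-eatCircuit : PS eatCircuitⱽ
  ps-eatCircuit = ps-ext (ps-exp (app ps-eat (lit (token end) ∷ app
      ps-eatValue (var 1F ∷ radix′ (var 0F) ∷ var 9F ∷
      app (ps-iterate ps-eatEntry (λ { j v (ord ∷ kd ∷ p₁ ∷ p₂ ∷ vl ∷ k ∷ w ∷ []) →
          eatEntry-shrinks ord kd p₁ p₂ vl k w j v }))
        (var 2F ∷ app ps-eat (lit (token end) ∷ app ps-eatNumber (var 3F ∷ (lit 1 +′ var 0F) ∷ []) ∷ []) ∷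
         var 4F ∷ var 5F ∷ var 6F ∷ var 7F ∷ var 8F ∷ var 1F ∷ var 0F ∷ []) ∷ []) ∷ [])))
      λ { (w ∷ k ∷ n ∷ out ∷ ord ∷ kd ∷ p₁ ∷ p₂ ∷ vl ∷ b ∷ []) → refl }

-- Sets that depend on components only up to a threshold

data Close {k} (s : ℕ) : ℕ∞ k → ℕ∞ k → Set where
  ∞   : Close s ∞ ∞
  fin : ∀ {a b} → (∀ i → lookup a i ⊓ s ≡ lookup b i ⊓ s) → Close s (fin a) (fin b)

close-sym : ∀ {k s} {x y : ℕ∞ k} → Close s x y → Close s y x
close-sym ∞       = ∞
close-sym (fin h) = fin (sym ∘ h)

⊓-cases : ∀ {x y s} → x ⊓ s ≡ y ⊓ s → x ≡ y ⊎ (s ≤ x × s ≤ y)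
⊓-cases {x} {y} {s} eq with ≤-total x s | ≤-total y s
... | inj₁ p | inj₁ q = inj₁ (trans (sym (m≤n⇒m⊓n≡m p)) (trans eq (m≤n⇒m⊓n≡m q)))
... | inj₁ p | inj₂ q = inj₂ (≤-reflexive (trans (sym (m≥n⇒m⊓n≡n q)) (trans (sym eq) (m≤n⇒m⊓n≡m p))) , q)
... | inj₂ p | inj₁ q = inj₂ (p , ≤-reflexive (trans (sym (m≥n⇒m⊓n≡n p)) (trans eq (m≤n⇒m⊓n≡m q))))
... | inj₂ p | inj₂ q = inj₂ (p , q)

⊓-large : ∀ {x y s} → s ≤ x → s ≤ y → x ⊓ s ≡ y ⊓ s
⊓-large p q = trans (m≥n⇒m⊓n≡n p) (sym (m≥n⇒m⊓n≡n q))

⊓-mono-≡ : ∀ {x y s t} → s ≤ t → x ⊓ t ≡ y ⊓ t → x ⊓ s ≡ y ⊓ s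
⊓-mono-≡ s≤t eq with ⊓-cases eq
... | inj₁ refl    = refl
... | inj₂ (p , q) = ⊓-large (≤-trans s≤t p) (≤-trans s≤t q)

⊓-+ : ∀ b {x y s} → x ⊓ s ≡ y ⊓ s → (b + x) ⊓ s ≡ (b + y) ⊓ s
⊓-+ b {x} {y} eq with ⊓-cases eq
... | inj₁ refl    = refl
... | inj₂ (p , q) = ⊓-large (≤-trans p (m≤n+m x b)) (≤-trans q (m≤n+m y b))

close-mono : ∀ {k s t} {x y : ℕ∞ k} → s ≤ t → Close t x y → Close s x y
close-mono le ∞       = ∞
close-mono le (fin h) = fin (λ i → ⊓-mono-≡ le (h i))

Invariant : ∀ {k} → ℕ → Pred (ℕ∞ k) 0ℓ → Set
Invariant s A = ∀ {x y} → Close s x y → A x → A y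

invariant-mono : ∀ {k s t} {A : Pred (ℕ∞ k) 0ℓ} → s ≤ t → Invariant s A → Invariant t A
invariant-mono le inv c = inv (close-mono le c)

-- If `a + b` and `y` are both at least `s + s`, one of `a` and `b` is at least `s`. It absorbs the
-- change from `a + b` to `y`, while the other one is kept or cut down to `s`.
split-sum : ∀ s a b y → (a + b) ⊓ (s + s) ≡ y ⊓ (s + s) → ∃₂ λ a′ b′ →
    a′ + b′ ≡ y × a ⊓ s ≡ a′ ⊓ s × b ⊓ s ≡ b′ ⊓ s
split-sum s a b y eq with ⊓-cases eq
... | inj₁ refl = a , b , refl , refl , refl
... | inj₂ (p , q) with ≤-total s a
-- `b` itself might exceed `y`; cut down to `s` it keeps its truncation and leaves at least `s` for
-- the other summand.
... | inj₁ s≤a = y ∸ (b ⊓ s) , b ⊓ s , m∸n+n≡m (≤-trans (m⊓n≤n b s) (≤-trans (m≤m+n s s) q)) ,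
    ⊓-large s≤a (≤-trans (≤-reflexive (sym (m+n∸n≡m s s))) (∸-mono q (m⊓n≤n b s))) ,
    sym (trans (⊓-assoc b s s) (cong (b ⊓_) (⊓-idem s)))
... | inj₂ a≤s = a , y ∸ a , m+[n∸m]≡n (≤-trans a≤s (≤-trans (m≤m+n s s) q)) , refl ,
    ⊓-large (+-cancelˡ-≤ s s b (≤-trans p (+-monoˡ-≤ b a≤s)))
            (≤-trans (≤-reflexive (sym (m+n∸n≡m s s))) (∸-mono q a≤s))

lookup-ext : ∀ {k} {u v : Vec ℕ k} → (∀ i → lookup u i ≡ lookup v i) → u ≡ v
lookup-ext {u = u} {v} h = trans (sym (tabulate∘lookup u)) (trans (tabulate-cong h) (tabulate∘lookup v))

invariant-plus : ∀ {k s} {A B : Pred (ℕ∞ k) 0ℓ} → Invariant s A → Invariant s B → Invariant (s + s) (A ⊕ B)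
invariant-plus invA invB ∞ (a , b , a∈A , b∈B , eq) = a , b , a∈A , b∈B , eq
invariant-plus {s = s} invA invB (fin h) (fin a , ∞ , a∈A , b∈B , ())
invariant-plus {s = s} invA invB (fin h) (∞ , b , a∈A , b∈B , ())
invariant-plus {s = s} {A} {B} invA invB (fin {b = y} h) (fin a , fin b , a∈A , b∈B , refl) =
  fin (tabulate (proj₁ ∘ parts)) , fin (tabulate (proj₁ ∘ proj₂ ∘ parts)) ,
  invA (fin λ i → trans (proj₁ (proj₂ (proj₂ (proj₂ (parts i)))))
      (cong (_⊓ s) (sym (lookup∘tabulate (proj₁ ∘ parts) i)))) a∈A ,
  invB (fin λ i → trans (proj₂ (proj₂ (proj₂ (proj₂ (parts i)))))
      (cong (_⊓ s) (sym (lookup∘tabulate (proj₁ ∘ proj₂ ∘ parts) i)))) b∈B ,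
  cong fin (lookup-ext λ i → trans (lookup-zipWith _+_ i (tabulate (proj₁ ∘ parts))
      (tabulate (proj₁ ∘ proj₂ ∘ parts)))
    (trans (cong₂ _+_ (lookup∘tabulate (proj₁ ∘ parts) i) (lookup∘tabulate (proj₁ ∘ proj₂ ∘ parts) i))
        (proj₁ (proj₂ (proj₂ (parts i))))))
  where
  parts : ∀ i → ∃₂ λ a′ b′ → a′ + b′ ≡ lookup y i × lookup a i ⊓ s ≡ a′ ⊓ s × lookup b i ⊓ s ≡ b′ ⊓ s
  parts i = split-sum s (lookup a i) (lookup b i) (lookup y i)
      (trans (cong (_⊓ (s + s)) (sym (lookup-zipWith _+_ i a b))) (h i))

+-∸-vec : ∀ {k} (b c : Vec ℕ k) → zipWith _∸_ (zipWith _+_ b c) b ≡ c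
+-∸-vec []      []      = refl
+-∸-vec (x ∷ b) (y ∷ c) = cong₂ _∷_ (m+n∸m≡n x y) (+-∸-vec b c)

b≤b+c : ∀ {k} (b c : Vec ℕ k) → Pointwise _≤_ b (zipWith _+_ b c)
b≤b+c []      []      = []
b≤b+c (x ∷ b) (y ∷ c) = m≤m+n x y ∷ b≤b+c b c

-- With `plus⇒minus` this turns differences into sums with a finite summand `b`. It covers
-- `∞ - b = ∞` because `b + ∞ = ∞`.
minus⇒plus : ∀ {k} {a b c : ℕ∞ k} → a - b ≐ c → (∃ λ b′ → b ≡ fin b′) × a ≡ b ∞+ c
minus⇒plus (fin-fin h) = (_ , refl) , cong fin (sym (go h))
  where
  go : ∀ {k} {b a : Vec ℕ k} → Pointwise _≤_ b a → zipWith _+_ b (zipWith _∸_ a b) ≡ a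
  go []       = refl
  go (p ∷ ps) = cong₂ _∷_ (m+[n∸m]≡n p) (go ps)
minus⇒plus ∞-fin = (_ , refl) , refl

plus⇒minus : ∀ {k} (b : Vec ℕ k) c → (fin b ∞+ c) - fin b ≐ c
plus⇒minus b (fin c) = subst (λ z → fin (zipWith _+_ b c) - fin b ≐ fin z) (+-∸-vec b c) (fin-fin (b≤b+c b c))
plus⇒minus b ∞       = ∞-fin

close-+ : ∀ {k s} (b : ℕ∞ k) {x y} → Close s x y → Close s (b ∞+ x) (b ∞+ y)
close-+ ∞       c = ∞
close-+ (fin b) ∞ = ∞
close-+ {s = s} (fin b) (fin {x} {y} h) = fin λ i → trans (cong (_⊓ s) (lookup-zipWith _+_ i b x))
  (trans (⊓-+ (lookup b i) (h i)) (cong (_⊓ s) (sym (lookup-zipWith _+_ i b y))))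

-- Keep the subtrahend and move the minuend along with the result: adding `b` to close values gives
-- close values, so the threshold does not grow, however large the minuends are.
invariant-minus : ∀ {k s} {A B : Pred (ℕ∞ k) 0ℓ} → Invariant s A → Invariant s (A ⊖ B)
invariant-minus {A = A} inv {x} {y} c (a , b , a∈A , b∈B , eq) with minus⇒plus eq
... | (b′ , refl) , refl = fin b′ ∞+ y , fin b′ , inv (close-+ (fin b′) c) a∈A , b∈B , plus⇒minus b′ y

invariant-∁ : ∀ {k s} {A : Pred (ℕ∞ k) 0ℓ} → Invariant s A → Invariant s (λ x → ¬ A x)
invariant-∁ inv c x∉ y∈ = x∉ (inv (close-sym c) y∈)

ComponentsBelow : ∀ {k} → ℕ → ℕ∞ k → Set
ComponentsBelow m (fin a) = ∀ i → lookup a i < m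
ComponentsBelow m ∞       = ⊤

invariant-singleton : ∀ {k m} (a : ℕ∞ k) → ComponentsBelow m a → Invariant m (a ≡_)
invariant-singleton ∞       h ∞ refl = refl
invariant-singleton {m = m} (fin a) h (fin {b = b} c) refl = cong fin (lookup-ext λ i → eq i (⊓-cases (c i)))
  where
  eq : ∀ i → lookup a i ≡ lookup b i ⊎ (m ≤ lookup a i × m ≤ lookup b i) → lookup a i ≡ lookup b i
  eq i (inj₁ e)       = e
  eq i (inj₂ (p , _)) = contradiction p (<⇒≱ (h i))

-- Gates and their codes

opNumber : BinOp → ℕ
opNumber cup   = 2
opNumber cap   = 3
opNumber plus  = 4
opNumber minus = 5

data Matches {k n} (Rep : ℕ → ℕ∞ k → Set) (m : ℕ) : Gate U k n → (kind p₁ p₂ v : ℕ) → Set where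
  input      : ∀ {a p₁ p₂ v} → Rep v a → ComponentsBelow m a → Matches Rep m (input a) 0 p₁ p₂ v
  complement : ∀ {o h p₂ v} → Matches Rep m (complement o h) 1 (toℕ h) p₂ v
  binary     : ∀ {σ o g₁ g₂ le v} → Matches Rep m (binary σ o g₁ g₂ le) (opNumber σ) (toℕ g₁) (toℕ g₂) v

-- What the search has to know about codes. The essential point is `close`: values with a common
-- code cannot be told apart by a set with threshold `θ`, so one guess stands for all of them. `sum`
-- and `sum′` hold for every choice of representatives.
record Coding {k} (kn R K θ : ℕ) (Rep : ℕ → ℕ∞ k → Set) : Set where
  field
    total  : ∀ x → ∃ λ α → α < K × Rep α x
    onto   : ∀ α → α < K → ∃ λ x → Rep α x
    close  : ∀ {α x y} → Rep α x → Rep α y → Close θ x y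
    finite : ∀ {α x} → Rep α x → 1 ≤ α → ∃ λ b → x ≡ fin b
    finite′ : ∀ {α b} → Rep α (fin b) → 1 ≤ α
    unit    : Rep 1 (fin (Vec.replicate k 0))
    sum    : ∀ {α β γ a b} → Rep α a → Rep β b → TruncatedSum kn R α β γ → Rep γ (a ∞+ b)
    sum′   : ∀ {α β γ a b} → Rep α a → Rep β b → Rep γ (a ∞+ b) → TruncatedSum kn R α β γ

-- `combᶠ` as a function of the kind, so that the kind of a given gate selects its clause by
-- computation.
Cases : (kn R κ r₁ r₂ a b c v : ℕ) → Set
Cases kn R 0 r₁ r₂ a b c v = TruncatedSum kn R v 1 c
Cases kn R 1 r₁ r₂ a b c v = a ≡ c × r₁ ≡ 0
Cases kn R 2 r₁ r₂ a b c v = a ≡ c × b ≡ c × (1 ≤ r₁ ⊎ 1 ≤ r₂)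
Cases kn R 3 r₁ r₂ a b c v = a ≡ c × b ≡ c × 1 ≤ r₁ × 1 ≤ r₂
Cases kn R 4 r₁ r₂ a b c v = 1 ≤ r₁ × 1 ≤ r₂ × TruncatedSum kn R a b c
Cases kn R 5 r₁ r₂ a b c v = 1 ≤ r₁ × 1 ≤ r₂ × 1 ≤ b × TruncatedSum kn R b c a
Cases kn R _ r₁ r₂ a b c v = ⊥

module _ {kn R κ r₁ r₂ a b c v : ℕ} where

  private
    args : Vec ℕ 9
    args = r₁ ∷ r₂ ∷ a ∷ b ∷ c ∷ κ ∷ v ∷ kn ∷ R ∷ []

  comb⇒cases : ⟦ combᶠ ⟧ᶠ args → Cases kn R κ r₁ r₂ a b c v
  comb⇒cases (inj₁ (refl , s)) = proj₁ ref-sum s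
  comb⇒cases (inj₂ (inj₁ (refl , h))) = h
  comb⇒cases (inj₂ (inj₂ (inj₁ (refl , h)))) = h
  comb⇒cases (inj₂ (inj₂ (inj₂ (inj₁ (refl , h))))) = h
  comb⇒cases (inj₂ (inj₂ (inj₂ (inj₂ (inj₁ (refl , p , q , s)))))) = p , q , proj₁ ref-sum s
  comb⇒cases (inj₂ (inj₂ (inj₂ (inj₂ (inj₂ (refl , p , q , o , s)))))) = p , q , o , proj₁ ref-sum s

  cases⇒comb : Cases kn R κ r₁ r₂ a b c v → ⟦ combᶠ ⟧ᶠ args
  cases⇒comb = go κ refl
    where
    go : ∀ κ′ → κ ≡ κ′ → Cases kn R κ′ r₁ r₂ a b c v → ⟦ combᶠ ⟧ᶠ args
    go 0 eq s = inj₁ (eq , proj₂ ref-sum s)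
    go 1 eq h = inj₂ (inj₁ (eq , h))
    go 2 eq h = inj₂ (inj₂ (inj₁ (eq , h)))
    go 3 eq h = inj₂ (inj₂ (inj₂ (inj₁ (eq , h))))
    go 4 eq (p , q , s) = inj₂ (inj₂ (inj₂ (inj₂ (inj₁ (eq , p , q , proj₂ ref-sum s)))))
    go 5 eq (p , q , o , s) = inj₂ (inj₂ (inj₂ (inj₂ (inj₂ (eq , p , q , o , proj₂ ref-sum s)))))
    go (suc (suc (suc (suc (suc (suc _)))))) eq ()

module _ {k n : ℕ} {Rep : ℕ → ℕ∞ k → Set} {m : ℕ} where

  result-invariant : ∀ {γ : Gate U k n} {κ p₁ p₂ v s I} → Matches Rep m γ κ p₁ p₂ v → m ≤ s + s →
    (∀ h h∈ → Invariant s (I h h∈)) → Invariant (s + s) (resultOf γ I)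
  result-invariant {s = s} (input {a} _ below) m≤ inv = invariant-mono m≤ (invariant-singleton a below)
  result-invariant {s = s} complement m≤ inv = invariant-mono (m≤m+n s s) (invariant-∁ (inv _ _))
  result-invariant {s = s} (binary {cup}) m≤ inv c (inj₁ x∈) = inj₁ (inv _ _ (close-mono (m≤m+n s s) c) x∈)
  result-invariant {s = s} (binary {cup}) m≤ inv c (inj₂ x∈) = inj₂ (inv _ _ (close-mono (m≤m+n s s) c) x∈)
  result-invariant {s = s} (binary {cap}) m≤ inv c (x∈ , x∈′) =
    inv _ _ (close-mono (m≤m+n s s) c) x∈ , inv _ _ (close-mono (m≤m+n s s) c) x∈′
  result-invariant {s = s} (binary {plus}) m≤ inv = invariant-plus (inv _ _) (inv _ _)
  result-invariant {s = s} (binary {minus}) m≤ inv = invariant-mono (m≤m+n s s) (invariant-minus (inv _ _))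

  module _ {kn R K θ} (C : Coding kn R K θ Rep) (E : ℕ → ℕ) where

    open Coding C

    Search : (κ p₁ p₂ c v : ℕ) → Set
    Search κ p₁ p₂ c v = ∃₂ λ a b → a < K × b < K × Cases kn R κ (E (p₁ * K + a)) (E (p₂ * K + b)) a b c v

    -- From a search to membership, guessed codes are replaced by arbitrary representatives, and the
    -- invariance of the sets carries membership along `Close`. In the other direction the codes of
    -- actual witnesses are the guess.
    result-search : ∀ {γ : Gate U k n} {κ p₁ p₂ v I} → Matches Rep m γ κ p₁ p₂ v →
      (∀ h h∈ {α x} → α < K → Rep α x → Reflects (E (toℕ h * K + α)) (I h h∈ x)) →
      (∀ h h∈ → Invariant θ (I h h∈)) → Invariant θ (resultOf γ I) →
      ∀ {c x} → c < K → Rep c x → (Search κ p₁ p₂ c v → resultOf γ I x)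
          × (resultOf γ I x → Search κ p₁ p₂ c v)
    result-search {I = I} (input {a} {p₁} {p₂} {v} rv below) ref inv inv′ {c} {x} c<K rc = to , from
      where
      0ᵏ = fin (Vec.replicate k 0)
      a+0 : ∀ a → a ∞+ 0ᵏ ≡ a
      a+0 ∞       = refl
      a+0 (fin a) = cong fin (lookup-ext λ i →
          trans (lookup-zipWith _+_ i a _) (trans (cong (lookup a i +_) (lookup-replicate i 0))
              (+-identityʳ _)))
      -- Comparing `v` and `c` as numbers would be too strict, since a value may have several codes:
      -- only the first `kn` digits count. So the test is that `c` is a code of `a + 0`.
      to : Search 0 p₁ p₂ c v → a ≡ x
      to (_ , _ , _ , _ , ts) = inv′ (close (subst (Rep c) (a+0 a) (sum rv unit ts)) rc) refl
      from : a ≡ x → Search 0 p₁ p₂ c v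
      from refl = c , c , c<K , c<K , sum′ rv unit (subst (Rep c) (sym (a+0 a)) rc)
    result-search complement ref inv inv′ {c} c<K rc =
      (λ { (_ , _ , _ , _ , refl , eq) x∈ → contradiction
          (≤-trans (proj₂ (ref _ _ c<K rc) x∈) (≤-reflexive eq)) λ () }) ,
      (λ x∉ → c , c , c<K , c<K , refl , zero-of (proj₁ (ref _ _ c<K rc)) x∉)
      where
      zero-of : ∀ {e} {P : Set} → (1 ≤ e → P) → ¬ P → e ≡ 0
      zero-of {zero}  f ¬p = refl
      zero-of {suc e} f ¬p = contradiction (f (s≤s z≤n)) ¬p
    result-search (binary {cup}) ref inv inv′ {c} c<K rc =
      (λ { (_ , _ , _ , _ , refl , refl , inj₁ h) → inj₁ (proj₁ (ref _ _ c<K rc) h)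
         ; (_ , _ , _ , _ , refl , refl , inj₂ h) → inj₂ (proj₁ (ref _ _ c<K rc) h) }) ,
      (λ { (inj₁ h) → c , c , c<K , c<K , refl , refl , inj₁ (proj₂ (ref _ _ c<K rc) h)
         ; (inj₂ h) → c , c , c<K , c<K , refl , refl , inj₂ (proj₂ (ref _ _ c<K rc) h) })
    result-search (binary {cap}) ref inv inv′ {c} c<K rc =
      (λ { (_ , _ , _ , _ , refl , refl , h , h′) → proj₁ (ref _ _ c<K rc) h , proj₁ (ref _ _ c<K rc) h′ }) ,
      (λ { (h , h′) → c , c , c<K , c<K , refl , refl , proj₂ (ref _ _ c<K rc) h ,
          proj₂ (ref _ _ c<K rc) h′ })
    result-search {I = I} (binary {plus} {g₁ = g₁} {g₂} {v = v}) ref inv inv′ {c} {x} c<K rc = to , from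
      where
      to : Search 4 (toℕ g₁) (toℕ g₂) c v → (I g₁ (here refl) ⊕ I g₂ (there (here refl))) x
      to (α , β , α<K , β<K , h , h′ , ts) with onto α α<K | onto β β<K
      ... | a , ra | b , rb = inv′ (close (sum ra rb ts) rc)
            (a , b , proj₁ (ref _ _ α<K ra) h , proj₁ (ref _ _ β<K rb) h′ , refl)
      from : (I g₁ (here refl) ⊕ I g₂ (there (here refl))) x → Search 4 (toℕ g₁) (toℕ g₂) c v
      from (a , b , a∈ , b∈ , refl) with total a | total b
      ... | α , α<K , ra | β , β<K , rb = α , β , α<K , β<K , proj₂ (ref _ _ α<K ra) a∈ ,
          proj₂ (ref _ _ β<K rb) b∈ , sum′ ra rb rc
    result-search {I = I} (binary {minus} {g₁ = g₁} {g₂} {v = v}) ref inv inv′ {c} {x} c<K rc = to , from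
      where
      to : Search 5 (toℕ g₁) (toℕ g₂) c v → (I g₁ (here refl) ⊖ I g₂ (there (here refl))) x
      to (α , β , α<K , β<K , h , h′ , o , ts) with onto α α<K | onto β β<K
      ... | a , ra | b , rb with finite rb o
      -- The representative `a` of `α` is exchanged for `b′ + x`, which has the same code and from
      -- which subtracting `b′` really gives `x`.
      ... | b′ , refl = fin b′ ∞+ x , fin b′ , inv _ _ (close ra (sum rb rc ts)) (proj₁ (ref _ _ α<K ra) h) ,
            proj₁ (ref _ _ β<K rb) h′ , plus⇒minus b′ x
      from : (I g₁ (here refl) ⊖ I g₂ (there (here refl))) x → Search 5 (toℕ g₁) (toℕ g₂) c v
      from (a , b , a∈ , b∈ , eq) with minus⇒plus eq | total a | total b
      ... | (b′ , refl) , refl | α , α<K , ra | β , β<K , rb = α , β , α<K , β<K , proj₂ (ref _ _ α<K ra) a∈ ,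
            proj₂ (ref _ _ β<K rb) b∈ , finite′ rb , sum′ rb rc ra

-- Membership in the sets of a circuit

module Membership {k : ℕ} (C : Circuit U k) {Rep : ℕ → ℕ∞ k → Set} {m : ℕ} (w kn kd p₁ p₂ vl : ℕ)
  (coding : Coding kn (radix w) (bound w) (m * 2 ^ Circuit.size C) Rep)
  (matches : ∀ g → Matches Rep m (Circuit.gate C g) (digitAt (bound w) kd (toℕ g))
      (digitAt (bound w) p₁ (toℕ g))
                     (digitAt (bound w) p₂ (toℕ g)) (digitAt (bound w) vl (toℕ g)))
  (rank : Fin (Circuit.size C) → ℕ) (rank< : ∀ g → rank g < Circuit.size C)
  (rank-mono : ∀ g h → Circuit._◁_ C h g → rank g < rank h)
  where

  open Circuit C
  open EvaluateProperties w kn kd p₁ p₂ vl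
  open Evaluate w kn kd p₁ p₂ vl

  fuel : ∀ {d g h} → size ≤ suc d + rank g → h ◁ g → size ≤ d + rank h
  fuel {d} {g} {h} le h◁g = ≤-trans le (≤-trans (≤-reflexive (sym (+-suc d (rank g))))
      (+-monoʳ-≤ d (rank-mono g h h◁g)))

  no-fuel : ∀ {g} {A : Set} → size ≤ rank g → A
  no-fuel {g} le = ⊥-elim (<⇒≱ (rank< g) le)

  threshold-suc : ∀ d → m * 2 ^ suc d ≡ m * 2 ^ d + m * 2 ^ d
  threshold-suc d = trans (*-distribˡ-+ m (2 ^ d) _) (cong (λ z → m * 2 ^ d + m * z) (+-identityʳ (2 ^ d)))

  resultAcc-invariant : ∀ d g a → size ≤ d + rank g → Invariant (m * 2 ^ d) (resultAcc g a)
  resultAcc-invariant zero    g a        le = no-fuel le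
  resultAcc-invariant (suc d) g (acc rs) le =
      subst (λ s → Invariant s (resultAcc g (acc rs))) (sym (threshold-suc d))
    (result-invariant (matches g) (≤-trans m≤ (m≤m+n _ _))
        (λ h h∈ → resultAcc-invariant d h (rs h∈) (fuel {d} {g} le h∈)))
    where
    m≤ : m ≤ m * 2 ^ d
    m≤ = ≤-trans (≤-reflexive (sym (*-identityʳ m))) (*-monoʳ-≤ m (m^n>0 2 d))

  invariant : ∀ g a → Invariant (m * 2 ^ size) (resultAcc g a)
  invariant g a = resultAcc-invariant size g a (m≤m+n size (rank g))

  -- The fuel decreases from a gate to its predecessors, but the threshold is `m * 2 ^ size` at
  -- every level, so that a single coding serves the whole recursion.
  ref-resultAcc : ∀ d g a → size ≤ d + rank g → ∀ {γ x} → γ < bound w → Rep γ x →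
    Reflects (ev d (toℕ g * bound w + γ)) (resultAcc g a x)
  ref-resultAcc zero    g a        le γ<K rγ = no-fuel le
  ref-resultAcc (suc d) g (acc rs) le {γ} {x} γ<K rγ = ref-map (ref-ev d {toℕ g} γ<K)
      (λ { (a , b , a<K , b<K , body) → proj₁ equiv (a , b , a<K , b<K , comb⇒cases body) })
      (λ x∈ → let a , b , a<K , b<K , cs = proj₂ equiv x∈ in a , b , a<K , b<K , cases⇒comb cs)
    where
    equiv = result-search coding (ev d) (matches g)
      (λ h h∈ α<K rα → ref-resultAcc d h (rs h∈) (fuel {d} {g} le h∈) α<K rα)
      (λ h h∈ → invariant h (rs h∈)) (invariant g (acc rs)) γ<K rγ

-- Lengths and sizes of encodings

numeral-injective : ∀ u v → numeral u ≡ numeral v → u ≡ v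
numeral-injective []          []          eq = refl
numeral-injective []          (false ∷ v) ()
numeral-injective []          (true ∷ v)  ()
numeral-injective (false ∷ u) []          ()
numeral-injective (true ∷ u)  []          ()
numeral-injective (false ∷ u) (false ∷ v) eq =
    cong (false ∷_) (numeral-injective u v (*-cancelˡ-≡ _ _ 2 (suc-injective eq)))
numeral-injective (true ∷ u)  (true ∷ v)  eq =
    cong (true ∷_) (numeral-injective u v (*-cancelˡ-≡ _ _ 2 (suc-injective (suc-injective eq))))
numeral-injective (false ∷ u) (true ∷ v)  eq =
    contradiction (suc-injective eq) (even≢odd (numeral u) (numeral v))
numeral-injective (true ∷ u)  (false ∷ v) eq =
    contradiction (sym (suc-injective eq)) (even≢odd (numeral v) (numeral u))

token≥ : ∀ t → 15 ≤ token t
token≥ (digit zero)       = ≤-refl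
token≥ (digit (suc zero)) = m≤m+n 15 _
token≥ sep                = m≤m+n 15 _
token≥ end                = m≤m+n 15 _
token≥ infinity           = m≤m+n 15 _
token≥ (op compl)         = m≤m+n 15 _
token≥ (op (bin cup))     = m≤m+n 15 _
token≥ (op (bin cap))     = m≤m+n 15 _
token≥ (op (bin plus))    = m≤m+n 15 _
token≥ (op (bin minus))   = m≤m+n 15 _

-- Bounds the number of tokens by `lg w`, and with it the number of gates, the dimension of a vector
-- that occurs, and the binary length of its components.
2^length≤put : ∀ ts → 2 ^ length ts ≤ suc (put ts 0)
2^length≤put []       = ≤-refl
2^length≤put (t ∷ ts) = begin
  2 * 2 ^ length ts             ≤⟨ *-mono-≤ (m≤m+n 2 14) (2^length≤put ts) ⟩
  16 * suc (put ts 0)           ≡⟨ *-suc 16 (put ts 0) ⟩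
  suc (15 + 16 * put ts 0)      ≤⟨ s≤s (+-monoˡ-≤ _ (token≥ t)) ⟩
  suc (token t + 16 * put ts 0) ∎
  where open ≤-Reasoning

binary< : ∀ {x ds} → Binary x ds → x < 2 ^ length ds
binary< (lsb r)        = toℕ<n r
binary< (bits-∷ r x {ds} b) = begin-strict
  toℕ r + suc x * 2    <⟨ +-monoˡ-< _ (toℕ<n r) ⟩
  suc (suc x) * 2      ≤⟨ *-monoˡ-≤ 2 (binary< b) ⟩
  2 ^ length ds * 2    ≡⟨ *-comm (2 ^ length ds) 2 ⟩
  2 * 2 ^ length ds    ∎
  where open ≤-Reasoning

number< : ∀ x → x < 2 ^ length (number x)
number< x = ≤-trans (binary< (toDigits-binary x)) (^-monoʳ-≤ 2
  (≤-trans (≤-reflexive (sym (length-map digit ds)))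
      (≤-trans (m≤m+n _ 1) (≤-reflexive (sym (length-++ (lmap digit ds)))))))
  where ds = proj₁ (toDigits 2 x)

number-nonempty : ∀ x → 1 ≤ length (number x)
number-nonempty x = ≤-trans (m≤n+m 1 _) (≤-reflexive (sym (length-++ (lmap digit (proj₁ (toDigits 2 x))))))

length-++ˡ : ∀ {A : Set} (xs ys : List A) → length xs ≤ length (xs ++ ys)
length-++ˡ xs ys = ≤-trans (m≤m+n _ _) (≤-reflexive (sym (length-++ xs)))

length-++ʳ : ∀ {A : Set} (xs ys : List A) → length ys ≤ length (xs ++ ys)
length-++ʳ xs ys = ≤-trans (m≤n+m _ _) (≤-reflexive (sym (length-++ xs)))

length-concatMap : ∀ {A B : Set} (f : A → List B) {x xs} → x ∈ₗ xs → length (f x) ≤ length (concatMap f xs)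
length-concatMap f {xs = y ∷ xs} (here refl) = length-++ˡ (f y) _
length-concatMap f {xs = y ∷ xs} (there x∈)  = ≤-trans (length-concatMap f x∈) (length-++ʳ (f y) _)

length≤concatMap : ∀ {A B : Set} (f : A → List B) → (∀ x → 1 ≤ length (f x)) → ∀ xs →
    length xs ≤ length (concatMap f xs)
length≤concatMap f h []       = z≤n
length≤concatMap f h (x ∷ xs) = ≤-trans (+-mono-≤ (h x) (length≤concatMap f h xs))
    (≤-reflexive (sym (length-++ (f x))))

length-component : ∀ {k} (a : Vec ℕ k) i → length (number (lookup a i)) ≤ length (value (fin a))
length-component (x ∷ a) zero    = length-++ˡ (number x) _
length-component (x ∷ a) (suc i) = ≤-trans (length-component a i) (length-++ʳ (number x) _)

length-vector : ∀ {k} (a : Vec ℕ k) → k ≤ length (value (fin a))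
length-vector []      = z≤n
length-vector (x ∷ a) = ≤-trans (+-mono-≤ (number-nonempty x) (length-vector a))
    (≤-reflexive (sym (length-++ (number x))))

entryTokens : ∀ {k} (C : Circuit U k) → Fin (Circuit.size C) → List Token
entryTokens C g = number (toℕ g) ++ labelAndPredecessors (Circuit.gate C g) ++ end ∷ []

module _ {k : ℕ} (C : Circuit U k) (gs : List (Fin (Circuit.size C))) (b : ℕ∞ k) where

  open Circuit C

  tokens : List Token
  tokens = number (toℕ output) ++ end ∷ [] ++ concatMap (entryTokens C) gs ++ value b ++ end ∷ []

  numeral-encode : numeral (encode C gs b) ≡ put tokens 0
  numeral-encode = numeral-bits tokens

  length-entries : length (concatMap (entryTokens C) gs) ≤ length tokens
  length-entries = ≤-trans (length-++ˡ (concatMap (entryTokens C) gs) _)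
      (≤-trans (n≤1+n _) (length-++ʳ (number (toℕ output)) _))

  length-output : length (value b) ≤ length tokens
  length-output = ≤-trans (length-++ˡ (value b) _) (≤-trans (length-++ʳ (concatMap (entryTokens C) gs) _)
    (≤-trans (n≤1+n _) (length-++ʳ (number (toℕ output)) _)))

  length-gates : length gs ≤ length tokens
  length-gates = ≤-trans (length≤concatMap (entryTokens C)
      (λ g → ≤-trans (number-nonempty (toℕ g)) (length-++ˡ (number (toℕ g)) _)) gs) length-entries

  length-input : ∀ {g a} → g ∈ₗ gs → gate g ≡ input a → length (value a) ≤ length tokens
  length-input {g} {a} g∈ eq = ≤-trans (≤-trans
      (≤-trans (≤-reflexive (cong (length ∘ labelAndPredecessors) (sym eq)))
          (length-++ˡ (labelAndPredecessors (gate g)) _))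
    (≤-trans (length-++ʳ (number (toℕ g)) _) (length-concatMap (entryTokens C) g∈))) length-entries

  module Bounds {w} (w≡ : w ≡ numeral (encode C gs b)) where

    2^tokens : 2 ^ length tokens ≤ suc w
    2^tokens = ≤-trans (2^length≤put tokens) (≤-reflexive (cong suc (sym (trans w≡ numeral-encode))))

    ≤tokens⇒≤lg : ∀ {n} → n ≤ length tokens → n ≤ lg w
    ≤tokens⇒≤lg le = ≤lg (≤-trans (^-monoʳ-≤ 2 le) 2^tokens)

    components : ∀ (a : ℕ∞ k) → length (value a) ≤ length tokens → ComponentsBelow (suc w) a
    components ∞       le = tt
    components (fin a) le i = ≤-trans (number< (lookup a i))
        (≤-trans (^-monoʳ-≤ 2 (≤-trans (length-component a i) le)) 2^tokens)

-- Coded circuits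

-- Exact, unlike `Truncated`, because a certificate has to reproduce the constants of the encoding.
-- As `vec` demands `kn ≡ k`, the choice `kn = 0` leaves only `∞` in a positive dimension.
data CodedValue (kn R : ℕ) {k} : ℕ → ℕ∞ k → Set where
  inf : CodedValue kn R 0 ∞
  vec : ∀ {s a} → kn ≡ k → (∀ i → digitAt R s (toℕ i) ≡ lookup a i) → CodedValue kn R (suc s) (fin a)

data Coded (kn R : ℕ) {k n} : Gate U k n → (κ p₁ p₂ v : ℕ) → Set where
  input      : ∀ {a p₁ p₂ v} → CodedValue kn R v a → Coded kn R (input a) 0 p₁ p₂ v
  complement : ∀ {o h p₂ v} → Coded kn R (complement o h) 1 (toℕ h) p₂ v
  binary     : ∀ {σ o g₁ g₂ le v} → Coded kn R (binary σ o g₁ g₂ le) (opNumber σ) (toℕ g₁) (toℕ g₂) v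

concatTo-vec : ∀ {A B : Set} {k} (f : A → List B) (a : Vec A k) (h : ℕ → List B) →
    (∀ i → h (toℕ i) ≡ f (lookup a i)) →
  concatTo h k ≡ concatMap f (toList a)
concatTo-vec f []      h eq = refl
concatTo-vec {k = suc k} f (x ∷ a) h eq = trans (concatTo-cons h k)
    (cong₂ _++_ (eq zero) (concatTo-vec f a (h ∘ suc) (eq ∘ suc)))

nth : {A : Set} → List (List A) → ℕ → List A
nth []       _       = []
nth (x ∷ xs) zero    = x
nth (x ∷ xs) (suc i) = nth xs i

concatTo-nth : ∀ {A : Set} (xs : List (List A)) → concatTo (nth xs) (length xs) ≡ concat xs
concatTo-nth []       = refl
concatTo-nth (x ∷ xs) = trans (concatTo-cons (nth (x ∷ xs)) (length xs)) (cong (x ++_) (concatTo-nth xs))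

nth-map : ∀ {A B : Set} (f : A → List B) xs (i : Fin (length xs)) →
    nth (lmap f xs) (toℕ i) ≡ f (List.lookup xs i)
nth-map f (x ∷ xs) zero    = refl
nth-map f (x ∷ xs) (suc i) = nth-map f xs i

opaque
  unfolding eatValue

  eatValue-eats : ∀ {kn R v k} {a : ℕ∞ k} → CodedValue kn R v a → Eats (eatValue kn R v) (value a)
  eatValue-eats inf = eat-eats infinity
  eatValue-eats {kn} {R} {a = fin a} (vec {s} refl eq) =
      eats-≗ (iterate-eats kn (λ i _ → eatNumber-eats (digitAt R s i))) (λ _ → refl)
    (concatTo-vec number a (λ i → number (digitAt R s i)) (λ i → cong number (eq i)))

opaque
  unfolding eatGate

  eatGate-eats : ∀ {kn R k n κ p₁ p₂ v} {γ : Gate U k n} → Coded kn R γ κ p₁ p₂ v →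
      Eats (eatGate κ p₁ p₂ v kn R) (labelAndPredecessors γ)
  eatGate-eats (input cv) = eatValue-eats cv
  eatGate-eats (complement {h = h}) = eats-∘ (eat-eats (op compl)) (eatNumber-eats (toℕ h))
  eatGate-eats (binary {cup} {g₁ = g₁} {g₂})   =
      eats-∘ (eats-∘ (eat-eats (op (bin cup))) (eatNumber-eats (toℕ g₁))) (eatNumber-eats (toℕ g₂))
  eatGate-eats (binary {cap} {g₁ = g₁} {g₂})   =
      eats-∘ (eats-∘ (eat-eats (op (bin cap))) (eatNumber-eats (toℕ g₁))) (eatNumber-eats (toℕ g₂))
  eatGate-eats (binary {plus} {g₁ = g₁} {g₂})  =
      eats-∘ (eats-∘ (eat-eats (op (bin plus))) (eatNumber-eats (toℕ g₁))) (eatNumber-eats (toℕ g₂))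
  eatGate-eats (binary {minus} {g₁ = g₁} {g₂}) =
      eats-∘ (eats-∘ (eat-eats (op (bin minus))) (eatNumber-eats (toℕ g₁))) (eatNumber-eats (toℕ g₂))

record Description {k} (C : Circuit U k) (gs : List (Fin (Circuit.size C))) (b : ℕ∞ k)
                   (w kn ord kd p₁ p₂ vl bc : ℕ) : Set where
  open Circuit C
  field
    gates  : ∀ g → Coded kn (radix w) (gate g) (digitAt (bound w) kd (toℕ g)) (digitAt (bound w) p₁ (toℕ g))
                     (digitAt (bound w) p₂ (toℕ g)) (digitAt (bound w) vl (toℕ g))
    yields : CodedValue kn (radix w) bc b
    listed : length gs ≡ size
    order  : ∀ j → digitAt (bound w) ord (toℕ j) ≡ toℕ (List.lookup gs j)

module _ {k : ℕ} {C : Circuit U k} {gs : List (Fin (Circuit.size C))} {b : ℕ∞ k} {w kn ord kd p₁ p₂ vl bc : ℕ}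
         (D : Description C gs b w kn ord kd p₁ p₂ vl bc) where

  open Circuit C
  open Description D

  blocks : List (List Token)
  blocks = lmap (entryTokens C) gs

  opaque
    unfolding eatEntry

    eatEntry-eats : ∀ j → Eats (eatEntry ord kd p₁ p₂ vl kn w (toℕ j)) (entryTokens C (List.lookup gs j))
    eatEntry-eats j rewrite order j = eats-≗ (eats-∘
        (eats-∘ (eatNumber-eats (toℕ g)) (eatGate-eats (gates g))) (eat-eats end))
        (λ _ → refl) (++-assoc (number (toℕ g)) _ _)
      where
      g : Fin size
      g = List.lookup gs j

  opaque
    unfolding eatCircuit

    eatCircuit-eats : ∃ λ F → (eatCircuit w kn size (toℕ output) ord kd p₁ p₂ vl bc ≡ F (suc w))
        × Eats F (tokens C gs b)
    eatCircuit-eats = _ , refl , eats-≗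
      (eats-∘ (eats-∘ (eats-∘ (eats-∘ (eatNumber-eats (toℕ output)) (eat-eats end))
        (iterate-eats {ts = nth blocks} size entry-eats)) (eatValue-eats yields)) (eat-eats end))
      (λ _ → refl) reassociate
      where
      entry-eats : ∀ i → i < size → Eats (eatEntry ord kd p₁ p₂ vl kn w i) (nth blocks i)
      entry-eats i lt = subst (λ i → Eats (eatEntry ord kd p₁ p₂ vl kn w i) (nth blocks i)) (toℕ-fromℕ< lt′)
          (subst (Eats _) (sym (nth-map (entryTokens C) gs (fromℕ< lt′))) (eatEntry-eats (fromℕ< lt′)))
        where
        lt′ : i < length gs
        lt′ = subst (i <_) (sym listed) lt
      entries : concatTo (nth blocks) size ≡ concatMap (entryTokens C) gs
      entries = trans (cong (concatTo (nth blocks))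
          (trans (sym listed) (sym (length-map (entryTokens C) gs))))
        (concatTo-nth blocks)
      reassociate : (((number (toℕ output) ++ end ∷ []) ++ concatTo (nth blocks) size) ++ value b) ++ end ∷ []
          ≡ tokens C gs b
      reassociate = begin
        (((number (toℕ output) ++ end ∷ []) ++ concatTo (nth blocks) size) ++ value b) ++ end ∷ []
          ≡⟨ ++-assoc ((number (toℕ output) ++ end ∷ []) ++ concatTo (nth blocks) size) (value b) _ ⟩
        ((number (toℕ output) ++ end ∷ []) ++ concatTo (nth blocks) size) ++ value b ++ end ∷ []
          ≡⟨ ++-assoc (number (toℕ output) ++ end ∷ []) _ _ ⟩
        (number (toℕ output) ++ end ∷ []) ++ concatTo (nth blocks) size ++ value b ++ end ∷ []
          ≡⟨ ++-assoc (number (toℕ output)) _ _ ⟩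
        number (toℕ output) ++ end ∷ concatTo (nth blocks) size ++ value b ++ end ∷ []
          ≡⟨ cong (λ ts → number (toℕ output) ++ end ∷ ts ++ value b ++ end ∷ []) entries ⟩
        tokens C gs b ∎
        where open ≡-Reasoning

  eatCircuit-encode : eatCircuit w kn size (toℕ output) ord kd p₁ p₂ vl bc ≡ 1 → w ≡ numeral (encode C gs b)
  eatCircuit-encode eq with eatCircuit-eats
  ... | F , F≡ , eating _ only = trans (suc-injective (only (suc w) 0 (trans (sym F≡) eq)))
      (sym (numeral-encode C gs b))

  encode-eatCircuit : w ≡ numeral (encode C gs b) → eatCircuit w kn size (toℕ output) ord kd p₁ p₂ vl bc ≡ 1
  encode-eatCircuit eq with eatCircuit-eats
  ... | F , F≡ , eating succeeds _ = trans F≡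
      (trans (cong (F ∘ suc) (trans eq (numeral-encode C gs b))) (succeeds 0))

-- Truncated values

-- With `kn = k` all components are kept up to `R ∸ 1`. With `kn = 0` a code merely tells `∞` from
-- the vectors, which is all that sets with threshold 0 can distinguish.
data Truncated {k} (kn R : ℕ) : ℕ → ℕ∞ k → Set where
  inf : Truncated kn R 0 ∞
  vec : ∀ {s a} → (∀ i → toℕ i < kn → digitAt R s (toℕ i) ≡ lookup a i ⊓ (R ∸ 1)) →
      Truncated kn R (suc s) (fin a)

⊓-⊓-+ : ∀ x y M → (x ⊓ M + y ⊓ M) ⊓ M ≡ (x + y) ⊓ M
⊓-⊓-+ x y M with ≤-total x M | ≤-total y M
... | inj₁ p | inj₁ q rewrite m≤n⇒m⊓n≡m p | m≤n⇒m⊓n≡m q = refl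
... | inj₂ p | _      rewrite m≥n⇒m⊓n≡n p = ⊓-large (m≤m+n M _) (≤-trans p (m≤m+n x y))
... | inj₁ _ | inj₂ q rewrite m≥n⇒m⊓n≡n q = ⊓-large (m≤n+m M _) (≤-trans q (m≤n+m y x))

module TruncatedCoding {k kn R K θ : ℕ} (1≤R : 1 ≤ R) (kn≤k : kn ≤ k) (2≤K : 2 ≤ K)
  (case : (kn ≡ k × θ ≤ R ∸ 1 × R ^ k < K) ⊎ (kn ≡ 0 × θ ≡ 0)) where

  private
    M = R ∸ 1
    <R : ∀ {x} → x ⊓ M < R
    <R {x} = ≤-trans (s≤s (m⊓n≤n x M)) (≤-reflexive (m+[n∸m]≡n 1≤R))
    TS : ℕ → ℕ → ℕ → Set
    TS α β γ = (α ≡ 0 ⊎ β ≡ 0) × γ ≡ 0 ⊎ (1 ≤ α × 1 ≤ β × 1 ≤ γ ×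
      (∀ i → i < kn → digitAt R (γ ∸ 1) i ≡ (digitAt R (α ∸ 1) i + digitAt R (β ∸ 1) i) ⊓ (R ∸ 1)))

  totalᵗ : ∀ (x : ℕ∞ k) → ∃ λ α → α < K × Truncated kn R α x
  totalᵗ ∞       = 0 , ≤-trans (s≤s z≤n) 2≤K , inf
  totalᵗ (fin a) = go case
    where
    f : Fin k → ℕ
    f i = lookup a i ⊓ M
    go : (kn ≡ k × θ ≤ R ∸ 1 × R ^ k < K) ⊎ (kn ≡ 0 × θ ≡ 0) → ∃ λ α → α < K × Truncated kn R α (fin a)
    go (inj₁ (_ , _ , lt)) = suc (code R f) , ≤-trans (s≤s (code< R f (λ i → <R {lookup a i}))) lt ,
                             vec (λ i _ → digit-code R f (λ i → <R {lookup a i}) i)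
    go (inj₂ (kn≡0 , _))   = 1 , 2≤K , vec (λ i lt → contradiction (subst (toℕ i <_) kn≡0 lt) λ ())

  ontoᵗ : ∀ α → α < K → ∃ λ (x : ℕ∞ k) → Truncated kn R α x
  ontoᵗ zero    lt = ∞ , inf
  ontoᵗ (suc s) lt = fin (tabulate (λ i → digitAt R s (toℕ i))) , vec λ i _ →
    sym (trans (cong (_⊓ M) (lookup∘tabulate (λ i → digitAt R s (toℕ i)) i))
      (m≤n⇒m⊓n≡m (≤-pred (≤-trans (digitAt< s (toℕ i) 1≤R) (≤-reflexive (sym (m+[n∸m]≡n 1≤R)))))))

  closeᵗ : ∀ {α} {x y : ℕ∞ k} → Truncated kn R α x → Truncated kn R α y → Close θ x y
  closeᵗ inf     inf     = ∞
  closeᵗ (vec {a = a} h) (vec {a = b} h′) = go case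
    where
    go : (kn ≡ k × θ ≤ R ∸ 1 × R ^ k < K) ⊎ (kn ≡ 0 × θ ≡ 0) → Close θ (fin a) (fin b)
    go (inj₁ (kn≡k , le , _)) = fin λ i → ⊓-mono-≡ le (trans (sym (h i (lt i))) (h′ i (lt i)))
      where
      lt : ∀ i → toℕ i < kn
      lt i = subst (toℕ i <_) (sym kn≡k) (toℕ<n i)
    go (inj₂ (_ , refl))      = fin λ i → trans (⊓-zeroʳ _) (sym (⊓-zeroʳ _))

  sumᵗ : ∀ {α β γ} {a b : ℕ∞ k} → Truncated kn R α a → Truncated kn R β b → TS α β γ →
      Truncated kn R γ (a ∞+ b)
  sumᵗ inf     _       (inj₁ (_ , refl)) = inf
  sumᵗ (vec _) inf     (inj₁ (_ , refl)) = inf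
  sumᵗ (vec _) (vec _) (inj₁ (inj₁ () , _))
  sumᵗ (vec _) (vec _) (inj₁ (inj₂ () , _))
  sumᵗ inf     _       (inj₂ (() , _))
  sumᵗ (vec _) inf     (inj₂ (_ , () , _))
  sumᵗ {γ = zero} (vec {a = a} h) (vec {a = b} h′) (inj₂ (_ , _ , () , _))
  sumᵗ {γ = suc s} (vec {a = a} h) (vec {a = b} h′) (inj₂ (_ , _ , _ , eq)) = vec λ i lt → begin
    digitAt R s (toℕ i)                           ≡⟨ eq (toℕ i) lt ⟩
    (digitAt R _ (toℕ i) + digitAt R _ (toℕ i)) ⊓ M ≡⟨ cong₂ (λ x y → (x + y) ⊓ M) (h i lt) (h′ i lt) ⟩
    (lookup a i ⊓ M + lookup b i ⊓ M) ⊓ M         ≡⟨ ⊓-⊓-+ (lookup a i) (lookup b i) M ⟩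
    (lookup a i + lookup b i) ⊓ M                 ≡⟨ cong (_⊓ M) (lookup-zipWith _+_ i a b) ⟨
    lookup (Vec.zipWith _+_ a b) i ⊓ M            ∎
    where open ≡-Reasoning

  sumᵗ′ : ∀ {α β γ} {a b : ℕ∞ k} → Truncated kn R α a → Truncated kn R β b → Truncated kn R γ (a ∞+ b) →
      TS α β γ
  sumᵗ′ inf     _       inf = inj₁ (inj₁ refl , refl)
  sumᵗ′ (vec _) inf     inf = inj₁ (inj₂ refl , refl)
  sumᵗ′ (vec {s} {a} h) (vec {s′} {b} h′) (vec {s″} h″) = inj₂ (s≤s z≤n , s≤s z≤n , s≤s z≤n , λ i lt →
      subst (λ i → digitAt R s″ i ≡ (digitAt R s i + digitAt R s′ i) ⊓ M) (toℕ-fromℕ< (≤-trans lt kn≤k))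
        (at-index (fromℕ< (≤-trans lt kn≤k)) (subst (_< kn) (sym (toℕ-fromℕ< (≤-trans lt kn≤k))) lt)))
    where
    open ≡-Reasoning
    at-index : ∀ i → toℕ i < kn → digitAt R s″ (toℕ i) ≡ (digitAt R s (toℕ i) + digitAt R s′ (toℕ i)) ⊓ M
    at-index i lt = begin
      digitAt R s″ (toℕ i)                              ≡⟨ h″ i lt ⟩
      lookup (Vec.zipWith _+_ a b) i ⊓ M                ≡⟨ cong (_⊓ M) (lookup-zipWith _+_ i a b) ⟩
      (lookup a i + lookup b i) ⊓ M                     ≡⟨ ⊓-⊓-+ (lookup a i) (lookup b i) M ⟨
      (lookup a i ⊓ M + lookup b i ⊓ M) ⊓ M             ≡⟨ cong₂ (λ x y → (x + y) ⊓ M) (h i lt) (h′ i lt) ⟨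
      (digitAt R s (toℕ i) + digitAt R s′ (toℕ i)) ⊓ M  ∎

  truncatedCoding : Coding kn R K θ (Truncated {k} kn R)
  truncatedCoding = record
    { total   = totalᵗ
    ; onto    = ontoᵗ
    ; close   = closeᵗ
    ; finite  = λ { inf () ; (vec _) _ → _ , refl }
    ; finite′ = λ { (vec _) → s≤s z≤n }
    ; unit    = vec λ i _ → trans (n≤0⇒n≡0 (digitAt≤ R 0 (toℕ i))) (sym (cong (_⊓ M) (lookup-replicate i 0)))
    ; sum     = λ ra rb ts → sumᵗ ra rb (subst id truncatedSum-def ts)
    ; sum′    = λ ra rb rc → subst id (sym truncatedSum-def) (sumᵗ′ ra rb rc)
    }

1≤radix : ∀ w → 1 ≤ radix w
1≤radix w = ≤-trans (s≤s z≤n) (w<radix w)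

-- A vector has a code `suc s` with `s < radix w ^ k` and `k ≤ lg w`; the strict inequality makes
-- room for the successor.
smash<bound : ∀ w → smash (radix w) w < bound w
smash<bound w = ≤-trans (m<m+n (smash (radix w) w) (≤-trans (s≤s z≤n) (m≤n+m 8 (radix w))))
    (≤-reflexive (sym (bound-def w)))

rem-small : ∀ {x B} → x < B → rem x B ≡ x
rem-small {x} {B} lt = trans (cong (λ y → rem y B) (sym (trans (cong (x +_) (*-zeroʳ B)) (+-identityʳ x))))
    (rem-digit 0 lt)

module _ {k : ℕ} {C : Circuit U k} {gs : List (Fin (Circuit.size C))} {b : ℕ∞ k}
    {w kn ord kd p₁ p₂ vl bc : ℕ} where

  open Circuit C
  open Evaluate w kn kd p₁ p₂ vl

  -- If kn = 0, then no vector occurs in the encoding, and k need not be bounded.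
  ref-evaluate : Description C gs b w kn ord kd p₁ p₂ vl bc → w ≡ numeral (encode C gs b) → (∀ g → g ∈ₗ gs) →
    1 ≤ k → (kn ≡ k × k ≤ lg w) ⊎ kn ≡ 0 → bc < bound w →
    (rank : Fin size → ℕ) → (∀ g → rank g < size) → (∀ g h → h ◁ g → rank g < rank h) →
    Reflects (evaluate size (toℕ output * bound w + bc)) (I output b)
  ref-evaluate D w≡ complete 1≤k compat bc< rank rank< rank-mono =
      subst (λ e → Reflects e (I output b)) (sym evaluate≡) (membership compat)
    where
    open Description D
    open Bounds C gs b w≡
    K = bound w
    R = radix w
    size≤ : size ≤ lg w
    size≤ = ≤tokens⇒≤lg (≤-trans (≤-reflexive (sym listed)) (length-gates C gs b))
    out<K : toℕ output < K
    out<K = <-trans (≤-trans (toℕ<n output) (≤-trans size≤ (lg≤ w))) (w<bound w)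
    evaluate≡ : evaluate size (toℕ output * K + bc) ≡ ev size (toℕ output * K + bc)
    evaluate≡ = cong₂ ev (m≤n⇒m⊓n≡m size≤)
      (rem-small (<-trans (pair< out<K bc<) (≤-reflexive (trans (+-comm 1 (K * K)) (sym (base-def w))))))
    truncated : ∀ {v} {a : ℕ∞ k} → CodedValue kn R v a → Truncated kn R v a
    truncated inf = inf
    truncated (vec {s} {a} _ h) = vec λ i _ → trans (h i) (sym (m≤n⇒m⊓n≡m
      (≤-pred (≤-trans (subst (_< R) (h i) (digitAt< s (toℕ i) (1≤radix w)))
          (≤-reflexive (sym (m+[n∸m]≡n (1≤radix w))))))))
    matched : ∀ {m n κ q₁ q₂ v} {γ : Gate U k n} → Coded kn R γ κ q₁ q₂ v →
        (∀ a → γ ≡ input a → CodedValue kn R v a → ComponentsBelow m a) →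
              Matches (Truncated kn R) m γ κ q₁ q₂ v
    matched (input cv)  h = input (truncated cv) (h _ refl cv)
    matched complement  h = complement
    matched binary      h = binary
    membership : (kn ≡ k × k ≤ lg w) ⊎ kn ≡ 0 → Reflects (ev size (toℕ output * K + bc)) (I output b)
    membership (inj₁ (kn≡k , k≤)) = Membership.ref-resultAcc C {m = suc w} w kn kd p₁ p₂ vl
        (TruncatedCoding.truncatedCoding (1≤radix w) (≤-reflexive kn≡k)
            (≤-trans (s≤s (s≤s z≤n)) (≤-trans (m≤n+m 8 R) (radix≤bound w)))
          (inj₁ (kn≡k , θ≤ , ≤-trans (s≤s (^-monoʳ-≤ R {{>-nonZero (1≤radix w)}} k≤)) (smash<bound w))))
        (λ g → matched (gates g) (λ a eq _ → components a (length-input C gs b (complete g) eq)))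
        rank rank< rank-mono size output (◁-wellFounded output) (m≤m+n size _) bc< (truncated yields)
      where
      -- The origin of `radix w`: constants have components below `suc w`, and doubling this at most
      -- `lg w` times gives at most `suc w * suc w`, since `2 ^ lg w ≤ suc w`.
      θ≤ : suc w * 2 ^ size ≤ R ∸ 1
      θ≤ = ≤-trans (*-monoʳ-≤ (suc w) (≤-trans (^-monoʳ-≤ 2 size≤) (2^lg≤ w)))
          (≤-reflexive (sym (cong (_∸ 1) (radix-def w))))
    -- Without vectors among the constants the initial threshold is 0, and doubling keeps it there.
    membership (inj₂ kn≡0) = Membership.ref-resultAcc C {m = 0} w kn kd p₁ p₂ vl
        (TruncatedCoding.truncatedCoding (1≤radix w) (≤-trans (≤-reflexive kn≡0) z≤n)
            (≤-trans (s≤s (s≤s z≤n)) (≤-trans (m≤n+m 8 R) (radix≤bound w)))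
          (inj₂ (kn≡0 , refl)))
        (λ g → matched (gates g) no-vector)
        rank rank< rank-mono size output (◁-wellFounded output) (m≤m+n size _) bc< (truncated yields)
      where
      no-vector : ∀ {v n} {γ : Gate U k n} a → γ ≡ input a → CodedValue kn R v a → ComponentsBelow 0 a
      no-vector ∞       eq cv          = tt
      no-vector (fin a) eq (vec kn≡k _) = contradiction (≤-trans 1≤k (≤-reflexive (trans (sym kn≡k) kn≡0)))
          λ ()

-- Certificates

-- `ord` lists the gates and `rk` is its inverse, giving the position of a gate. That `rk` increases
-- from a gate to its predecessors certifies acyclicity as well as the order of the list. The
-- dimension `k = 0` stands for an encoding in which only `∞` occurs.
Valid : (w k n out ord rk kd p₁ p₂ vl b : ℕ) → Set
Valid w k n out ord rk kd p₁ p₂ vl b =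
  n ≤ lg w × k ≤ lg w ×
  (1 ≤ k ⊎ (b ≡ 0 × (∀ g → g < n → D kd g ≡ 0 → D vl g ≡ 0))) ×
  out < n × b < bound w ×
  (∀ j → j < n → D ord j < n × D rk (D ord j) ≡ j) ×
  (∀ g → g < n → D rk g < n × D ord (D rk g) ≡ g ×
    (D kd g ≡ 0 ⊎ (D p₁ g < n × D rk g < D rk (D p₁ g) ×
      (D kd g ≡ 1 ⊎ (2 ≤ D kd g × D kd g ≤ 5 × D p₂ g < n × D rk g < D rk (D p₂ g) × D p₁ g ≤ D p₂ g)))))
  where
  D : ℕ → ℕ → ℕ
  D = digitAt (bound w)

Certified : (w k n out ord rk kd p₁ p₂ vl b : ℕ) → Set
Certified w k n out ord rk kd p₁ p₂ vl b = Valid w k n out ord rk kd p₁ p₂ vl b ×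
  eatCircuit w k n out ord kd p₁ p₂ vl b ≡ 1 × 1 ≤ Evaluate.evaluate w k kd p₁ p₂ vl n (out * bound w + b)

opOf : ∀ κ → 2 ≤ κ → κ ≤ 5 → ∃ λ σ → opNumber σ ≡ κ
opOf 2 _ _ = cup , refl
opOf 3 _ _ = cap , refl
opOf 4 _ _ = plus , refl
opOf 5 _ _ = minus , refl
opOf 0 () _
opOf 1 (s≤s ()) _
opOf (suc (suc (suc (suc (suc (suc _)))))) _ (s≤s (s≤s (s≤s (s≤s (s≤s ())))))

lookup-tabulate : ∀ {A : Set} {n} (f : Fin n → A) (j : Fin (length (List.tabulate f))) → ∃ λ i →
    toℕ j ≡ toℕ i × List.lookup (List.tabulate f) j ≡ f i
lookup-tabulate {n = suc n} f zero    = zero , refl , refl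
lookup-tabulate {n = suc n} f (suc j) with lookup-tabulate (f ∘ suc) j
... | i , eq , eq′ = suc i , cong suc eq , eq′

-- From certificates to circuits

module Soundness {w k n out ord rk kd p₁ p₂ vl b : ℕ} (cert : Certified w k n out ord rk kd p₁ p₂ vl b)
                 (kc : ℕ) (1≤kc : 1 ≤ kc) (compat : k ≡ kc ⊎ k ≡ 0) where

  private
    D : ℕ → ℕ → ℕ
    D = digitAt (bound w)
    valid = proj₁ cert
    k≤ = proj₁ (proj₂ valid)
    vectors = proj₁ (proj₂ (proj₂ valid))
    out<n = proj₁ (proj₂ (proj₂ (proj₂ valid)))
    b<K = proj₁ (proj₂ (proj₂ (proj₂ (proj₂ valid))))
    orders = proj₁ (proj₂ (proj₂ (proj₂ (proj₂ (proj₂ valid)))))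
    gates-ok = proj₂ (proj₂ (proj₂ (proj₂ (proj₂ (proj₂ valid)))))

  decode : ℕ → ℕ∞ kc
  decode zero    = ∞
  decode (suc s) = fin (tabulate (λ i → digitAt (radix w) s (toℕ i)))

  coded-value : ∀ v → k ≡ kc ⊎ v ≡ 0 → CodedValue k (radix w) v (decode v)
  coded-value zero    _           = inf
  coded-value (suc s) (inj₁ k≡kc) = vec k≡kc (λ i →
      sym (lookup∘tabulate (λ i → digitAt (radix w) s (toℕ i)) i))
  coded-value (suc s) (inj₂ ())

  no-vectors : k ≡ 0 → b ≡ 0 × (∀ g → g < n → D kd g ≡ 0 → D vl g ≡ 0)
  no-vectors k≡0 with vectors
  ... | inj₁ 1≤k = contradiction (subst (1 ≤_) k≡0 1≤k) λ ()
  ... | inj₂ h = h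

  input-ok : ∀ g → g < n → D kd g ≡ 0 → k ≡ kc ⊎ D vl g ≡ 0
  input-ok g lt eq = go compat
    where
    go : k ≡ kc ⊎ k ≡ 0 → k ≡ kc ⊎ D vl g ≡ 0
    go (inj₁ k≡kc) = inj₁ k≡kc
    go (inj₂ k≡0)  = inj₂ (proj₂ (no-vectors k≡0) g lt eq)

  rank : Fin n → ℕ
  rank g = D rk (toℕ g)

  GateAt : Fin n → Set
  GateAt g = ∃ λ (γ : Gate U kc n) → Coded k (radix w) γ (D kd (toℕ g)) (D p₁ (toℕ g)) (D p₂ (toℕ g))
      (D vl (toℕ g)) ×
    (∀ h → h ∈ₗ predecessors γ → rank g < rank h)

  ranked : ∀ {g p} (lt : p < n) → rank g < D rk p → rank g < rank (fromℕ< lt)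
  ranked {g} lt h = subst (λ p → rank g < D rk p) (sym (toℕ-fromℕ< lt)) h

  gateAt : ∀ g → GateAt g
  gateAt g with proj₂ (proj₂ (gates-ok (toℕ g) (toℕ<n g)))
  ... | inj₁ κ≡0 = input (decode (D vl (toℕ g))) ,
        subst (λ κ → Coded k (radix w) (input (decode (D vl (toℕ g)))) κ (D p₁ (toℕ g)) (D p₂ (toℕ g))
            (D vl (toℕ g))) (sym κ≡0)
          (input (coded-value (D vl (toℕ g)) (input-ok (toℕ g) (toℕ<n g) κ≡0))) ,
        (λ h ())
  ... | inj₂ (p₁<n , r₁ , inj₁ κ≡1) = complement tt (fromℕ< p₁<n) ,
        subst₂ (λ κ q → Coded k (radix w) (complement tt (fromℕ< p₁<n)) κ q (D p₂ (toℕ g)) (D vl (toℕ g)))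
            (sym κ≡1) (toℕ-fromℕ< p₁<n) complement ,
        (λ { h (here refl) → ranked {g} p₁<n r₁ })
  ... | inj₂ (p₁<n , r₁ , inj₂ (2≤κ , κ≤5 , p₂<n , r₂ , p₁≤p₂)) with opOf (D kd (toℕ g)) 2≤κ κ≤5
  ... | σ , σ≡ = γ , subst (λ κ → Coded k (radix w) γ κ (D p₁ (toℕ g)) (D p₂ (toℕ g)) (D vl (toℕ g))) σ≡
          (subst₂ (λ q q′ → Coded k (radix w) γ (opNumber σ) q q′ (D vl (toℕ g))) (toℕ-fromℕ< p₁<n)
              (toℕ-fromℕ< p₂<n) binary) ,
        (λ { h (here refl) → ranked {g} p₁<n r₁ ; h (there (here refl)) → ranked {g} p₂<n r₂ })
    where
    γ : Gate U kc n
    γ = binary σ tt (fromℕ< p₁<n) (fromℕ< p₂<n)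
        (subst₂ _≤_ (sym (toℕ-fromℕ< p₁<n)) (sym (toℕ-fromℕ< p₂<n)) p₁≤p₂)

  rank-mono : ∀ g h → h ∈ₗ predecessors (proj₁ (gateAt g)) → rank g < rank h
  rank-mono g = proj₂ (proj₂ (gateAt g))

  rank-trans : ∀ {g h} → TransClosure (λ h g → h ∈ₗ predecessors (proj₁ (gateAt g))) h g → rank g < rank h
  rank-trans [ h◁g ]    = rank-mono _ _ h◁g
  rank-trans (h◁g ∷ gs) = <-trans (rank-trans gs) (rank-mono _ _ h◁g)

  circuit : Circuit U kc
  circuit = record
    { size    = n
    ; gate    = proj₁ ∘ gateAt
    ; output  = fromℕ< out<n
    ; acyclic = λ g cycle → <-irrefl refl (rank-trans cycle)
    }

  order : Fin n → Fin n
  order j = fromℕ< (proj₁ (orders (toℕ j) (toℕ<n j)))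

  toℕ-order : ∀ j → toℕ (order j) ≡ D ord (toℕ j)
  toℕ-order j = toℕ-fromℕ< _

  rank-order : ∀ j → rank (order j) ≡ toℕ j
  rank-order j = trans (cong (D rk) (toℕ-order j)) (proj₂ (orders (toℕ j) (toℕ<n j)))

  gs : List (Fin n)
  gs = List.tabulate order

  complete : ∀ g → g ∈ₗ gs
  complete g = subst (_∈ₗ gs) (toℕ-injective (trans (toℕ-order j)
      (trans (cong (D ord) (toℕ-fromℕ< rk<n)) (proj₁ (proj₂ ok))))) (∈-tabulate⁺ j)
    where
    ok = gates-ok (toℕ g) (toℕ<n g)
    rk<n = proj₁ ok
    j : Fin n
    j = fromℕ< rk<n

  -- A list without repetitions that contains every gate is a permutation of all gates. The first
  -- property holds as `rk` is a left inverse of `ord`, the second as it is a right inverse.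
  topological : Circuit.ReverseTopological circuit gs
  topological =
    ∼bag⇒↭ (unique∧set⇒bag (Unique.tabulate⁺ injective) (Unique.allFin⁺ n)
        (mk⇔ (λ _ → ∈-allFin _) (λ _ → complete _))) ,
    AllPairs.tabulate⁺-< λ {i} {j} i<j h → <-asym
        i<j (subst₂ _<_ (rank-order j) (rank-order i) (rank-mono _ _ h))
    where
    injective : ∀ {i j} → order i ≡ order j → i ≡ j
    injective {i} {j} eq = toℕ-injective (trans (sym (rank-order i)) (trans (cong rank eq) (rank-order j)))

  description : Description circuit gs (decode b) w k ord kd p₁ p₂ vl b
  description = record
    { gates  = λ g → proj₁ (proj₂ (gateAt g))
    ; yields = coded-value b (b-ok compat)
    ; listed = length-tabulate order
    ; order  = λ j → let i , j≡i , eq = lookup-tabulate order j in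
                 trans (cong (D ord) j≡i) (trans (sym (toℕ-order i)) (cong toℕ (sym eq)))
    }
    where
    b-ok : k ≡ kc ⊎ k ≡ 0 → k ≡ kc ⊎ b ≡ 0
    b-ok (inj₁ k≡kc) = inj₁ k≡kc
    b-ok (inj₂ k≡0)  = inj₂ (proj₁ (no-vectors k≡0))

  sound : ∀ v → numeral v ≡ w → MC* U v
  sound v v≡w = kc , 1≤kc , circuit , decode b , gs , topological , numeral-injective v _ (trans v≡w w≡) ,
    proj₁ (ref-evaluate description w≡ complete 1≤kc (compat′ compat) b<K
        rank (λ g → proj₁ (gates-ok (toℕ g) (toℕ<n g))) rank-mono)
      (subst (λ o → 1 ≤ Evaluate.evaluate w k kd p₁ p₂ vl n (o * bound w + b)) (sym (toℕ-fromℕ< out<n))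
          (proj₂ (proj₂ cert)))
    where
    w≡ : w ≡ numeral (encode circuit gs (decode b))
    w≡ = eatCircuit-encode description (subst (λ o → eatCircuit w k n o ord kd p₁ p₂ vl b ≡ 1)
        (sym (toℕ-fromℕ< out<n)) (proj₁ (proj₂ cert)))
    compat′ : k ≡ kc ⊎ k ≡ 0 → (k ≡ kc × kc ≤ lg w) ⊎ k ≡ 0
    compat′ (inj₁ k≡kc) = inj₁ (k≡kc , subst (_≤ lg w) k≡kc k≤)
    compat′ (inj₂ k≡0)  = inj₂ k≡0

-- An encoding certified with `k = 0` contains no vector and so fits every dimension; 1 is chosen.
certified⇒MC* : ∀ {w k n out ord rk kd p₁ p₂ vl b} → Certified w k n out ord rk kd p₁ p₂ vl b → ∀ v →
    numeral v ≡ w → MC* U v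
certified⇒MC* {k = zero}  cert = Soundness.sound cert 1 (s≤s z≤n) (inj₂ refl)
certified⇒MC* {k = suc k} cert = Soundness.sound cert (suc k) (s≤s z≤n) (inj₁ refl)

allPairs-lookup : ∀ {A : Set} {R : A → A → Set} {xs} → AllPairs R xs → ∀ i j → toℕ i < toℕ j →
    R (List.lookup xs i) (List.lookup xs j)
allPairs-lookup (r ∷ rs) zero    (suc j) lt = All.lookup r (∈-lookup j)
allPairs-lookup (r ∷ rs) (suc i) (suc j) lt = allPairs-lookup rs i j (≤-pred lt)
allPairs-lookup (r ∷ rs) zero    zero    ()
allPairs-lookup (r ∷ rs) (suc i) zero    ()

-- From circuits to certificates

module Completeness {k : ℕ} (1≤k : 1 ≤ k) (C : Circuit U k) (gs : List (Fin (Circuit.size C))) (b : ℕ∞ k)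
                    (topological : Circuit.ReverseTopological C gs)
                        {w : ℕ} (w≡ : w ≡ numeral (encode C gs b)) where

  open Circuit C
  open Bounds C gs b w≡

  K R : ℕ
  K = bound w
  R = radix w

  complete : ∀ g → g ∈ₗ gs
  complete g = ∈-resp-↭ (↭-sym (proj₁ topological)) (∈-allFin g)

  length≡ : length gs ≡ size
  length≡ = trans (↭-length (proj₁ topological)) (length-tabulate id)

  unique : Unique gs
  unique = Permutationₛ.Unique-resp-↭ (setoid _) (↭⇒↭ₛ (↭-sym (proj₁ topological))) (Unique.allFin⁺ size)

  index : Fin size → Fin (length gs)
  index g = Any.index (complete g)

  lookup-index′ : ∀ g → List.lookup gs (index g) ≡ g
  lookup-index′ g = sym (lookup-index (complete g))

  index-lookup : ∀ j → index (List.lookup gs j) ≡ j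
  index-lookup j with <-cmp (toℕ (index (List.lookup gs j))) (toℕ j)
  ... | tri< lt _ _ = contradiction (lookup-index′ (List.lookup gs j))
      (allPairs-lookup unique (index (List.lookup gs j)) j lt)
  ... | tri≈ _ eq _ = toℕ-injective eq
  ... | tri> _ _ gt = contradiction (sym (lookup-index′ (List.lookup gs j)))
      (allPairs-lookup unique j (index (List.lookup gs j)) gt)

  rank : Fin size → ℕ
  rank g = toℕ (index g)

  rank< : ∀ g → rank g < size
  rank< g = subst (rank g <_) length≡ (toℕ<n (index g))

  rank-mono : ∀ g h → h ◁ g → rank g < rank h
  rank-mono g h h◁g with <-cmp (rank g) (rank h)
  ... | tri< lt _ _ = lt
  ... | tri≈ _ eq _ = contradiction [ subst (_◁ g) (sym g≡h) h◁g ] (acyclic g)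
    where
    g≡h : g ≡ h
    g≡h = trans (sym (lookup-index′ g)) (trans (cong (List.lookup gs) (toℕ-injective eq)) (lookup-index′ h))
  ... | tri> _ _ gt = contradiction (subst₂ _◁_ (sym (lookup-index′ h)) (sym (lookup-index′ g)) h◁g)
    (allPairs-lookup (proj₂ topological) (index h) (index g) gt)

  size≤ : size ≤ lg w
  size≤ = ≤tokens⇒≤lg (≤-trans (≤-reflexive (sym length≡)) (length-gates C gs b))

  <K : ∀ {x} → x < size → x < K
  <K lt = <-trans (≤-trans lt (≤-trans size≤ (lg≤ w))) (w<bound w)

  -- If k > lg w, then no vector is short enough to occur in the encoding.
  Dimension : ℕ → Set
  Dimension kn = kn ≤ lg w × ((kn ≡ k × k ≤ lg w) ⊎ (kn ≡ 0 × lg w < k))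

  dimension : ∃ Dimension
  dimension with k ≤? lg w
  ... | yes k≤ = k , k≤ , inj₁ (refl , k≤)
  ... | no k≰  = 0 , z≤n , inj₂ (refl , ≰⇒> k≰)

  valueCode : ℕ∞ k → ℕ
  valueCode ∞       = 0
  valueCode (fin a) with k ≤? lg w
  ... | yes _ = suc (code R (lookup a))
  -- A vector that occurs in the encoding has at least `k` tokens, so `k ≤ lg w` for it. For
  -- `k > lg w` the value 0 makes the clause of `Valid` for the dimension 0 true.
  ... | no _  = 0

  Short : ℕ∞ k → Set
  Short a = length (value a) ≤ length (tokens C gs b)

  valueCode< : ∀ a → Short a → valueCode a < K
  valueCode< ∞       h = 1≤bound w
  valueCode< (fin a) h with k ≤? lg w
  ... | no _   = 1≤bound w
  ... | yes k≤ = ≤-trans (s≤s (≤-trans (code< R (lookup a) (λ i → <-trans-≤ (components (fin a) h i)))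
      (^-monoʳ-≤ R {{>-nonZero (1≤radix w)}} k≤))) (smash<bound w)
    where
    <-trans-≤ : ∀ {x} → x < suc w → x < R
    <-trans-≤ lt = ≤-trans lt (w<radix w)

  coded : ∀ {kn} → Dimension kn → ∀ a → Short a → CodedValue kn R (valueCode a) a
  coded dim ∞ h = inf
  coded (_ , dim) (fin a) h with k ≤? lg w
  coded (_ , inj₁ (eq , _))  (fin a) h | yes k≤ =
      vec eq (digit-code R (lookup a) (λ i → ≤-trans (components (fin a) h i) (w<radix w)))
  coded (_ , inj₂ (_ , gt))  (fin a) h | yes k≤ = contradiction k≤ (<⇒≱ gt)
  coded dim                  (fin a) h | no k≰  = contradiction (≤tokens⇒≤lg (≤-trans (length-vector a) h)) k≰

  gate-kind gate-left gate-right gate-value : Gate U k size → ℕ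
  gate-kind (input _)            = 0
  gate-kind (complement _ _)     = 1
  gate-kind (binary σ _ _ _ _)   = opNumber σ
  gate-left (input _)            = 0
  gate-left (complement _ h)     = toℕ h
  gate-left (binary _ _ g₁ _ _)  = toℕ g₁
  gate-right (input _)           = 0
  gate-right (complement _ _)    = 0
  gate-right (binary _ _ _ g₂ _) = toℕ g₂
  gate-value (input a)           = valueCode a
  gate-value (complement _ _)    = 0
  gate-value (binary _ _ _ _ _)  = 0

  opNumber-range : ∀ σ → 2 ≤ opNumber σ × opNumber σ ≤ 5
  opNumber-range cup   = m≤m+n 2 0 , m≤m+n 2 3
  opNumber-range cap   = m≤m+n 2 1 , m≤m+n 3 2
  opNumber-range plus  = m≤m+n 2 2 , m≤m+n 4 1
  opNumber-range minus = m≤m+n 2 3 , m≤m+n 5 0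

  gate-kind≤ : ∀ γ → gate-kind γ ≤ 5
  gate-kind≤ (input _)          = z≤n
  gate-kind≤ (complement _ _)   = s≤s z≤n
  gate-kind≤ (binary σ _ _ _ _) = proj₂ (opNumber-range σ)

  gate-left< : ∀ γ → gate-left γ < K
  gate-left< (input _)            = 1≤bound w
  gate-left< (complement _ h)     = <K (toℕ<n h)
  gate-left< (binary _ _ g₁ _ _)  = <K (toℕ<n g₁)

  gate-right< : ∀ γ → gate-right γ < K
  gate-right< (input _)           = 1≤bound w
  gate-right< (complement _ _)    = 1≤bound w
  gate-right< (binary _ _ _ g₂ _) = <K (toℕ<n g₂)

  gate-value< : ∀ γ → (∀ a → γ ≡ input a → Short a) → gate-value γ < K
  gate-value< (input a)          h = valueCode< a (h a refl)
  gate-value< (complement _ _)   h = 1≤bound w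
  gate-value< (binary _ _ _ _ _) h = 1≤bound w

  short-input : ∀ g a → gate g ≡ input a → Short a
  short-input g a = length-input C gs b (complete g)

  ord rk kd p₁ p₂ vl bc : ℕ
  ord = code K (λ j → toℕ (List.lookup gs j))
  rk  = code K rank
  kd  = code K (gate-kind ∘ gate)
  p₁  = code K (gate-left ∘ gate)
  p₂  = code K (gate-right ∘ gate)
  vl  = code K (gate-value ∘ gate)
  bc  = valueCode b

  private
    D : ℕ → ℕ → ℕ
    D = digitAt K

  kd< : ∀ g → gate-kind (gate g) < K
  kd< g = ≤-trans (s≤s (gate-kind≤ (gate g))) (≤-trans (m≤m+n 6 2) (≤-trans (m≤n+m 8 R) (radix≤bound w)))

  ord≡ : ∀ j → D ord (toℕ j) ≡ toℕ (List.lookup gs j)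
  ord≡ = digit-code K _ (λ j → <K (toℕ<n (List.lookup gs j)))
  rk≡ : ∀ g → D rk (toℕ g) ≡ rank g
  rk≡ = digit-code K _ (λ g → <K (rank< g))
  kd≡ : ∀ g → D kd (toℕ g) ≡ gate-kind (gate g)
  kd≡ = digit-code K _ kd<
  p₁≡ : ∀ g → D p₁ (toℕ g) ≡ gate-left (gate g)
  p₁≡ = digit-code K _ (gate-left< ∘ gate)
  p₂≡ : ∀ g → D p₂ (toℕ g) ≡ gate-right (gate g)
  p₂≡ = digit-code K _ (gate-right< ∘ gate)
  vl≡ : ∀ g → D vl (toℕ g) ≡ gate-value (gate g)
  vl≡ = digit-code K _ (λ g → gate-value< (gate g) (short-input g))

  bc< : bc < K
  bc< = valueCode< b (length-output C gs b)

  coded-gate : ∀ {kn} → Dimension kn → ∀ γ → (∀ a → γ ≡ input a → Short a) →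
    Coded kn R γ (gate-kind γ) (gate-left γ) (gate-right γ) (gate-value γ)
  coded-gate dim (input a)          h = input (coded dim a (h a refl))
  coded-gate dim (complement _ _)   h = complement
  coded-gate dim (binary _ _ _ _ _) h = binary

  description : ∀ {kn} → Dimension kn → Description C gs b w kn ord kd p₁ p₂ vl bc
  description {kn} dim = record
    { gates  = λ g → coded-cong (sym (kd≡ g)) (sym (p₁≡ g)) (sym (p₂≡ g)) (sym (vl≡ g))
        (coded-gate dim (gate g) (short-input g))
    ; yields = coded dim b (length-output C gs b)
    ; listed = length≡
    ; order  = ord≡
    }
    where
    coded-cong : ∀ {γ : Gate U k size} {κ κ′ q q′ r r′ v v′} → κ ≡ κ′ → q ≡ q′ → r ≡ r′ → v ≡ v′ →
        Coded kn R γ κ q r v → Coded kn R γ κ′ q′ r′ v′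
    coded-cong refl refl refl refl c = c

  byIndex : ∀ {P : ℕ → Set} → (∀ (i : Fin size) → P (toℕ i)) → ∀ i → i < size → P i
  byIndex {P} h i lt = subst P (toℕ-fromℕ< lt) (h (fromℕ< lt))

  Ordered : ℕ → Set
  Ordered g = D kd g ≡ 0 ⊎ (D p₁ g < size × D rk g < D rk (D p₁ g) ×
    (D kd g ≡ 1 ⊎ (2 ≤ D kd g × D kd g ≤ 5 × D p₂ g < size × D rk g < D rk (D p₂ g) × D p₁ g ≤ D p₂ g)))

  ordered : ∀ g → Ordered (toℕ g)
  ordered g = go (gate g) refl
    where
    ranks : ∀ {p} h → p ≡ toℕ h → h ◁ g → D rk (toℕ g) < D rk p
    ranks h refl h◁g = subst₂ _<_ (sym (rk≡ g)) (sym (rk≡ h)) (rank-mono g h h◁g)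
    go : ∀ γ → gate g ≡ γ → Ordered (toℕ g)
    go (input a) eq = inj₁ (trans (kd≡ g) (cong gate-kind eq))
    go (complement o h) eq = inj₂ (subst (_< size) (sym left′) (toℕ<n h) ,
        ranks h left′ (subst (h ∈ₗ_) (cong predecessors (sym eq)) (here refl)) ,
        inj₁ (trans (kd≡ g) (cong gate-kind eq)))
      where
      left′ : D p₁ (toℕ g) ≡ toℕ h
      left′ = trans (p₁≡ g) (cong gate-left eq)
    go (binary σ o g₁ g₂ le) eq = inj₂ (subst (_< size) (sym left′) (toℕ<n g₁) ,
        ranks g₁ left′ (subst (g₁ ∈ₗ_) (cong predecessors (sym eq)) (here refl)) ,
        inj₂ (subst (2 ≤_) (sym kind) (proj₁ (opNumber-range σ)) ,
            subst (_≤ 5) (sym kind) (proj₂ (opNumber-range σ)) ,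
          subst (_< size) (sym right′) (toℕ<n g₂) ,
              ranks g₂ right′ (subst (g₂ ∈ₗ_) (cong predecessors (sym eq)) (there (here refl))) ,
          subst₂ _≤_ (sym left′) (sym right′) le))
      where
      left′ : D p₁ (toℕ g) ≡ toℕ g₁
      left′ = trans (p₁≡ g) (cong gate-left eq)
      right′ : D p₂ (toℕ g) ≡ toℕ g₂
      right′ = trans (p₂≡ g) (cong gate-right eq)
      kind : D kd (toℕ g) ≡ opNumber σ
      kind = trans (kd≡ g) (cong gate-kind eq)

  valid : ∀ {kn} → Dimension kn → Valid w kn size (toℕ output) ord rk kd p₁ p₂ vl bc
  valid {kn} dim = size≤ , proj₁ dim , vectors (proj₂ dim) , toℕ<n output , bc< , orders , byIndex gates-ok
    where
    no-value : lg w < k → ∀ a → valueCode a ≡ 0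
    no-value gt ∞       = refl
    no-value gt (fin a) with k ≤? lg w
    ... | yes k≤ = contradiction k≤ (<⇒≱ gt)
    ... | no _   = refl
    vectors : (kn ≡ k × k ≤ lg w) ⊎ (kn ≡ 0 × lg w < k) →
        1 ≤ kn ⊎ (bc ≡ 0 × (∀ g → g < size → D kd g ≡ 0 → D vl g ≡ 0))
    vectors (inj₁ (kn≡k , _)) = inj₁ (subst (1 ≤_) (sym kn≡k) 1≤k)
    vectors (inj₂ (_ , gt))   = inj₂ (no-value gt b , byIndex (λ g _ → trans (vl≡ g) (zero-value (gate g))))
      where
      zero-value : ∀ γ → gate-value γ ≡ 0
      zero-value (input a)          = no-value gt a
      zero-value (complement _ _)   = refl
      zero-value (binary _ _ _ _ _) = refl
    orders : ∀ j → j < size → D ord j < size × D rk (D ord j) ≡ j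
    orders j lt = subst (λ j → D ord j < size × D rk (D ord j) ≡ j) (toℕ-fromℕ< lt′)
        (subst (_< size) (sym (ord≡ i)) (toℕ<n (List.lookup gs i)) ,
         trans (cong (D rk) (ord≡ i)) (trans (rk≡ (List.lookup gs i)) (cong toℕ (index-lookup i))))
      where
      lt′ : j < length gs
      lt′ = subst (j <_) (sym length≡) lt
      i : Fin (length gs)
      i = fromℕ< lt′
    gates-ok : ∀ g → D rk (toℕ g) < size × D ord (D rk (toℕ g)) ≡ toℕ g × Ordered (toℕ g)
    gates-ok g = subst (_< size) (sym (rk≡ g)) (rank< g) ,
      trans (cong (D ord) (rk≡ g)) (trans (ord≡ (index g)) (cong toℕ (lookup-index′ g))) , ordered g

  certified : ∀ {kn} → Dimension kn → I output b → Certified w kn size (toℕ output) ord rk kd p₁ p₂ vl bc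
  certified {kn} dim b∈ = valid dim , encode-eatCircuit (description dim) w≡ ,
    proj₂ (ref-evaluate (description dim) w≡ complete 1≤k (compat (proj₂ dim)) bc< rank rank< rank-mono) b∈
    where
    compat : (kn ≡ k × k ≤ lg w) ⊎ (kn ≡ 0 × lg w < k) → (kn ≡ k × k ≤ lg w) ⊎ kn ≡ 0
    compat (inj₁ h)       = inj₁ h
    compat (inj₂ (h , _)) = inj₂ h

  -- Covers scalars below `K` as well as arrays of at most `lg w` entries below `K`.
  limit : ℕ
  limit = K + smash K w

  array< : ∀ {n} (f : Fin n → ℕ) → n ≤ lg w → (∀ i → f i < K) → code K f < limit
  array< f n≤ h = ≤-trans (code< K f h) (≤-trans (^-monoʳ-≤ K {{>-nonZero (1≤bound w)}} n≤) (m≤n+m _ K))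

  scalar< : ∀ {x} → x < K → x < limit
  scalar< lt = ≤-trans lt (m≤m+n K _)

  lg<K : ∀ {x} → x ≤ lg w → x < K
  lg<K le = ≤-trans (s≤s (≤-trans le (lg≤ w))) (w<bound w)

-- The decision procedure

certifiedᶠ : Fm 11
certifiedᶠ = validᶠ ∧ app ps-eatCircuit (w ∷ k ∷ n ∷ out ∷ ord ∷ kd ∷ p₁ ∷ p₂ ∷ vl ∷ b ∷ []) ≐ lit 1
           ∧ lit 1 ≼ app ps-evaluate (n ∷ out *′ bound′ w +′ b ∷ w ∷ k ∷ kd ∷ p₁ ∷ p₂ ∷ vl ∷ [])
  where
  b vl p₂ p₁ kd rk ord out n k w : Exp 11
  b   = var 0F
  vl  = var 1F
  p₂  = var 2F
  p₁  = var 3F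
  kd  = var 4F
  rk  = var 5F
  ord = var 6F
  out = var 7F
  n   = var 8F
  k   = var 9F
  w   = var 10F
  _≺_ : ∀ {m} → Exp m → Exp m → Fm m
  e ≺ e′ = lit 1 +′ e ≼ e′
  infix 4 _≺_
  g n⁺ : Exp 12
  g  = var 0F
  n⁺ = var 9F
  D : Exp 12 → Exp 12 → Exp 12
  D = digitAt′ (bound′ (var 11F))
  KD P₁ P₂ VL RK : Exp 12
  KD = D (var 5F) g
  P₁ = D (var 4F) g
  P₂ = D (var 3F) g
  VL = D (var 2F) g
  RK = D (var 6F) g
  validᶠ : Fm 11
  validᶠ = n ≼ lg′ w ∧ k ≼ lg′ w
    ∧ (lit 1 ≼ k ∨ b ≐ lit 0 ∧ ∀< n ∙ (KD ≐ lit 0 ⇒ VL ≐ lit 0))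
    ∧ out ≺ n ∧ b ≺ bound′ w
    ∧ (∀< n ∙ D (var 7F) g ≺ n⁺ ∧ D (var 6F) (D (var 7F) g) ≐ g)
    ∧ ∀< n ∙ RK ≺ n⁺ ∧ D (var 7F) RK ≐ g
      ∧ (KD ≐ lit 0 ∨ P₁ ≺ n⁺ ∧ RK ≺ D (var 6F) P₁
        ∧ (KD ≐ lit 1 ∨ lit 2 ≼ KD ∧ KD ≼ lit 5 ∧ P₂ ≺ n⁺ ∧ RK ≺ D (var 6F) P₂ ∧ P₁ ≼ P₂))

-- `Valid` and `Certified` copy the formula connective by connective, and `u < v` unfolds to
-- `suc u ≤ v`, the meaning of `≺`; so both sides agree by computation.
certifiedᶠ-correct : ∀ {w k n out ord rk kd p₁ p₂ vl b} →
  ⟦ certifiedᶠ ⟧ᶠ (b ∷ vl ∷ p₂ ∷ p₁ ∷ kd ∷ rk ∷ ord ∷ out ∷ n ∷ k ∷ w ∷ [])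
      ≡ Certified w k n out ord rk kd p₁ p₂ vl b
certifiedᶠ-correct = refl

-- Guessing becomes exhaustive search: each quantifier costs a counter of polynomial length, and
-- time is free. `limit` is given the index of `w` below the quantifiers passed so far.
certificateᶠ : Fm 1
certificateᶠ = ∃< limit 0F ∙ ∃< limit 1F ∙ ∃< limit 2F ∙ ∃< limit 3F ∙ ∃< limit 4F ∙ ∃< limit 5F ∙ ∃< limit 6F
    ∙
               ∃< limit 7F ∙ ∃< limit 8F ∙ ∃< limit 9F ∙ certifiedᶠ
  where
  limit : ∀ {m} → Fin m → Exp m
  limit i = bound′ (var i) +′ smash′ (bound′ (var i)) (var i)

decision : Vec ℕ 1 → ℕ
decision = χ certificateᶠ

decision-sound : ∀ v → 1 ≤ decision (numeral v ∷ []) → MC* U v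
decision-sound v h with proj₁ (reflects certificateᶠ (numeral v ∷ [])) h
... | k , _ , n , _ , out , _ , ord , _ , rk , _ , kd , _ , p₁ , _ , p₂ , _ , vl , _ , b , _ , cert =
  certified⇒MC* (subst id (certifiedᶠ-correct {numeral v} {k} {n} {out} {ord} {rk} {kd} {p₁} {p₂} {vl} {b})
      cert) v refl

decision-complete : ∀ v → MC* U v → 1 ≤ decision (numeral v ∷ [])
decision-complete v (k , 1≤k , C , b , gs , topological , v≡ , b∈) =
    proj₂ (reflects certificateᶠ (numeral v ∷ []))
    (kn , scalar< (lg<K (proj₁ dim)) , size , scalar< (lg<K size≤) , toℕ output ,
        scalar< (<K (toℕ<n output)) ,
     ord , array< _ gs≤ (λ j → <K (toℕ<n (List.lookup gs j))) , rk , array< rank size≤ (<K ∘ rank<) ,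
     kd , array< (gate-kind ∘ gate) size≤ kd< , p₁ , array< (gate-left ∘ gate) size≤ (gate-left< ∘ gate) ,
     p₂ , array< (gate-right ∘ gate) size≤ (gate-right< ∘ gate) ,
     vl , array< (gate-value ∘ gate) size≤ (λ g → gate-value< (gate g) (short-input g)) , bc , scalar< bc< ,
     subst id (sym (certifiedᶠ-correct {numeral v} {kn} {size} {toℕ output} {ord} {rk} {kd} {p₁} {p₂} {vl}
         {bc})) (certified dim b∈))
  where
  open Circuit C
  open Completeness 1≤k C gs b topological (cong numeral v≡)
  kn = proj₁ dimension
  dim = proj₂ dimension
  gs≤ : length gs ≤ lg (numeral v)
  gs≤ = ≤-trans (≤-reflexive length≡) size≤

-- Polynomial space

infixl 6 _⊞_

_⊞_ : List ℕ → List ℕ → List ℕ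
[]      ⊞ q       = q
(a ∷ p) ⊞ []      = a ∷ p
(a ∷ p) ⊞ (b ∷ q) = (a + b) ∷ (p ⊞ q)

eval-⊞ : ∀ p q x → polynomial (p ⊞ q) x ≡ polynomial p x + polynomial q x
eval-⊞ []      q       x = refl
eval-⊞ (a ∷ p) []      x = sym (+-identityʳ _)
eval-⊞ (a ∷ p) (b ∷ q) x = begin
  a + b + x * polynomial (p ⊞ q) x                      ≡⟨ cong (λ y → a + b + x * y) (eval-⊞ p q x) ⟩
  a + b + x * (polynomial p x + polynomial q x)         ≡⟨ cong (a + b +_)
      (*-distribˡ-+ x (polynomial p x) _) ⟩
  a + b + (x * polynomial p x + x * polynomial q x)     ≡⟨ interchange a b (x * polynomial p x)
      (x * polynomial q x) ⟩
  a + x * polynomial p x + (b + x * polynomial q x)     ∎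
  where
  open ≡-Reasoning
  open import Algebra.Properties.CommutativeSemigroup +-commutativeSemigroup using (interchange)

scale : ℕ → List ℕ → List ℕ
scale c []      = []
scale c (a ∷ p) = c * a ∷ scale c p

eval-scale : ∀ c p x → polynomial (scale c p) x ≡ c * polynomial p x
eval-scale c []      x = sym (*-zeroʳ c)
eval-scale c (a ∷ p) x = begin
  c * a + x * polynomial (scale c p) x ≡⟨ cong (λ y → c * a + x * y) (eval-scale c p x) ⟩
  c * a + x * (c * polynomial p x)     ≡⟨ cong (c * a +_) (x∙yz≈y∙xz x c (polynomial p x)) ⟩
  c * a + c * (x * polynomial p x)     ≡⟨ *-distribˡ-+ c a _ ⟨
  c * (a + x * polynomial p x)         ∎
  where
  open ≡-Reasoning
  open import Algebra.Properties.CommutativeSemigroup *-commutativeSemigroup using (x∙yz≈y∙xz)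

powers : ℕ → ℕ → List ℕ
powers a zero    = 1 ∷ []
powers a (suc c) = scale a (powers a c) ⊞ (0 ∷ powers a c)

eval-powers : ∀ a c x → polynomial (powers a c) x ≡ (a + x) ^ c
eval-powers a zero    x = cong suc (*-zeroʳ x)
eval-powers a (suc c) x = begin
  polynomial (scale a (powers a c) ⊞ (0 ∷ powers a c)) x               ≡⟨ eval-⊞ (scale a (powers a c))
      (0 ∷ powers a c) x ⟩
  polynomial (scale a (powers a c)) x + x * polynomial (powers a c) x  ≡⟨ cong₂ (λ y z → y + x * z)
      (eval-scale a (powers a c) x) (eval-powers a c x) ⟩
  a * polynomial (powers a c) x + x * (a + x) ^ c                      ≡⟨ cong (λ y → a * y + x * (a + x) ^ c)
      (eval-powers a c x) ⟩
  a * (a + x) ^ c + x * (a + x) ^ c                                    ≡⟨ *-distribʳ-+ ((a + x) ^ c) a x ⟨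
  (a + x) * (a + x) ^ c                                                ∎
  where open ≡-Reasoning

ps⇒PSPACE : ∀ {f : Vec ℕ 1 → ℕ} → PS f → (L : Language) →
  (∀ w → (1 ≤ f (numeral w ∷ []) → L w) × (L w → 1 ≤ f (numeral w ∷ []))) → L ∈ PSPACE
ps⇒PSPACE {f} ps L reflectsL = machine , scale (suc d) ((2 ∷ []) ⊞ powers 3 degree) , proj₁ correct ,
    λ w t → ≤-trans (proj₂ correct w t) (≤-reflexive (sym (space≡ (length w))))
  where
  open Machine (PS.prog ps zero (zero ∷ []))
  open TuringMachine machine using (Decides; RunsInSpace)
  degree : ℕ
  -- The successor keeps the exponent positive, so that the input itself stays within the bound.
  degree = suc (PS.deg ps)
  ℓ : ℕ → ℕ
  -- A numeral with `n` digits can reach `2 ^ (n + 1) - 2`, so the length to start from is `suc n`.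
  -- The base of the power is then `3 + n`, which `powers 3 degree` expands.
  ℓ n = poly degree (suc n)
  runs : ∀ w → length w ≤ ℓ (length w) × numeral w < 2 ^ ℓ (length w) ×
    Run (ℓ (length w)) (PS.prog ps zero (zero ∷ [])) (numeral w ∷ []) (f (numeral w ∷ []) ∷ [])
  runs w = ≤-trans (n≤1+n _) L≤ , 2^-mono L≤ small-numeral ,
      run-mono (poly-deg (suc (length w)) (n≤1+n (PS.deg ps)))
          (PS.assigns ps (suc (length w)) (numeral w ∷ []) zero (zero ∷ []) (below-∷ small-numeral (mk λ ())))
    where
    L≤ : suc (length w) ≤ ℓ (length w)
    L≤ = poly-id (PS.deg ps) (suc (length w))
    small-numeral : numeral w < 2 ^ suc (length w)
    small-numeral = ≤-trans (n≤1+n _) (<2^length w)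
  correct : Decides L × RunsInSpace (λ n → suc d * suc (suc (ℓ n)))
  correct = decides L (λ v → f (v ∷ [])) ℓ runs reflectsL
  space≡ : ∀ n → polynomial (scale (suc d) ((2 ∷ []) ⊞ powers 3 degree)) n ≡ suc d * suc (suc (ℓ n))
  space≡ n = begin
    polynomial (scale (suc d) ((2 ∷ []) ⊞ powers 3 degree)) n        ≡⟨ eval-scale (suc d)
        ((2 ∷ []) ⊞ powers 3 degree) n ⟩
    suc d * polynomial ((2 ∷ []) ⊞ powers 3 degree) n                ≡⟨ cong (suc d *_)
        (eval-⊞ (2 ∷ []) (powers 3 degree) n) ⟩
    suc d * (2 + n * 0 + polynomial (powers 3 degree) n)             ≡⟨ cong₂ (λ y z → suc d * (2 + y + z))
        (*-zeroʳ n) (eval-powers 3 degree n) ⟩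
    suc d * (2 + (3 + n) ^ degree)                                   ∎
    where open ≡-Reasoning

theorem6 : MC* U ∈ PSPACE
theorem6 = ps⇒PSPACE (ps-χ certificateᶠ) (MC* U) (λ w → decision-sound w , decision-complete w)
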